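{- Let $k>\ell\ge1$ be integers, $\lambda\in[0,k+\ell-5]$, $m\ge\max\{7,k+\ell-1,5T(\frac1{k+\ell})\}$, and let $p=(k+\ell)m+2+\lambda$ be prime; let $n\ge2$. Let $A\subset\mathbb F_p^n$ be a nontrivial $(k,\ell)$-sum-free set with $|A|\ge mp^{n-1}$. If there exists a decomposition $(v,K)$ of $\mathbb F_p^n$ with $\omega\le m+1$, then $A$ is normal up to isomorphism.
   Context: $hX=\{x_1+\dots+x_h:x_i\in X\}$; $A$ is $(k,\ell)$-sum-free if $A\ne\emptyset$ and $kA\cap\ell A=\emptyset$. Subsets of $\mathbb F_p^n$ are isomorphic if an automorphism of the additive group maps one onto the other. $[a,b]=\{a,\dots,b\}\subseteq\mathbb F_p$ (cyclic). A decomposition $(v,K)$: $K$ a subspace of dimension $n-1$, $v\notin K$; $\omega$ = number of $i\in\mathbb F_p$ with $(A-iv)\cap K\ne\emptyset$. Extremal cuboids: $A_{k,\ell,p,j}=[a_j,a_j+m]\times\mathbb F_p^{n-1}$, $a_j=-(km+1+j)(k-\ell)^{ -1}$, $j\in[0,\lceil\frac{\lambda+1}2\rceil-1]$; trivial = isomorphic to a subset of some extremal cuboid; nontrivial otherwise. Normal means type 1 or type 2, where for $|A|=mp^{n-1}$: type 1: $A$ isomorphic to $[a,a+m-1]\times\mathbb F_p^{n-1}$ with $\ell a-k(a+m-1)\in[1,\ell]$ or $\in[\lambda+\ell+2,k]$ (latter only if $\lambda+\ell+2\le k$); type 2: $\ell=1$, $n\ge2$, $A$ isomorphic to $(\{a\}\times(\mathbb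 F_p^{n-1}\setminus V))\sqcup([a+1,a+m-1]\times\mathbb F_p^{n-1})\sqcup(\{a+m\}\times V)$ with $a=mk(\ell-k)^{ -1}$ and $V$ a proper subspace. The function $T$: a finite $X\subseteq\mathbb F_p$ has the covering property if it lies in an arithmetic progression of length $|X+X|-|X|+1$; for $c\in(0,1)$, $\tau\in(0,1]$ is feasible for $c$ if (for every prime $p$) every $X\subseteq\mathbb F_p$ with $|X|\le cp$ and $|X+X|\le(2+\tau)|X|-3$ has the covering property; $T(c)=1/\tau(c)$ with $\tau(c)$ the supremum of feasible $\tau$. -}

module Defs where

open import Data.Nat using (ℕ; zero; suc; _+_; _*_; _∸_; _≤_; _<_; _≤ᵇ_; NonZero; ⌈_/2⌉)
open import Data.Nat.DivMod using (_mod_)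
open import Data.Nat.Primality using (Prime)
open import Data.Fin using (Fin; toℕ) renaming (_≟_ to _≟F_)
open import Data.Vec using (Vec; []; _∷_; zipWith; replicate; foldr)
import Data.Vec as V
open import Data.Vec.Properties using (≡-dec)
open import Data.Vec.Relation.Unary.All using (All)
open import Data.List using (List; length; filterᵇ; allFin; concatMap)
open import Data.Bool.ListAction using (any)
import Data.List as L
open import Data.Bool using (Bool; true; false; _∧_; _∨_; not)
open import Data.Product using (Σ; ∃; ∃-syntax; _×_; _,_)
open import Data.Sum using (_⊎_)
open import Data.Empty using (⊥)
open import Relation.Nullary using (¬_)
open import Relation.Nullary.Decidable using (⌊_⌋)
open import Relation.Binary.PropositionalEquality using (_≡_)
open import Function.Bundles using (_⇔_)

module _ {p : ℕ} .{{_ : NonZero p}} where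

  ι : ℕ → Fin p
  ι n = n mod p

  infixl 6 _+F_ _-F_
  infixl 7 _*F_

  _+F_ : Fin p → Fin p → Fin p
  a +F b = ι (toℕ a + toℕ b)

  _*F_ : Fin p → Fin p → Fin p
  a *F b = ι (toℕ a * toℕ b)

  -F_ : Fin p → Fin p
  -F a = ι (p ∸ toℕ a)

  _-F_ : Fin p → Fin p → Fin p
  a -F b = a +F (-F b)

  _^F_ : Fin p → ℕ → Fin p
  a ^F zero = ι 1
  a ^F suc e = a *F (a ^F e)

  -- multiplicative inverse (Fermat): a⁻¹ = a^(p-2) for a ≠ 0, p prime
  invF : Fin p → Fin p
  invF a = a ^F (p ∸ 2)

  _==F_ : Fin p → Fin p → Bool
  a ==F b = ⌊ a ≟F b ⌋

  -- cyclic interval [x,y] = {x, x+1, …, y} ⊆ 𝔽_p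
  inIntB : Fin p → Fin p → Fin p → Bool
  inIntB x y z = toℕ (z -F x) ≤ᵇ toℕ (y -F x)

Pt : ℕ → ℕ → Set
Pt p n = Vec (Fin p) n

SubsetF : ℕ → ℕ → Set
SubsetF p n = Pt p n → Bool

allFinVec : (p n : ℕ) → List (Pt p n)
allFinVec p zero = [] L.∷ L.[]
allFinVec p (suc n) = concatMap (λ x → L.map (x ∷_) (allFinVec p n)) (allFin p)

card : {p n : ℕ} → SubsetF p n → ℕ
card {p} {n} A = length (filterᵇ A (allFinVec p n))

module _ {p : ℕ} .{{_ : NonZero p}} where

  infixl 6 _⊕_ _⊖_
  infixr 7 _·_

  _⊕_ : {n : ℕ} → Pt p n → Pt p n → Pt p n
  _⊕_ = zipWith _+F_

  _·_ : {n : ℕ} → Fin p → Pt p n → Pt p n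
  c · x = V.map (c *F_) x

  ⊖_ : {n : ℕ} → Pt p n → Pt p n
  ⊖ x = V.map -F_ x

  _⊖_ : {n : ℕ} → Pt p n → Pt p n → Pt p n
  x ⊖ y = x ⊕ (⊖ y)

  𝟘 : {n : ℕ} → Pt p n
  𝟘 = replicate _ (ι 0)

  sumPts : {n h : ℕ} → Vec (Pt p n) h → Pt p n
  sumPts = foldr _ _⊕_ 𝟘

  InSumset : {n : ℕ} → ℕ → SubsetF p n → Pt p n → Set
  InSumset {n} h A x =
    Σ (Vec (Pt p n) h) λ as → All (λ a → A a ≡ true) as × sumPts as ≡ x

  SumFree : {n : ℕ} → ℕ → ℕ → SubsetF p n → Set
  SumFree {n} k ℓ A =
    (∃ λ (x : Pt p n) → A x ≡ true) × (∀ x → InSumset k A x → InSumset ℓ A x → ⊥)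

  IsAutomorphism : {n : ℕ} → (Pt p n → Pt p n) → Set
  IsAutomorphism {n} φ =
    (∀ x y → φ (x ⊕ y) ≡ φ x ⊕ φ y) ×
    (∃ λ (ψ : Pt p n → Pt p n) → (∀ x → ψ (φ x) ≡ x) × (∀ x → φ (ψ x) ≡ x))

  Iso : {n : ℕ} → SubsetF p n → SubsetF p n → Set
  Iso {n} A B = ∃ λ (φ : Pt p n → Pt p n) → IsAutomorphism φ × (∀ x → A x ≡ B (φ x))

  IsoSub : {n : ℕ} → SubsetF p n → SubsetF p n → Set
  IsoSub {n} A B = ∃ λ (φ : Pt p n → Pt p n) → IsAutomorphism φ × (∀ x → A x ≡ true → B (φ x) ≡ true)

  Subspace : {n : ℕ} → SubsetF p n → Set
  Subspace K =
    K 𝟘 ≡ true ×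
    (∀ x y → K x ≡ true → K y ≡ true → K (x ⊕ y) ≡ true) ×
    (∀ c x → K x ≡ true → K (c · x) ≡ true)

  linComb : {n d : ℕ} → Vec (Fin p) d → Vec (Pt p n) d → Pt p n
  linComb cs bs = sumPts (zipWith _·_ cs bs)

  LinIndep : {n d : ℕ} → Vec (Pt p n) d → Set
  LinIndep {d = d} bs = ∀ cs → linComb cs bs ≡ 𝟘 → cs ≡ replicate d (ι 0)

  HasDim : {n : ℕ} → SubsetF p n → ℕ → Set
  HasDim {n} K d =
    Subspace K ×
    Σ (Vec (Pt p n) d) λ bs →
      LinIndep bs × (∀ x → (K x ≡ true) ⇔ (Σ (Vec (Fin p) d) λ cs → linComb cs bs ≡ x))

  Decomposition : {n : ℕ} → Pt p n → SubsetF p n → Set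
  Decomposition {n} v K = HasDim K (n ∸ 1) × K v ≡ false

  omega : {n : ℕ} → SubsetF p n → Pt p n → SubsetF p n → ℕ
  omega {n} A v K =
    length (filterᵇ (λ i → any (λ a → A a ∧ K (a ⊖ (i · v))) (allFinVec p n))
                    (allFin p))

  cuboid : {n : ℕ} → Fin p → Fin p → SubsetF p n
  cuboid a b [] = false
  cuboid a b (x ∷ _) = inIntB a b x

  extremal : {n : ℕ} → (k ℓ m j : ℕ) → SubsetF p n
  extremal k ℓ m j = cuboid a (a +F ι m)
    where a = (-F ι (k * m + 1 + j)) *F invF (ι k -F ι ℓ)

  Nontrivial : {n : ℕ} → (k ℓ m λ' : ℕ) → SubsetF p n → Set
  Nontrivial k ℓ m λ' A =
    ∀ j → j < ⌈ λ' + 1 /2⌉ → ¬ IsoSub A (extremal k ℓ m j)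

  Type1 : {n : ℕ} → (k ℓ m λ' : ℕ) → SubsetF p n → Set
  Type1 k ℓ m λ' A =
    ∃ λ (a : Fin p) →
      Iso A (cuboid a (a +F ι (m ∸ 1))) ×
      let e = ι ℓ *F a -F ι k *F (a +F ι (m ∸ 1)) in
      (inIntB (ι 1) (ι ℓ) e ≡ true ⊎
       (λ' + ℓ + 2 ≤ k × inIntB (ι (λ' + ℓ + 2)) (ι k) e ≡ true))

  type2Set : {n : ℕ} → Fin p → ℕ → SubsetF p n → SubsetF p (suc n)
  type2Set a m V (x ∷ y) =
    ((x ==F a) ∧ not (V y)) ∨
    inIntB (a +F ι 1) (a +F ι (m ∸ 1)) x ∨
    ((x ==F (a +F ι m)) ∧ V y)

  Type2 : {n : ℕ} → (k ℓ m : ℕ) → SubsetF p n → Set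
  Type2 {zero} k ℓ m A = ⊥
  Type2 {suc n'} k ℓ m A =
    ℓ ≡ 1 × 2 ≤ suc n' ×
    ∃ λ (V : SubsetF p n') →
      Subspace V × (∃ λ (y : Pt p n') → V y ≡ false) ×
      Iso A (type2Set ((ι m *F ι k) *F invF (ι ℓ -F ι k)) m V)

  Normal : {n : ℕ} → (k ℓ m λ' : ℕ) → SubsetF p n → Set
  Normal k ℓ m λ' A = Type1 k ℓ m λ' A ⊎ Type2 k ℓ m A

module _ {q : ℕ} .{{_ : NonZero q}} where

  cardF : (Fin q → Bool) → ℕ
  cardF X = length (filterᵇ X (allFin q))

  sumsetF : (Fin q → Bool) → Fin q → Bool
  sumsetF X z =
    any (λ x → any (λ y → X x ∧ X y ∧ ((x +F y) ==F z)) (allFin q)) (allFin q)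

  Covering : (Fin q → Bool) → Set
  Covering X =
    ∃ λ (a : Fin q) → ∃ λ (d : Fin q) → ∀ x → X x ≡ true →
      ∃ λ (i : ℕ) → i < cardF (sumsetF X) ∸ cardF X + 1 × x ≡ a +F (ι i *F d)

-- τ = a/b (b > 0) is feasible for c = 1/s:
-- τ ∈ (0,1] and for every prime q and X ⊆ 𝔽_q with |X| ≤ q/s and
-- |X+X| ≤ (2+τ)|X| - 3, X has the covering property.
Feasible : (s a b : ℕ) → Set
Feasible s a b =
  0 < a × a ≤ b ×
  (∀ (q : ℕ) (pr : Prime q) .{{_ : NonZero q}} (X : Fin q → Bool) →
     s * cardF X ≤ q →
     b * cardF (sumsetF X) + 3 * b ≤ (2 * b + a) * cardF X →
     Covering X)

-- m ≥ 5 T(1/s), i.e. τ(1/s) = sup{feasible τ} ≥ 5/m: every rational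
-- a/b < 5/m is bounded above by some feasible τ' = a'/b'.
FiveTBound : (s m : ℕ) → Set
FiveTBound s m =
  ∀ (a b : ℕ) → 0 < b → a * m < 5 * b →
    ∃ λ (a' : ℕ) → ∃ λ (b' : ℕ) → 0 < b' × Feasible s a' b' × a * b' ≤ a' * b

{-# OPTIONS --safe #-}
module Submission where

-- Split 𝔽_p^n along (v , K) into p slices.  At most m+1 slices are nonempty, and since N = p^{n-1}
-- is odd, at least m of them have more than N/2 points; let X be m of these and Ω ⊇ X the support.
-- Two slices over X sum to the whole of K, so a k-fold sum of Ω with two terms in X is never an
-- ℓ-fold sum of Ω.  In particular kX ∩ ℓX = ∅, and this forces X into a progression of length m+2:
-- if |2X| ≤ 2m+1 by feasibility of some τ ≥ 4/m, and otherwise because Cauchy–Davenport and Vosper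
-- make |kX| + |ℓX| > p.  (Vosper is needed for |2X| = 2m+2 since the supremum τ(c) need not be
-- attained.)  Along the progression X misses at most two places, so its differences are known
-- exactly, and the disjointness of kX and ℓX pins X down to an interval with at most one hole.
-- The remaining point y of Ω must be adjacent to X, because the sums t y + (k−t)X would otherwise
-- run into ℓX.  If the hull of Ω is again disjoint under k and ℓ the set is trivial; otherwise
-- Ω = X is of type 1, or k y = a for the far end a of X and ℓ = 1, where the slices over y and a
-- have N points in total, which makes the slice over y a coset and its translate the complement
-- of the slice over a.

open import Defs
open import Data.Nat using (ℕ; zero; suc; _+_; _*_; _^_; _∸_; _≤_; _<_; z≤n; s≤s; NonZero; >-nonZero; _≤?_; _%_; _/_; _≤ᵇ_; ⌈_/2⌉)
open import Data.Nat.Properties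
open import Data.Nat.DivMod using (m%n<n; %-distribˡ-+; %-distribˡ-*; m<n⇒m%n≡m; m≡m%n+[m/n]*n; [m+n]%n≡m%n; m<n*o⇒m/o<n)
open import Data.Nat.Divisibility using (divides)
open import Data.Nat.Primality using (Prime; ¬prime[0]; ¬prime[1]; prime⇒irreducible)
open import Data.Nat.Coprimality using (prime⇒coprime; coprime-Bézout)
open import Data.Nat.GCD using (module Bézout)
open import Data.Nat.Tactic.RingSolver using (solve-∀)
open import Data.Fin using (Fin; toℕ; zero; suc) renaming (_≟_ to _≟F_)
open import Data.Fin.Properties using (toℕ-injective; toℕ<n; toℕ-fromℕ<; any?)
open import Data.Fin.Permutation using (permutation)
open import Data.Bool using (Bool; true; false; _∧_; _∨_; not; T?)
open import Data.Bool.Properties using (T-≡; ∧-zeroʳ)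
open import Data.Bool.ListAction using (any)
open import Data.List using (List; []; _∷_; length; filterᵇ; allFin; _++_; concatMap; upTo)
import Data.List as L
open import Data.List.Properties using (length-++; length-map; length-tabulate; length-upTo)
open import Data.List.Membership.Propositional using (_∈_; lose)
open import Data.List.Membership.Propositional.Properties using (∈-∃++; ∈-++⁺ˡ; ∈-++⁺ʳ; ∈-++⁻; ∈-filter⁺; ∈-filter⁻; ∈-allFin; ∈-map⁺; ∈-map⁻; ∈-concatMap⁺; ∈-upTo⁺; ∈-upTo⁻; ∈-length)
open import Data.List.Relation.Unary.Any using (here; there)
open import Data.List.Relation.Unary.All using (All; []; _∷_)
import Data.List.Relation.Unary.All as All
import Data.List.Relation.Unary.All.Properties as AllP
open import Data.List.Relation.Unary.AllPairs using ([]; _∷_)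
import Data.List.Relation.Unary.AllPairs as AP
import Data.List.Relation.Unary.AllPairs.Properties as APP
open import Data.List.Relation.Unary.Unique.Propositional using (Unique)
import Data.List.Relation.Unary.Unique.Propositional.Properties as Uq
open import Data.Vec using (Vec; []; _∷_)
open import Data.Vec.Properties using (≡-dec; zipWith-assoc; zipWith-comm; zipWith-identityˡ; zipWith-identityʳ; zipWith-inverseˡ; zipWith-inverseʳ; ∷-injective)
import Data.Vec.Relation.Unary.All as VAll
open import Data.Product using (_×_; _,_; ∃; proj₁; proj₂)
open import Data.Sum using (_⊎_; inj₁; inj₂)
import Data.Sum
open import Data.Empty using (⊥; ⊥-elim)
open import Function using (_∘_; Equivalence)
open import Level using (0ℓ)
open import Relation.Nullary using (Dec; ¬_; yes; no; ¬?; _×-dec_)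
open import Relation.Nullary.Decidable using (⌊_⌋)
open import Relation.Binary.PropositionalEquality
open import Algebra.Bundles using (AbelianGroup; CommutativeRing)
open import Algebra.Structures using (IsGroup)
import Algebra.Properties.AbelianGroup as AG
import Algebra.Properties.CommutativeMonoid.Sum as MSum
import Algebra.Properties.CommutativeSemigroup as CS
import Algebra.Properties.Ring as RP

open ≡-Reasoning

-- Every sum is written as ha + nd, so a coincidence between k-fold and ℓ-fold sums becomes an
-- equation between natural numbers, and the single residue E with ℓa = ka + Ed records where the
-- progression lies. If X has first offset 0 and last offset M, the hulls of kX and ℓX occupy (k +
-- ℓ)M + 2 residues, and g₁ + g₂ residues are left for the two gaps between them. For M = m this
-- leaves λ, for M = m - 1 it leaves k + ℓ + λ, and for M = m + 1 the hulls no longer fit. In the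
-- second case the value of g₁ decides whether the set is trivial, of type 1 or of type 2. The two
-- sides are not symmetric: ℓ may be 1, so two large slices can be demanded only on the side of k.
-- This is why a gap in X is bridged by a difference, whose two ends go to opposite sides, while the
-- second term from X on the side of k stays available. The slice over the remaining point y may
-- hold a single element, so sums involving y must be completed to a coset by two other terms.

infixl 6 _⊹_
infixr 7 _⊗_

-- Linear arithmetic: the hypotheses are summed into P ≤ Q, and the conclusion
-- x ≤ y follows from a semiring identity with slack s.
lin : ∀ {P Q x y} s → P ≤ Q → x + Q + s ≡ y + P → x ≤ y
lin {P} {Q} {x} {y} s P≤Q eq = +-cancelʳ-≤ Q x y
  (≤-trans (m≤m+n (x + Q) s) (≤-trans (≤-reflexive eq) (+-monoʳ-≤ y P≤Q)))

_⊹_ : ∀ {a b c d} → a ≤ b → c ≤ d → a + c ≤ b + d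
_⊹_ = +-mono-≤

_⊗_ : ∀ {a b} c → a ≤ b → c * a ≤ c * b
c ⊗ q = *-monoʳ-≤ c q

halve-≤ : ∀ a b → 2 * a ≤ suc (2 * b) → a ≤ b
halve-≤ a b q = ≮⇒≥ λ b<a → <-irrefl refl (≤-trans (≤-reflexive (sym (*-suc 2 b))) (≤-trans (*-monoʳ-≤ 2 b<a) q))

-- Arithmetic in 𝔽_p.

module _ {p : ℕ} .{{_ : NonZero p}} where

  toℕ-ι : ∀ n → toℕ (ι {p} n) ≡ n % p
  toℕ-ι n = toℕ-fromℕ< (m%n<n n p)

  toℕ-ι-< : ∀ {n} → n < p → toℕ (ι {p} n) ≡ n
  toℕ-ι-< {n} n<p = trans (toℕ-ι n) (m<n⇒m%n≡m n<p)

  ι-toℕ : ∀ (x : Fin p) → ι (toℕ x) ≡ x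
  ι-toℕ x = toℕ-injective (toℕ-ι-< (toℕ<n x))

  ι-% : ∀ {a b} → a % p ≡ b % p → ι {p} a ≡ ι b
  ι-% {a} {b} eq = toℕ-injective (trans (toℕ-ι a) (trans eq (sym (toℕ-ι b))))

  ι-injective : ∀ {a b} → a < p → b < p → ι {p} a ≡ ι b → a ≡ b
  ι-injective a<p b<p eq = trans (sym (toℕ-ι-< a<p)) (trans (cong toℕ eq) (toℕ-ι-< b<p))

  ι-+ : ∀ a b → ι {p} a +F ι b ≡ ι (a + b)
  ι-+ a b = ι-% (trans (cong₂ (λ x y → (x + y) % p) (toℕ-ι a) (toℕ-ι b)) (sym (%-distribˡ-+ a b p)))

  ι-* : ∀ a b → ι {p} a *F ι b ≡ ι (a * b)
  ι-* a b = ι-% (trans (cong₂ (λ x y → (x * y) % p) (toℕ-ι a) (toℕ-ι b)) (sym (%-distribˡ-* a b p)))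

  ι-p+ : ∀ a → ι {p} (a + p) ≡ ι a
  ι-p+ a = ι-% ([m+n]%n≡m%n a p)

  ι-p : ι {p} p ≡ ι 0
  ι-p = ι-p+ 0

  private
    -- Every residue is `ι` of its representative, so the ring laws need checking only on such
    -- values, where `ι-+` and `ι-*` reduce them to laws of ℕ.
    lift1 : ∀ {P : Fin p → Set} → (∀ a → P (ι a)) → ∀ x → P x
    lift1 {P} f x = subst P (ι-toℕ x) (f (toℕ x))

  +F-assoc : ∀ (x y z : Fin p) → (x +F y) +F z ≡ x +F (y +F z)
  +F-assoc = lift1 λ a → lift1 λ b → lift1 λ c →
    trans (cong (_+F ι c) (ι-+ a b)) (trans (ι-+ (a + b) c) (trans (cong ι (+-assoc a b c))
      (sym (trans (cong (ι a +F_) (ι-+ b c)) (ι-+ a (b + c))))))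

  +F-comm : ∀ (x y : Fin p) → x +F y ≡ y +F x
  +F-comm x y = cong ι (+-comm (toℕ x) (toℕ y))

  +F-identityˡ : ∀ (x : Fin p) → ι 0 +F x ≡ x
  +F-identityˡ = lift1 λ a → ι-+ 0 a

  +F-identityʳ : ∀ (x : Fin p) → x +F ι 0 ≡ x
  +F-identityʳ x = trans (+F-comm x (ι 0)) (+F-identityˡ x)

  +F-inverseʳ : ∀ (x : Fin p) → x +F (-F x) ≡ ι 0
  +F-inverseʳ x = trans (cong (_+F (-F x)) (sym (ι-toℕ x)))
    (trans (ι-+ (toℕ x) _) (trans (cong ι (m+[n∸m]≡n (<⇒≤ (toℕ<n x)))) ι-p))

  +F-inverseˡ : ∀ (x : Fin p) → (-F x) +F x ≡ ι 0
  +F-inverseˡ x = trans (+F-comm _ x) (+F-inverseʳ x)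

  *F-assoc : ∀ (x y z : Fin p) → (x *F y) *F z ≡ x *F (y *F z)
  *F-assoc = lift1 λ a → lift1 λ b → lift1 λ c →
    trans (cong (_*F ι c) (ι-* a b)) (trans (ι-* (a * b) c) (trans (cong ι (*-assoc a b c))
      (sym (trans (cong (ι a *F_) (ι-* b c)) (ι-* a (b * c))))))

  *F-comm : ∀ (x y : Fin p) → x *F y ≡ y *F x
  *F-comm x y = cong ι (*-comm (toℕ x) (toℕ y))

  *F-identityˡ : ∀ (x : Fin p) → ι 1 *F x ≡ x
  *F-identityˡ = lift1 λ a → trans (ι-* 1 a) (cong ι (*-identityˡ a))

  *F-identityʳ : ∀ (x : Fin p) → x *F ι 1 ≡ x
  *F-identityʳ x = trans (*F-comm x (ι 1)) (*F-identityˡ x)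

  *F-distribˡ : ∀ (x y z : Fin p) → x *F (y +F z) ≡ x *F y +F x *F z
  *F-distribˡ = lift1 λ a → lift1 λ b → lift1 λ c →
    trans (cong (ι a *F_) (ι-+ b c)) (trans (ι-* a (b + c)) (trans (cong ι (*-distribˡ-+ a b c))
      (sym (trans (cong₂ _+F_ (ι-* a b) (ι-* a c)) (ι-+ (a * b) (a * c))))))

  *F-distribʳ : ∀ (x y z : Fin p) → (y +F z) *F x ≡ y *F x +F z *F x
  *F-distribʳ x y z = trans (*F-comm _ x) (trans (*F-distribˡ x y z) (cong₂ _+F_ (*F-comm x y) (*F-comm x z)))

  private
    +F-isGroup : IsGroup _≡_ (_+F_ {p}) (ι 0) (λ x → -F x)
    +F-isGroup = record
      { isMonoid = record
        { isSemigroup = record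
          { isMagma = record { isEquivalence = isEquivalence ; ∙-cong = cong₂ _+F_ }
          ; assoc = +F-assoc }
        ; identity = +F-identityˡ , +F-identityʳ }
      ; inverse = +F-inverseˡ , +F-inverseʳ
      ; ⁻¹-cong = cong (λ x → -F x) }

  FpRing : CommutativeRing 0ℓ 0ℓ
  FpRing = record
    { Carrier = Fin p ; _≈_ = _≡_ ; _+_ = _+F_ ; _*_ = _*F_ ; -_ = (λ x → -F x) ; 0# = ι 0 ; 1# = ι 1
    ; isCommutativeRing = record
      { isRing = record
        { +-isAbelianGroup = record { isGroup = +F-isGroup ; comm = +F-comm }
        ; *-cong = cong₂ _*F_
        ; *-assoc = *F-assoc
        ; *-identity = *F-identityˡ , *F-identityʳ
        ; distrib = *F-distribˡ , *F-distribʳ }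
      ; *-comm = *F-comm } }

  module Fp = CommutativeRing FpRing
  module FpG = AG Fp.+-abelianGroup
  module FpR = RP Fp.ring
  module FpC = CS Fp.+-commutativeSemigroup

  -F+F-cancel : ∀ (x y : Fin p) → (x -F y) +F y ≡ x
  -F+F-cancel x y = trans (+F-assoc x (-F y) y) (trans (cong (x +F_) (+F-inverseˡ y)) (+F-identityʳ x))

  +F-F-cancel : ∀ (x y : Fin p) → (x +F y) -F y ≡ x
  +F-F-cancel x y = trans (+F-assoc x y (-F y)) (trans (cong (x +F_) (+F-inverseʳ y)) (+F-identityʳ x))

  +F-cancelʳ : ∀ (z x y : Fin p) → x +F z ≡ y +F z → x ≡ y
  +F-cancelʳ z x y eq = trans (sym (+F-F-cancel x z)) (trans (cong (_-F z) eq) (+F-F-cancel y z))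

  +F-cancelˡ : ∀ (z x y : Fin p) → z +F x ≡ z +F y → x ≡ y
  +F-cancelˡ z x y eq = +F-cancelʳ z x y (trans (+F-comm x z) (trans eq (+F-comm z y)))

  +F≡⇒≡-F : ∀ {x y z : Fin p} → x +F y ≡ z → x ≡ z -F y
  +F≡⇒≡-F {x} {y} eq = trans (sym (+F-F-cancel x y)) (cong (_-F y) eq)

  -F≢0 : ∀ {x y : Fin p} → x ≢ y → x -F y ≢ ι 0
  -F≢0 {x} {y} ne e = ne (trans (sym (-F+F-cancel x y)) (trans (cong (_+F y) e) (+F-identityˡ y)))

  neg≢0 : ∀ {d : Fin p} → d ≢ ι 0 → (-F d) ≢ ι 0
  neg≢0 {d} d≢0 e = d≢0 (trans (sym (FpG.⁻¹-involutive d)) (trans (cong (λ w → -F w) e) FpG.ε⁻¹≈ε))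

  *F-zeroˡ : ∀ (x : Fin p) → ι 0 *F x ≡ ι 0
  *F-zeroˡ = Fp.zeroˡ

  *F-zeroʳ : ∀ (x : Fin p) → x *F ι 0 ≡ ι 0
  *F-zeroʳ = Fp.zeroʳ

module _ {p : ℕ} .{{nz : NonZero p}} (pr : Prime p) where

  inverse-exists : ∀ (a : Fin p) → a ≢ ι 0 → ∃ λ b → a *F b ≡ ι 1
  inverse-exists a a≢0 = go (coprime-Bézout (prime⇒coprime pr {{nzn}} (toℕ<n a)))
    where
    nzn : NonZero (toℕ a)
    nzn = >-nonZero (n≢0⇒n>0 λ eq → a≢0 (trans (sym (ι-toℕ a)) (cong ι eq)))
    ιp* : ∀ x → ι {p} (x * p) ≡ ι 0
    ιp* x = trans (sym (ι-* x p)) (trans (cong (ι x *F_) ι-p) (*F-zeroʳ (ι x)))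
    ay : ∀ y → ι y *F a ≡ ι (y * toℕ a)
    ay y = trans (cong (ι y *F_) (sym (ι-toℕ a))) (ι-* y (toℕ a))
    go : Bézout.Identity 1 p (toℕ a) → ∃ λ b → a *F b ≡ ι 1
    go (Bézout.-+ x y eq) = ι y , (begin
      a *F ι y              ≡⟨ *F-comm a (ι y) ⟩
      ι y *F a              ≡⟨ ay y ⟩
      ι (y * toℕ a)         ≡⟨ cong ι (sym eq) ⟩
      ι (1 + x * p)         ≡⟨ sym (ι-+ 1 (x * p)) ⟩
      ι 1 +F ι (x * p)      ≡⟨ cong (ι 1 +F_) (ιp* x) ⟩
      ι 1 +F ι 0            ≡⟨ +F-identityʳ _ ⟩
      ι 1 ∎)
    go (Bézout.+- x y eq) = (-F (ι y)) , (begin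
      a *F (-F (ι y))             ≡⟨ sym (FpR.-‿distribʳ-* a (ι y)) ⟩
      -F (a *F ι y)               ≡⟨ cong (λ z → -F z) (trans (*F-comm a (ι y)) (ay y)) ⟩
      -F (ι (y * toℕ a))          ≡⟨ sym (FpG.inverseˡ-unique (ι 1) _ (trans (ι-+ 1 _) (trans (cong ι eq) (ιp* x)))) ⟩
      ι 1 ∎)

  *F-cancelˡ : ∀ (a x y : Fin p) → a ≢ ι 0 → a *F x ≡ a *F y → x ≡ y
  *F-cancelˡ a x y a≢0 eq = let b , ab = inverse-exists a a≢0
                                r : ∀ z → b *F (a *F z) ≡ z
                                r z = trans (sym (*F-assoc b a z)) (trans (cong (_*F z) (trans (*F-comm b a) ab)) (*F-identityˡ z))
                            in trans (sym (r x)) (trans (cong (b *F_) eq) (r y))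

  *F-nonzero : ∀ {a x : Fin p} → a ≢ ι 0 → x ≢ ι 0 → a *F x ≢ ι 0
  *F-nonzero {a} {x} a≢0 x≢0 eq = x≢0 (*F-cancelˡ a x (ι 0) a≢0 (trans eq (sym (*F-zeroʳ a))))

  1≢0 : ι {p} 1 ≢ ι 0
  1≢0 eq = go p pr refl
    where
    go : ∀ q → Prime q → q ≡ p → ⊥
    go 0 pr′ _ = ¬prime[0] pr′
    go 1 pr′ _ = ¬prime[1] pr′
    go (suc (suc q)) _ e with ι-injective (subst (1 <_) e (s≤s (s≤s z≤n))) (subst (0 <_) e (s≤s z≤n)) eq
    ... | ()

private
  -- The inverses in the extremal and type 2 sets are powers, so Fermat's little theorem is
  -- required. Multiplication by a permutes 𝔽_p; `unit-part` replaces 0 by 1, so that the product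
  -- over all residues is nonzero and can be compared with its permuted form. Accordingly `factor`
  -- is 1 at 0.
  module Fermat (p′ : ℕ) (pr : Prime (suc p′)) (a : Fin (suc p′)) (a≢0 : a ≢ ι 0) where

    private
      p = suc p′
      module Π = MSum (Fp.*-commutativeMonoid {p})

    unit-part : Fin p → Fin p
    unit-part zero = ι 1
    unit-part (suc i) = suc i

    unit-part-nonzero : ∀ x → unit-part x ≢ ι 0
    unit-part-nonzero zero = 1≢0 pr
    unit-part-nonzero (suc x) ()

    unit-part-id : ∀ x → x ≢ ι 0 → unit-part x ≡ x
    unit-part-id zero x≢0 = ⊥-elim (x≢0 refl)
    unit-part-id (suc x) _ = refl

    factor : Fin p → Fin p
    factor zero = ι 1
    factor (suc _) = a

    unit-part-* : ∀ x → unit-part (a *F x) ≡ factor x *F unit-part x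
    unit-part-* zero = trans (cong unit-part (*F-zeroʳ a)) (sym (*F-identityˡ _))
    unit-part-* (suc x) = unit-part-id _ (*F-nonzero pr a≢0 (λ ()))

    Π-nonzero : ∀ {n} (f : Fin n → Fin p) → (∀ i → f i ≢ ι 0) → Π.sum f ≢ ι 0
    Π-nonzero {zero} f _ = 1≢0 pr
    Π-nonzero {suc n} f nz = *F-nonzero pr (nz zero) (Π-nonzero _ (λ i → nz (suc i)))

    Π-const : ∀ n → Π.sum {n} (λ _ → a) ≡ a ^F n
    Π-const zero = refl
    Π-const (suc n) = cong (a *F_) (Π-const n)

    power : a ^F p′ ≡ ι 1
    power = sym (*F-cancelˡ pr Πu (ι 1) (a ^F p′) (Π-nonzero _ unit-part-nonzero) (begin
      Πu *F ι 1                        ≡⟨ *F-identityʳ Πu ⟩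
      Πu                               ≡⟨ Π.sum-permute unit-part π ⟩
      Π.sum (λ x → unit-part (a *F x)) ≡⟨ Π.sum-cong-≗ unit-part-* ⟩
      Π.sum (λ x → factor x *F unit-part x) ≡⟨ Π.∑-distrib-+ factor unit-part ⟩
      Π.sum factor *F Πu               ≡⟨ cong (_*F Πu) (trans (*F-identityˡ _) (Π-const p′)) ⟩
      a ^F p′ *F Πu                    ≡⟨ *F-comm _ Πu ⟩
      Πu *F a ^F p′ ∎))
      where
      Πu = Π.sum unit-part
      b = proj₁ (inverse-exists pr a a≢0)
      ab = proj₂ (inverse-exists pr a a≢0)
      π = permutation (a *F_) (b *F_)
            (λ x → trans (sym (*F-assoc a b x)) (trans (cong (_*F x) ab) (*F-identityˡ x)))
            (λ x → trans (sym (*F-assoc b a x)) (trans (cong (_*F x) (trans (*F-comm b a) ab)) (*F-identityˡ x)))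

*F-invF : ∀ {p} .{{_ : NonZero p}} → Prime p → (a : Fin p) → a ≢ ι 0 → a *F invF a ≡ ι 1
*F-invF {zero} pr = ⊥-elim (¬prime[0] pr)
*F-invF {suc zero} pr = ⊥-elim (¬prime[1] pr)
*F-invF {suc (suc p)} pr a a≢0 = Fermat.power (suc p) pr a a≢0

-- Counting

private variable
  α β : Set

∧-true : ∀ {a b} → a ≡ true → b ≡ true → a ∧ b ≡ true
∧-true refl refl = refl

∧-trueˡ : ∀ {a b} → a ∧ b ≡ true → a ≡ true
∧-trueˡ {true} _ = refl

∧-trueʳ : ∀ {a b} → a ∧ b ≡ true → b ≡ true
∧-trueʳ {true} e = e

∨-trueˡ : ∀ {a} b → a ≡ true → a ∨ b ≡ true
∨-trueˡ b refl = refl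

∨-trueʳ : ∀ a {b} → b ≡ true → a ∨ b ≡ true
∨-trueʳ true _ = refl
∨-trueʳ false e = e

∨-true⁻ : ∀ {a b} → a ∨ b ≡ true → a ≡ true ⊎ b ≡ true
∨-true⁻ {true} _ = inj₁ refl
∨-true⁻ {false} e = inj₂ e

not-true⇒false : ∀ {a} → not a ≡ true → a ≡ false
not-true⇒false {false} _ = refl

false⇒not-true : ∀ {a} → a ≡ false → not a ≡ true
false⇒not-true refl = refl

true≢false : ∀ {a} → a ≡ true → a ≡ false → ⊥
true≢false refl ()

¬true⇒false : ∀ {a} → (a ≡ true → ⊥) → a ≡ false
¬true⇒false {true} f = ⊥-elim (f refl)
¬true⇒false {false} _ = refl

bool-case : ∀ a → a ≡ true ⊎ a ≡ false
bool-case true = inj₁ refl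
bool-case false = inj₂ refl

iff⇒≡ : ∀ {a b} → (a ≡ true → b ≡ true) → (b ≡ true → a ≡ true) → a ≡ b
iff⇒≡ {true} f g = sym (f refl)
iff⇒≡ {false} {true} f g = g refl
iff⇒≡ {false} {false} f g = refl

any⁺ : ∀ (f : α → Bool) {xs x} → x ∈ xs → f x ≡ true → any f xs ≡ true
any⁺ f (here refl) e = ∨-trueˡ _ e
any⁺ f {y ∷ _} (there i) e = ∨-trueʳ (f y) (any⁺ f i e)

any⁻ : ∀ (f : α → Bool) xs → any f xs ≡ true → ∃ λ x → f x ≡ true
any⁻ f (x ∷ xs) e with ∨-true⁻ {f x} e
... | inj₁ t = x , t
... | inj₂ t = any⁻ f xs t

cnt : (α → Bool) → List α → ℕ
cnt P xs = length (filterᵇ P xs)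

injection⇒length≤ : (f : α → β) {as : List α} {bs : List β} → Unique as →
  (∀ {x} → x ∈ as → f x ∈ bs) → (∀ {x y} → x ∈ as → y ∈ as → f x ≡ f y → x ≡ y) →
  length as ≤ length bs
injection⇒length≤ f {[]} _ _ _ = z≤n
injection⇒length≤ f {a ∷ as} {bs} (a∉ ∷ u) sub inj with ∈-∃++ (sub (here refl))
... | ys , zs , refl = ≤-trans (s≤s (injection⇒length≤ f u sub′ (λ i j → inj (there i) (there j))))
        (≤-reflexive (trans (cong suc (length-++ ys)) (sym (trans (length-++ ys) (+-suc _ _)))))
  where
  sub′ : ∀ {x} → x ∈ as → f x ∈ ys ++ zs
  sub′ {x} i with ∈-++⁻ ys (sub (there i))
  ... | inj₁ j = ∈-++⁺ˡ j
  ... | inj₂ (there j) = ∈-++⁺ʳ ys j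
  ... | inj₂ (here e) = ⊥-elim (All.lookup a∉ i (sym (inj (there i) (here refl) e)))

filterᵇ⁺ : ∀ (P : α → Bool) {xs x} → x ∈ xs → P x ≡ true → x ∈ filterᵇ P xs
filterᵇ⁺ P i e = ∈-filter⁺ (T? ∘ P) i (Equivalence.from T-≡ e)

filterᵇ⁻ : ∀ (P : α → Bool) {xs x} → x ∈ filterᵇ P xs → x ∈ xs × P x ≡ true
filterᵇ⁻ P {xs} i with ∈-filter⁻ (T? ∘ P) {xs = xs} i
... | j , t = j , Equivalence.to T-≡ t

cnt-≤ : (f : α → β) {P : α → Bool} {Q : β → Bool} {xs : List α} {ys : List β} → Unique xs →
  (∀ y → y ∈ ys) → (∀ x → P x ≡ true → Q (f x) ≡ true) →
  (∀ x y → P x ≡ true → P y ≡ true → f x ≡ f y → x ≡ y) → cnt P xs ≤ cnt Q ys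
cnt-≤ f {P} {Q} {xs} u c PQ inj = injection⇒length≤ f (Uq.filter⁺ (T? ∘ P) u)
  (λ i → filterᵇ⁺ Q (c _) (PQ _ (proj₂ (filterᵇ⁻ P {xs} i))))
  (λ i j → inj _ _ (proj₂ (filterᵇ⁻ P {xs} i)) (proj₂ (filterᵇ⁻ P {xs} j)))

cnt-mono : {P Q : α → Bool} (xs : List α) → (∀ x → P x ≡ true → Q x ≡ true) → cnt P xs ≤ cnt Q xs
cnt-mono [] _ = z≤n
cnt-mono {P = P} {Q} (x ∷ xs) PQ with P x in eP | Q x in eQ
... | true | true = s≤s (cnt-mono xs PQ)
... | true | false = ⊥-elim (true≢false (PQ x eP) eQ)
... | false | true = m≤n⇒m≤1+n (cnt-mono xs PQ)
... | false | false = cnt-mono xs PQ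

cnt-cong : {P Q : α → Bool} (xs : List α) → (∀ x → P x ≡ Q x) → cnt P xs ≡ cnt Q xs
cnt-cong xs PQ = ≤-antisym (cnt-mono xs (λ x e → trans (sym (PQ x)) e)) (cnt-mono xs (λ x e → trans (PQ x) e))

cnt-∨∧ : (P Q : α → Bool) (xs : List α) →
  cnt P xs + cnt Q xs ≡ cnt (λ x → P x ∨ Q x) xs + cnt (λ x → P x ∧ Q x) xs
cnt-∨∧ P Q [] = refl
cnt-∨∧ P Q (x ∷ xs) with P x | Q x
... | true | true = cong suc (trans (+-suc _ _) (trans (cong suc (cnt-∨∧ P Q xs)) (sym (+-suc _ _))))
... | true | false = cong suc (cnt-∨∧ P Q xs)
... | false | true = trans (+-suc _ _) (cong suc (cnt-∨∧ P Q xs))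
... | false | false = cnt-∨∧ P Q xs

cnt-split : (P Q : α → Bool) (xs : List α) →
  cnt P xs ≡ cnt (λ x → P x ∧ Q x) xs + cnt (λ x → P x ∧ not (Q x)) xs
cnt-split P Q [] = refl
cnt-split P Q (x ∷ xs) with P x | Q x
... | true | true = cong suc (cnt-split P Q xs)
... | true | false = trans (cong suc (cnt-split P Q xs)) (sym (+-suc _ _))
... | false | true = cnt-split P Q xs
... | false | false = cnt-split P Q xs

cnt-not : (P : α → Bool) (xs : List α) → cnt P xs + cnt (λ x → not (P x)) xs ≡ length xs
cnt-not P [] = refl
cnt-not P (x ∷ xs) with P x
... | true = cong suc (cnt-not P xs)
... | false = trans (+-suc _ _) (cong suc (cnt-not P xs))

cnt-∃ : (P : α → Bool) (xs : List α) → 1 ≤ cnt P xs → ∃ λ x → P x ≡ true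
cnt-∃ P (x ∷ xs) h with P x in e
... | true = x , e
... | false = cnt-∃ P xs h

cnt-pos : (P : α → Bool) {xs : List α} {x : α} → x ∈ xs → P x ≡ true → 1 ≤ cnt P xs
cnt-pos P i e = ∈-length (filterᵇ⁺ P i e)

cnt-strict : {P Q : α → Bool} (xs : List α) {x : α} → x ∈ xs → (∀ x → P x ≡ true → Q x ≡ true) →
  P x ≡ false → Q x ≡ true → suc (cnt P xs) ≤ cnt Q xs
cnt-strict {P = P} {Q} xs {x} i PQ ¬P q = subst (suc (cnt P xs) ≤_) (sym (cnt-split Q P xs))
  (≤-trans (≤-reflexive (+-comm 1 _)) (+-mono-≤ (cnt-mono xs (λ y e → ∧-true (PQ y e) e))
    (cnt-pos _ i (∧-true q (false⇒not-true ¬P)))))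

cnt-⊆-≥ : {P Q : α → Bool} (xs : List α) → (∀ x → x ∈ xs) → (∀ x → P x ≡ true → Q x ≡ true) →
  cnt Q xs ≤ cnt P xs → ∀ x → Q x ≡ true → P x ≡ true
cnt-⊆-≥ {P = P} xs c PQ h x q with bool-case (P x)
... | inj₁ e = e
... | inj₂ e = ⊥-elim (<-irrefl refl (≤-trans (cnt-strict xs (c x) PQ e q) h))

cnt-all : (P : α → Bool) (xs : List α) → (∀ x → P x ≡ true) → cnt P xs ≡ length xs
cnt-all P [] _ = refl
cnt-all P (x ∷ xs) h rewrite h x = cong suc (cnt-all P xs h)

cnt-none : (P : α → Bool) (xs : List α) → (∀ x → P x ≡ false) → cnt P xs ≡ 0
cnt-none P [] _ = refl
cnt-none P (x ∷ xs) h rewrite h x = cnt-none P xs h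

cnt-≤-length : (P : α → Bool) (xs : List α) → cnt P xs ≤ length xs
cnt-≤-length P xs = ≤-trans (m≤m+n _ _) (≤-reflexive (cnt-not P xs))

cnt-full : (P : α → Bool) (xs : List α) → (∀ x → x ∈ xs) → length xs ≤ cnt P xs → ∀ x → P x ≡ true
cnt-full P xs c h x = cnt-⊆-≥ {P = P} {λ _ → true} xs c (λ _ _ → refl) (≤-trans (cnt-≤-length _ xs) h) x refl

allFinVec-complete : ∀ p n (v : Pt p n) → v ∈ allFinVec p n
allFinVec-complete p zero [] = here refl
allFinVec-complete p (suc n) (x ∷ v) =
  ∈-concatMap⁺ (λ x → L.map (x ∷_) (allFinVec p n)) (lose (∈-allFin x) (∈-map⁺ (x ∷_) (allFinVec-complete p n v)))

allFinVec-unique : ∀ p n → Unique (allFinVec p n)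
allFinVec-unique p zero = [] ∷ []
allFinVec-unique p (suc n) = Uq.concat⁺
  (AllP.map⁺ (All.universal (λ x → Uq.map⁺ (proj₂ ∘ ∷-injective) (allFinVec-unique p n)) _))
  (APP.map⁺ (AP.map (λ {x} {y} x≢y {v} (i , j) →
     x≢y (trans (hd i) (sym (hd j)))) (Uq.allFin⁺ p)))
  where
  hd : ∀ {x : Fin p} {v : Pt p (suc n)} {xs} → v ∈ L.map (x ∷_) xs → x ≡ Data.Vec.head v
  hd i with ∈-map⁻ _ i
  ... | _ , _ , refl = refl

Σl : (α → ℕ) → List α → ℕ
Σl f [] = 0
Σl f (x ∷ xs) = f x + Σl f xs

Σl-mono : ∀ {f g : α → ℕ} xs → (∀ x → f x ≤ g x) → Σl f xs ≤ Σl g xs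
Σl-mono [] _ = z≤n
Σl-mono (x ∷ xs) h = +-mono-≤ (h x) (Σl-mono xs h)

Σl-+ : ∀ (f g : α → ℕ) xs → Σl (λ x → f x + g x) xs ≡ Σl f xs + Σl g xs
Σl-+ f g [] = refl
Σl-+ f g (x ∷ xs) = trans (cong (f x + g x +_) (Σl-+ f g xs)) (+-interchange (f x) (g x) _ _)
  where
  +-interchange : ∀ a b c d → (a + b) + (c + d) ≡ (a + c) + (b + d)
  +-interchange a b c d = trans (+-assoc a b _) (trans (cong (a +_) (trans (sym (+-assoc b c d)) (trans (cong (_+ d) (+-comm b c)) (+-assoc c b d)))) (sym (+-assoc a c _)))

ind : Bool → ℕ → ℕ
ind true n = n
ind false n = 0

Σl-ind : ∀ (P : α → Bool) c xs → Σl (λ x → ind (P x) c) xs ≡ cnt P xs * c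
Σl-ind P c [] = refl
Σl-ind P c (x ∷ xs) with P x
... | true = cong (c +_) (Σl-ind P c xs)
... | false = Σl-ind P c xs

cnt-++ : ∀ (P : α → Bool) xs ys → cnt P (xs ++ ys) ≡ cnt P xs + cnt P ys
cnt-++ P [] ys = refl
cnt-++ P (x ∷ xs) ys with P x
... | true = cong suc (cnt-++ P xs ys)
... | false = cnt-++ P xs ys

cnt-map : ∀ (P : β → Bool) (f : α → β) xs → cnt P (L.map f xs) ≡ cnt (P ∘ f) xs
cnt-map P f [] = refl
cnt-map P f (x ∷ xs) with P (f x)
... | true = cong suc (cnt-map P f xs)
... | false = cnt-map P f xs

card-slices : ∀ {p n} (S : SubsetF p (suc n)) → card S ≡ Σl (λ x → card (λ v → S (x ∷ v))) (allFin p)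
card-slices {p} {n} S = go (allFin p)
  where
  go : ∀ xs → cnt S (concatMap (λ x → L.map (x ∷_) (allFinVec p n)) xs) ≡ Σl (λ x → card (λ v → S (x ∷ v))) xs
  go [] = refl
  go (x ∷ xs) = trans (cnt-++ S (L.map (x ∷_) (allFinVec p n)) _)
    (cong₂ _+_ (cnt-map S (x ∷_) (allFinVec p n)) (go xs))

length-allFin : ∀ p → length (allFin p) ≡ p
length-allFin p = length-tabulate (λ x → x)

length-allFinVec : ∀ p n → length (allFinVec p n) ≡ p ^ n
length-allFinVec p zero = refl
length-allFinVec p (suc n) = trans (go (allFin p)) (cong (_* p ^ n) (length-allFin p))
  where
  go : ∀ xs → length (concatMap (λ x → L.map (x ∷_) (allFinVec p n)) xs) ≡ length xs * p ^ n
  go [] = refl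
  go (x ∷ xs) = trans (length-++ (L.map (x ∷_) (allFinVec p n)))
    (cong₂ _+_ (trans (length-map _ (allFinVec p n)) (length-allFinVec p n)) (go xs))

-- Sumsets in 𝔽_p

module _ {p : ℕ} .{{nz : NonZero p}} where

  private
    Set′ : Set
    Set′ = Fin p → Bool

  ==F-refl : ∀ (x : Fin p) → (x ==F x) ≡ true
  ==F-refl x with x ≟F x
  ... | yes _ = refl
  ... | no ne = ⊥-elim (ne refl)

  ==F⇒≡ : ∀ {x y : Fin p} → (x ==F y) ≡ true → x ≡ y
  ==F⇒≡ {x} {y} e with x ≟F y
  ... | yes q = q

  ≢⇒==F : ∀ {x y : Fin p} → x ≢ y → (x ==F y) ≡ false
  ≢⇒==F {x} {y} ne with x ≟F y
  ... | yes q = ⊥-elim (ne q)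
  ... | no _ = refl

  cardF-inj : ∀ {X Y : Set′} (f : Fin p → Fin p) → (∀ x → X x ≡ true → Y (f x) ≡ true) →
    (∀ x y → f x ≡ f y → x ≡ y) → cardF X ≤ cardF Y
  cardF-inj f XY inj = cnt-≤ f (Uq.allFin⁺ p) ∈-allFin XY (λ x y _ _ → inj x y)

  cardF-mono : ∀ {X Y : Set′} → (∀ x → X x ≡ true → Y x ≡ true) → cardF X ≤ cardF Y
  cardF-mono = cnt-mono (allFin p)

  cardF-pos : ∀ {X : Set′} {x} → X x ≡ true → 1 ≤ cardF X
  cardF-pos {X} = cnt-pos X (∈-allFin _)

  cardF-missing : ∀ {X : Set′} → suc (cardF X) ≤ p → ∃ λ z → X z ≡ false
  cardF-missing {X} h = let z , e = cnt-∃ (not ∘ X) (allFin p) (+-cancelˡ-≤ (cardF X) 1 _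
                              (≤-trans (≤-reflexive (+-comm _ 1)) (≤-trans h (≤-reflexive (sym (trans (cnt-not X (allFin p)) (length-allFin p)))))))
                        in z , not-true⇒false e

  cardF-disjoint : ∀ {X Y Z : Set′} → (∀ x → X x ≡ true → Z x ≡ true) → (∀ x → Y x ≡ true → Z x ≡ true) →
    (∀ x → X x ≡ true → Y x ≡ true → ⊥) → cardF X + cardF Y ≤ cardF Z
  cardF-disjoint {X} {Y} {Z} XZ YZ dis = ≤-trans (≤-reflexive (cnt-∨∧ X Y (allFin p)))
    (≤-trans (+-mono-≤ (cardF-mono XYZ) (≤-reflexive (cnt-none _ (allFin p) none))) (≤-reflexive (+-identityʳ _)))
    where
    XYZ : ∀ x → X x ∨ Y x ≡ true → Z x ≡ true
    XYZ x e with ∨-true⁻ {X x} e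
    ... | inj₁ t = XZ x t
    ... | inj₂ t = YZ x t
    none : ∀ x → X x ∧ Y x ≡ false
    none x = ¬true⇒false λ t → dis x (∧-trueˡ t) (∧-trueʳ {X x} t)

  cardF-≤p : ∀ (X : Set′) → cardF X ≤ p
  cardF-≤p X = ≤-trans (cnt-≤-length X (allFin p)) (≤-reflexive (length-allFin p))

  cardF-disjoint-≤p : ∀ {X Y : Set′} → (∀ x → X x ≡ true → Y x ≡ true → ⊥) → cardF X + cardF Y ≤ p
  cardF-disjoint-≤p dis = ≤-trans (cardF-disjoint {Z = λ _ → true} (λ _ _ → refl) (λ _ _ → refl) dis) (cardF-≤p _)

  infixl 6 _∖_
  _∖_ : Set′ → Fin p → Set′
  (X ∖ x₀) x = X x ∧ not (x ==F x₀)

  ∖⁺ : ∀ {X : Set′} {x x₀} → X x ≡ true → x ≢ x₀ → (X ∖ x₀) x ≡ true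
  ∖⁺ e ne = ∧-true e (false⇒not-true (≢⇒==F ne))

  ∖⁻ˡ : ∀ {X : Set′} {x x₀} → (X ∖ x₀) x ≡ true → X x ≡ true
  ∖⁻ˡ = ∧-trueˡ

  ∖⁻ʳ : ∀ {X : Set′} {x x₀} → (X ∖ x₀) x ≡ true → x ≢ x₀
  ∖⁻ʳ {X} {x} {x₀} e refl = true≢false (==F-refl x) (not-true⇒false (∧-trueʳ {X x} e))

  cardF-∖ : ∀ (X : Set′) x₀ → cardF X ≤ suc (cardF (X ∖ x₀))
  cardF-∖ X x₀ = ≤-trans (≤-reflexive (cnt-split X (_==F x₀) (allFin p))) (+-monoˡ-≤ _ single)
    where
    single : cnt (λ x → X x ∧ (x ==F x₀)) (allFin p) ≤ 1
    single = ≤-trans (cnt-mono (allFin p) (λ x e → ∧-trueʳ {X x} e))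
      (injection⇒length≤ (λ x → x) {bs = x₀ ∷ []} (Uq.filter⁺ (T? ∘ (_==F x₀)) (Uq.allFin⁺ p))
        (λ i → here (==F⇒≡ (proj₂ (filterᵇ⁻ (_==F x₀) {allFin p} i)))) (λ _ _ e → e))

  cardF-∖-∈ : ∀ (X : Set′) x₀ → X x₀ ≡ true → cardF X ≡ suc (cardF (X ∖ x₀))
  cardF-∖-∈ X x₀ e = ≤-antisym (cardF-∖ X x₀)
    (cnt-strict (allFin p) (∈-allFin x₀) (λ x → ∧-trueˡ)
      (trans (cong (λ b → X x₀ ∧ not b) (==F-refl x₀)) (∧-zeroʳ (X x₀))) e)

  another : ∀ (X : Set′) x₀ → 2 ≤ cardF X → ∃ λ x → X x ≡ true × x ≢ x₀
  another X x₀ h = let x , e = cnt-∃ (X ∖ x₀) (allFin p) (≤-pred (≤-trans h (cardF-∖ X x₀))) in x , ∖⁻ˡ {X} e , ∖⁻ʳ {X} e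

  infixl 6 _⊞_
  opaque
    _⊞_ : Set′ → Set′ → Set′
    (A ⊞ B) z = any (λ x → A x ∧ B (z -F x)) (allFin p)

    ⊞⁺ : ∀ {A B : Set′} {x y z} → A x ≡ true → B y ≡ true → x +F y ≡ z → (A ⊞ B) z ≡ true
    ⊞⁺ {A} {B} {x} {y} a b refl = any⁺ _ (∈-allFin x)
      (∧-true a (trans (cong B (trans (cong (_-F x) (+F-comm x y)) (+F-F-cancel y x))) b))

    ⊞⁻ : ∀ {A B : Set′} {z} → (A ⊞ B) z ≡ true → ∃ λ x → ∃ λ y → A x ≡ true × B y ≡ true × x +F y ≡ z
    ⊞⁻ {A} {B} {z} e = let x , t = any⁻ _ (allFin p) e in
      x , z -F x , ∧-trueˡ t , ∧-trueʳ {A x} t , trans (+F-comm x _) (-F+F-cancel z x)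

  ⊞-mono : ∀ {A B A′ B′ : Set′} → (∀ x → A x ≡ true → A′ x ≡ true) → (∀ x → B x ≡ true → B′ x ≡ true) →
    ∀ z → (A ⊞ B) z ≡ true → (A′ ⊞ B′) z ≡ true
  ⊞-mono AA BB z e = let x , y , a , b , q = ⊞⁻ e in ⊞⁺ (AA x a) (BB y b) q

  private
    swap-mid : ∀ (x e y : Fin p) → (x -F e) +F (y +F e) ≡ x +F y
    swap-mid x e y = trans (FpC.interchange x (-F e) y e) (trans (cong ((x +F y) +F_) (+F-inverseˡ e)) (+F-identityʳ _))

  -- The Dyson transform A ∪ (B + e), B ∩ (A - e).
  dysonˡ dysonʳ : Set′ → Set′ → Fin p → Set′
  dysonˡ A B e z = A z ∨ B (z -F e)
  dysonʳ A B e z = B z ∧ A (z +F e)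

  dyson-⊞ : ∀ A B e z → (dysonˡ A B e ⊞ dysonʳ A B e) z ≡ true → (A ⊞ B) z ≡ true
  dyson-⊞ A B e z t with ⊞⁻ {dysonˡ A B e} {dysonʳ A B e} t
  ... | x , y , a , b , q with ∨-true⁻ {A x} a
  ...   | inj₁ ax = ⊞⁺ ax (∧-trueˡ b) q
  ...   | inj₂ bx = ⊞⁺ (∧-trueʳ {B y} b) bx (trans (+F-comm (y +F e) (x -F e)) (trans (swap-mid x e y) q))

  dyson-card : ∀ A B e → cardF A + cardF B ≤ cardF (dysonˡ A B e) + cardF (dysonʳ A B e)
  dyson-card A B e = ≤-trans (+-monoʳ-≤ (cardF A) (cardF-inj {Y = λ z → B (z -F e)} (_+F e)
        (λ x b → trans (cong B (+F-F-cancel x e)) b) (λ x y → +F-cancelʳ e x y)))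
    (≤-trans (≤-reflexive (cnt-∨∧ A (λ z → B (z -F e)) (allFin p)))
      (+-monoʳ-≤ _ (cardF-inj {Y = dysonʳ A B e} (_-F e)
        (λ x t → ∧-true (∧-trueʳ {A x} t) (trans (cong A (-F+F-cancel x e)) (∧-trueˡ t)))
        (λ x y → +F-cancelʳ (-F e) x y))))

  private
    move : ∀ (a b c : Fin p) → b +F (a -F c) ≡ a +F (b -F c)
    move a b c = FpC.x∙yz≈y∙xz b a (-F c)

  -- The points a of A with a + B - b₀ not inside A. For such a, the transform with e = a - b₀ keeps
  -- b₀ in the second set and loses some other element of B. This drives the inductions on |B| for
  -- both Cauchy-Davenport and Vosper.
  leaving : Set′ → Set′ → Fin p → Set′
  leaving A B b₀ a = A a ∧ any (λ b → B b ∧ not (A (a +F (b -F b₀)))) (allFin p)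

  leaving⁻ : ∀ {A B b₀ a} → leaving A B b₀ a ≡ true → ∃ λ b → B b ≡ true × A (a +F (b -F b₀)) ≡ false
  leaving⁻ {A} {B} {b₀} {a} e = let b , t = any⁻ _ (allFin p) (∧-trueʳ {A a} e) in
    b , ∧-trueˡ t , not-true⇒false (∧-trueʳ {B b} t)

  leaving⁺ : ∀ {A B b₀ a b} → A a ≡ true → B b ≡ true → A (a +F (b -F b₀)) ≡ false → leaving A B b₀ a ≡ true
  leaving⁺ {b = b} ea eb en = ∧-true ea (any⁺ _ (∈-allFin b) (∧-true eb (false⇒not-true en)))

  dysonʳ-shrinks : ∀ {A B b₀ a} → leaving A B b₀ a ≡ true → suc (cardF (dysonʳ A B (a -F b₀))) ≤ cardF B
  dysonʳ-shrinks {A} {B} {b₀} {a} e = let b , eb , en = leaving⁻ {A} {B} {b₀} {a} e in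
    cnt-strict (allFin p) (∈-allFin b) (λ x → ∧-trueˡ)
      (trans (cong (B b ∧_) (trans (cong A (move a b b₀)) en)) (∧-zeroʳ (B b))) eb

  dysonʳ-base : ∀ {A B b₀ a} → A a ≡ true → B b₀ ≡ true → dysonʳ A B (a -F b₀) b₀ ≡ true
  dysonʳ-base {A} {B} {b₀} {a} ea eb = ∧-true eb (trans (cong A (trans (+F-comm b₀ _) (-F+F-cancel a b₀))) ea)

  module _ (pr : Prime p) where

    translate-closed⇒all : ∀ (A : Set′) a₀ d → d ≢ ι 0 → A a₀ ≡ true → (∀ x → A x ≡ true → A (x +F d) ≡ true) → ∀ y → A y ≡ true
    translate-closed⇒all A a₀ d d≢0 ea cl y = subst (λ z → A z ≡ true) eq (steps (toℕ c))
      where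
      b = proj₁ (inverse-exists pr d d≢0)
      c = (y -F a₀) *F b
      steps : ∀ i → A (a₀ +F ι i *F d) ≡ true
      steps zero = trans (cong A (trans (cong (a₀ +F_) (*F-zeroˡ d)) (+F-identityʳ a₀))) ea
      steps (suc i) = trans (cong A (sym (trans (+F-assoc a₀ _ d) (cong (a₀ +F_)
        (trans (cong (ι i *F d +F_) (sym (*F-identityˡ d))) (trans (sym (*F-distribʳ d (ι i) (ι 1))) (cong (_*F d) (trans (ι-+ i 1) (cong ι (+-comm i 1)))))))))) (cl _ (steps i))
      eq : a₀ +F ι (toℕ c) *F d ≡ y
      eq = trans (cong (λ z → a₀ +F z *F d) (ι-toℕ c)) (trans (cong (a₀ +F_) (trans (*F-assoc (y -F a₀) b d)
             (trans (cong ((y -F a₀) *F_) (trans (*F-comm b d) (proj₂ (inverse-exists pr d d≢0)))) (*F-identityʳ (y -F a₀)))))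
             (trans (+F-comm a₀ _) (-F+F-cancel y a₀)))

    private
      -- Transform as long as some point of A is `leaving`. Otherwise A + B - b₀ lies in A: either B
      -- has one element, or A is closed under a nonzero translation and A ⊞ B misses nothing. The
      -- missing z takes the place of the usual minimum with p.
      CD : ∀ n (A B : Set′) → cardF B ≤ n → (∃ λ a → A a ≡ true) → (∃ λ b → B b ≡ true) →
        (∃ λ z → (A ⊞ B) z ≡ false) → cardF A + cardF B ≤ cardF (A ⊞ B) + 1
      CD zero A B h _ (b₀ , eb) _ = ⊥-elim (<-irrefl refl (≤-trans (cardF-pos {B} eb) h))
      CD (suc n) A B h (a₀ , ea) (b₀ , eb) (z , ez) with bool-case (any (leaving A B b₀) (allFin p))
      ... | inj₁ t = let a , la = any⁻ _ (allFin p) t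
                         e = a -F b₀
                         ih = CD n (dysonˡ A B e) (dysonʳ A B e)
                                (+-cancelˡ-≤ 1 _ _ (≤-trans (dysonʳ-shrinks {A} {B} {b₀} {a} la) h))
                                (a₀ , ∨-trueˡ _ ea) (b₀ , dysonʳ-base {A} {B} {b₀} {a} (∧-trueˡ la) eb)
                                (z , ¬true⇒false (λ t′ → true≢false (dyson-⊞ A B (a -F b₀) z t′) ez))
                     in ≤-trans (dyson-card A B e) (≤-trans ih (+-monoˡ-≤ 1 (cardF-mono (dyson-⊞ A B e))))
      ... | inj₂ f with 2 ≤? cardF B
      ...   | no ¬2 = ≤-trans (+-mono-≤ (cardF-inj {Y = A ⊞ B} (_+F b₀) (λ x e → ⊞⁺ e eb refl) (λ x y → +F-cancelʳ b₀ x y)) (≤-pred (≰⇒> ¬2))) ≤-refl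
      ...   | yes 2≤ = let b₁ , eb₁ , ne = another B b₀ 2≤
                           all = translate-closed⇒all A a₀ (b₁ -F b₀) (-F≢0 ne) ea (λ x ex → closed x b₁ ex eb₁)
                       in ⊥-elim (true≢false (⊞⁺ {A} {B} (all (z -F b₀)) eb (-F+F-cancel z b₀)) ez)
        where
        closed : ∀ x b → A x ≡ true → B b ≡ true → A (x +F (b -F b₀)) ≡ true
        closed x b ex eb′ with bool-case (A (x +F (b -F b₀)))
        ... | inj₁ t = t
        ... | inj₂ u = ⊥-elim (true≢false (any⁺ _ (∈-allFin x) (leaving⁺ {A} {B} {b₀} {x} {b} ex eb′ u)) f)

    cauchy-davenport : ∀ {A B : Set′} {a b z} → A a ≡ true → B b ≡ true → (A ⊞ B) z ≡ false →
      cardF A + cardF B ≤ cardF (A ⊞ B) + 1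
    cauchy-davenport {A} {B} ea eb ez = CD (cardF B) A B ≤-refl (_ , ea) (_ , eb) (_ , ez)

    -- Whenever A ≠ ∅, 𝔽_p, this says that A is an arithmetic progression with difference d.
    Progression : Fin p → Set′ → Set
    Progression d A = cardF (λ x → A x ∧ not (A (x +F d))) ≤ 1

    -- A = A′ ∪ (A′ + d) up to one point, so A ⊞ B contains A′ ⊞ (B ∪ (B + d)).
    progression-critical : ∀ d {A B : Set′} {b z} → Progression d A → 2 ≤ cardF A → B b ≡ true → (A ⊞ B) z ≡ false →
      cardF (A ⊞ B) + 1 ≤ cardF A + cardF B → Progression d B
    progression-critical d {A} {B} {b} {z} prog 2≤ eb ez crit =
      lin 0 (cd ⊹ cA ⊹ crit ⊹ cB ⊹ prog) (eqn (cardF A′) (cardF A) (cardF B′) (cardF B) (cardF (A ⊞ B)) (cardF (λ x → A x ∧ not (A (x +F d)))) (cardF (λ x → B x ∧ not (B (x +F d)))))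
      where
      A′ B′ : Set′
      A′ x = A x ∧ A (x +F d)
      B′ x = B x ∨ B (x -F d)
      cA : cardF A ≤ cardF A′ + cardF (λ x → A x ∧ not (A (x +F d)))
      cA = ≤-reflexive (cnt-split A (λ x → A (x +F d)) (allFin p))
      cB : cardF B + cardF (λ x → B x ∧ not (B (x +F d))) ≤ cardF B′
      cB = ≤-trans (+-monoʳ-≤ (cardF B) (cardF-inj {Y = λ x → B (x -F d) ∧ not (B x)} (_+F d)
              (λ x t → ∧-true (trans (cong B (+F-F-cancel x d)) (∧-trueˡ t)) (∧-trueʳ {B x} t)) (λ x y → +F-cancelʳ d x y)))
            (cardF-disjoint (λ x e → ∨-trueˡ _ e) (λ x e → ∨-trueʳ (B x) (∧-trueˡ e))
              (λ x e t → true≢false e (not-true⇒false (∧-trueʳ {B (x -F d)} t))))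
      sub : ∀ w → (A′ ⊞ B′) w ≡ true → (A ⊞ B) w ≡ true
      sub w e with ⊞⁻ {A′} {B′} e
      ... | x , y , a , q , eq with ∨-true⁻ {B y} q
      ...   | inj₁ t = ⊞⁺ (∧-trueˡ a) t eq
      ...   | inj₂ t = ⊞⁺ (∧-trueʳ {A x} a) t (trans (+F-comm (x +F d) (y -F d)) (trans (swap-mid y d x) (trans (+F-comm y x) eq)))
      miss : (A′ ⊞ B′) z ≡ false
      miss = ¬true⇒false λ t → true≢false (sub z t) ez
      nonempty : 1 ≤ cardF A′
      nonempty = lin 0 (2≤ ⊹ cA ⊹ prog) (eq′ (cardF A′) (cardF A) _)
        where
        eq′ : ∀ a′ a c → 1 + (a + (a′ + c) + 1) + 0 ≡ a′ + (2 + a + c)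
        eq′ = solve-∀
      -- Since |A′| is |A| minus the ends of A, and |B′| is at least |B| plus the ends of B,
      -- criticality forces B to have no more ends than A.
      cd : cardF A′ + cardF B′ ≤ cardF (A ⊞ B) + 1
      cd = ≤-trans (cauchy-davenport {A′} {B′} (proj₂ (cnt-∃ A′ (allFin p) nonempty)) (∨-trueˡ _ eb) miss) (+-monoˡ-≤ 1 (cardF-mono sub))
      eqn : ∀ a′ a b′ b s e f → f + (s + 1 + (a′ + e) + (a + b) + b′ + 1) + 0 ≡ 1 + (a′ + b′ + a + (s + 1) + (b + f) + e)
      eqn = solve-∀

    neg : Set′ → Set′
    neg A x = A (-F x)

    private
      neg-neg : ∀ (x : Fin p) → -F (-F x) ≡ x
      neg-neg = FpG.⁻¹-involutive

      neg-inj : ∀ (x y : Fin p) → (-F x) ≡ (-F y) → x ≡ y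
      neg-inj x y e = trans (sym (neg-neg x)) (trans (cong (λ z → -F z) e) (neg-neg y))

    cardF-neg : ∀ A → cardF A ≤ cardF (neg A)
    cardF-neg A = cardF-inj (λ x → -F x) (λ x e → trans (cong A (neg-neg x)) e) neg-inj

    -- Negation turns last points into first points, and both number |A| - |A ∩ (A + d)|.
    progression-neg : ∀ d A → Progression d A → Progression d (neg A)
    progression-neg d A prog = ≤-trans (cardF-inj {Y = λ x → A x ∧ not (A (x -F d))} (λ x → -F x)
        (λ x t → trans (cong (λ w → A (-F x) ∧ not (A w)) (FpG.⁻¹-∙-comm x d)) t) neg-inj)
      (≤-trans (+-cancelˡ-≤ (cardF (λ x → A x ∧ A (x -F d))) _ _
        (≤-trans (≤-reflexive (sym (cnt-split A (λ x → A (x -F d)) (allFin p))))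
          (≤-trans (≤-reflexive (cnt-split A (λ x → A (x +F d)) (allFin p)))
            (+-monoˡ-≤ _ (cardF-inj {Y = λ x → A x ∧ A (x -F d)} (_+F d)
               (λ x t → ∧-true (∧-trueʳ {A x} t) (trans (cong A (+F-F-cancel x d)) (∧-trueˡ t))) (λ x y → +F-cancelʳ d x y))))))
        prog)

    -- The complement C of A ⊞ B satisfies (C ⊞ −A) ∩ B = ∅, so criticality passes to (−A , C) and (C , −A).
    complement-critical : ∀ d {A B C : Set′} {b c} → B b ≡ true → C c ≡ true →
      (∀ x → C x ≡ true → (A ⊞ B) x ≡ true → ⊥) → p + 1 ≤ cardF A + cardF B + cardF C → 2 ≤ cardF A → Progression d A → Progression d C
    complement-critical d {A} {B} {C} {b} {c} eb ec dis big 2≤ prog =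
      progression-critical d {neg A} {C} {c} {b} (progression-neg d A prog) (≤-trans 2≤ (cardF-neg A)) ec
        miss (lin 0 (cardF-disjoint-≤p {neg A ⊞ C} {B} disj ⊹ big ⊹ cardF-neg A) (eqn p (cardF (neg A ⊞ C)) (cardF B) (cardF A) (cardF C) (cardF (neg A))))
      where
      disj : ∀ x → (neg A ⊞ C) x ≡ true → B x ≡ true → ⊥
      disj x t e = let u , w , au , cw , eq = ⊞⁻ {neg A} {C} t in
        dis w cw (⊞⁺ au e (trans (cong (-F u +F_) (sym eq)) (trans (sym (+F-assoc (-F u) u w)) (trans (cong (_+F w) (+F-inverseˡ u)) (+F-identityˡ w)))))
      miss : (neg A ⊞ C) b ≡ false
      miss = ¬true⇒false λ t → disj b t eb
      eqn : ∀ q s b a c n → s + 1 + (q + (a + b + c) + n) + 0 ≡ n + c + (s + b + (q + 1) + a)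
      eqn = solve-∀

    complement-critical′ : ∀ d {A B C : Set′} {a b} → A a ≡ true → B b ≡ true →
      (∀ x → C x ≡ true → (A ⊞ B) x ≡ true → ⊥) → p + 1 ≤ cardF A + cardF B + cardF C → 2 ≤ cardF C → Progression d C → Progression d A
    complement-critical′ d {A} {B} {C} {a} {b} ea eb dis big 2≤ prog =
      ≤-trans (cardF-mono (λ x t → trans (cong₂ (λ u w → A u ∧ not (A w)) (neg-neg x) (neg-neg (x +F d))) t))
       (progression-neg d (neg A) (progression-critical d {C} {neg A} {(-F a)} {b} prog 2≤ (trans (cong A (neg-neg a)) ea)
        miss (lin 0 (cardF-disjoint-≤p {C ⊞ neg A} {B} disj ⊹ big ⊹ cardF-neg A) (eqn p (cardF (C ⊞ neg A)) (cardF B) (cardF A) (cardF C) (cardF (neg A))))))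
      where
      disj : ∀ x → (C ⊞ neg A) x ≡ true → B x ≡ true → ⊥
      disj x t e = let w , u , cw , au , eq = ⊞⁻ {C} {neg A} t in
        dis w cw (⊞⁺ au e (trans (cong (-F u +F_) (trans (sym eq) (+F-comm w u))) (trans (sym (+F-assoc (-F u) u w)) (trans (cong (_+F w) (+F-inverseˡ u)) (+F-identityˡ w)))))
      miss : (C ⊞ neg A) b ≡ false
      miss = ¬true⇒false λ t → disj b t eb
      eqn : ∀ q s b a c n → s + 1 + (q + (a + b + c) + n) + 0 ≡ c + n + (s + b + (q + 1) + a)
      eqn = solve-∀

-- Vosper's theorem.

module _ {p : ℕ} .{{nz : NonZero p}} (pr : Prime p) where

  private
    Set′ : Set
    Set′ = Fin p → Bool

    -- Leaving points for which the Dyson transform keeps a second element of B.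
    useful : Set′ → Set′ → Fin p → Set′
    useful A B b₀ a = leaving A B b₀ a ∧ any (λ b → (B ∖ b₀) b ∧ A (a +F (b -F b₀))) (allFin p)

    -- Induction on |B|. A `useful` point yields a smaller critical pair A₁, B₁ with A₁ ⊞ B₁ inside
    -- A ⊞ B. The complement C of the larger sumset is critical with both pairs, so being a
    -- progression passes from A₁ to C and from C back to A. The two residues of room make |C| ≥ 2,
    -- which the return step needs.
    V : ∀ n (A B : Set′) → cardF B ≤ n → 2 ≤ cardF A → 2 ≤ cardF B →
      cardF (A ⊞ B) + 2 ≤ p → cardF (A ⊞ B) + 1 ≤ cardF A + cardF B → ∃ λ d → d ≢ ι 0 × Progression pr d A
    V zero A B h _ 2≤B _ _ = ⊥-elim (<-irrefl refl (≤-trans (s≤s z≤n) (≤-trans 2≤B h)))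
    V (suc n) A B h 2≤A 2≤B room crit with cnt-∃ B (allFin p) (≤-trans (s≤s z≤n) 2≤B)
    ... | b₀ , eb with bool-case (any (useful A B b₀) (allFin p))
    ...   | inj₁ t = d , d≢0 , complement-critical′ pr d {A} {B} {C} (proj₂ (cnt-∃ A (allFin p) (≤-trans (s≤s z≤n) 2≤A))) eb disC big 2≤C progC
      where
      a = proj₁ (any⁻ _ (allFin p) t)
      ua = proj₂ (any⁻ _ (allFin p) t)
      la : leaving A B b₀ a ≡ true
      la = ∧-trueˡ ua
      e = a -F b₀
      A₁ B₁ C : Set′
      A₁ = dysonˡ A B e
      B₁ = dysonʳ A B e
      C x = not ((A ⊞ B) x)
      w = any⁻ _ (allFin p) (∧-trueʳ {leaving A B b₀ a} ua)
      b₁ = proj₁ w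
      b₁∈ : B₁ b₁ ≡ true
      b₁∈ = ∧-true (∖⁻ˡ {X = B} (∧-trueˡ (proj₂ w))) (trans (cong A (FpC.x∙yz≈y∙xz b₁ a (-F b₀))) (∧-trueʳ {(B ∖ b₀) b₁} (proj₂ w)))
      b₀∈ : B₁ b₀ ≡ true
      b₀∈ = dysonʳ-base {A = A} {B} {b₀} {a} (∧-trueˡ la) eb
      2≤B₁ : 2 ≤ cardF B₁
      2≤B₁ = ≤-trans (s≤s (cardF-pos {X = B₁ ∖ b₀} (∖⁺ {X = B₁} b₁∈ (∖⁻ʳ {X = B} (∧-trueˡ (proj₂ w)))))) (≤-reflexive (sym (cardF-∖-∈ B₁ b₀ b₀∈)))
      2≤A₁ : 2 ≤ cardF A₁
      2≤A₁ = ≤-trans 2≤A (cardF-mono (λ x ex → ∨-trueˡ _ ex))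
      S⊆ : cardF (A₁ ⊞ B₁) ≤ cardF (A ⊞ B)
      S⊆ = cardF-mono (dyson-⊞ A B e)
      ih = V n A₁ B₁ (+-cancelˡ-≤ 1 _ _ (≤-trans (dysonʳ-shrinks {A = A} {B} {b₀} {a} la) h)) 2≤A₁ 2≤B₁
             (≤-trans (+-monoˡ-≤ 2 S⊆) room) (≤-trans (+-monoˡ-≤ 1 S⊆) (≤-trans crit (dyson-card A B e)))
      d = proj₁ ih
      d≢0 = proj₁ (proj₂ ih)
      |C| : cardF (A ⊞ B) + cardF C ≡ p
      |C| = trans (cnt-not (A ⊞ B) (allFin p)) (length-allFin p)
      2≤C : 2 ≤ cardF C
      2≤C = +-cancelˡ-≤ (cardF (A ⊞ B)) 2 _ (≤-trans room (≤-reflexive (sym |C|)))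
      disC : ∀ x → C x ≡ true → (A ⊞ B) x ≡ true → ⊥
      disC x ex q = true≢false q (not-true⇒false ex)
      big : p + 1 ≤ cardF A + cardF B + cardF C
      big = lin 0 (crit ⊹ ≤-reflexive (sym |C|)) (eqn p (cardF A) (cardF B) (cardF C) (cardF (A ⊞ B)))
        where
        eqn : ∀ p a b c s → p + 1 + (a + b + (s + c)) + 0 ≡ a + b + c + (s + 1 + p)
        eqn = solve-∀
      progC : Progression pr d C
      progC = complement-critical pr d {A₁} {B₁} {C} b₀∈ (proj₂ (cnt-∃ C (allFin p) (≤-trans (s≤s z≤n) 2≤C)))
        (λ x ex q → disC x ex (dyson-⊞ A B e x q)) (≤-trans big (+-monoˡ-≤ _ (dyson-card A B e))) 2≤A₁ (proj₂ (proj₂ ih))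
    -- Now no leaving point is useful, so `Xs` ⊞ `B*` avoids A + b₀ while both lie in A ⊞ B.
    -- Cauchy-Davenport bounds the former below by |Xs| + |B| - 2, and criticality leaves room for
    -- at most one point in `Xs`; every end of A in direction b₁ - b₀ is such a point.
    ...   | inj₂ f = b₁ -F b₀ , -F≢0 (proj₂ (proj₂ other)) , ≤-trans (cardF-mono ends⊆) few
      where
      other = another B b₀ 2≤B
      b₁ = proj₁ other
      Xs : Set′
      Xs = leaving A B b₀
      B* : Set′
      B* = B ∖ b₀
      b₁∈ : B* b₁ ≡ true
      b₁∈ = ∖⁺ {X = B} (proj₁ (proj₂ other)) (proj₂ (proj₂ other))
      ends⊆ : ∀ x → A x ∧ not (A (x +F (b₁ -F b₀))) ≡ true → Xs x ≡ true
      ends⊆ x ex = leaving⁺ {A = A} {B} {b₀} {x} {b₁} (∧-trueˡ ex) (proj₁ (proj₂ other)) (not-true⇒false (∧-trueʳ {A x} ex))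
      avoid : ∀ x b → Xs x ≡ true → B* b ≡ true → A (x +F (b -F b₀)) ≡ true → ⊥
      avoid x b ex eb* q = true≢false (any⁺ _ (∈-allFin x) (∧-true ex (any⁺ _ (∈-allFin b) (∧-true eb* q)))) f
      z = proj₁ (cardF-missing {X = A ⊞ B} (≤-trans (≤-trans (n≤1+n _) (≤-reflexive (+-comm 2 _))) room))
      ez = proj₂ (cardF-missing {X = A ⊞ B} (≤-trans (≤-trans (n≤1+n _) (≤-reflexive (+-comm 2 _))) room))
      sub : ∀ x → (Xs ⊞ B*) x ≡ true → (A ⊞ B) x ≡ true
      sub = ⊞-mono {A = Xs} {B*} {A} {B} (λ x → ∧-trueˡ) (λ x → ∖⁻ˡ {X = B})
      few : cardF Xs ≤ 1
      few with 2 ≤? cardF Xs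
      ... | no ¬2 = ≤-pred (≰⇒> ¬2)
      ... | yes 2≤ = lin 0 (cd ⊹ split ⊹ crit ⊹ cardF-∖ B b₀) (eqn (cardF A) (cardF B) (cardF B*) (cardF Xs) (cardF (Xs ⊞ B*)) (cardF (A ⊞ B)))
        where
        cd : cardF Xs + cardF B* ≤ cardF (Xs ⊞ B*) + 1
        cd = cauchy-davenport pr {Xs} {B*} (proj₂ (cnt-∃ Xs (allFin p) (≤-trans (s≤s z≤n) 2≤))) b₁∈
               (¬true⇒false (λ q → true≢false (sub z q) ez))
        split : cardF A + cardF (Xs ⊞ B*) ≤ cardF (A ⊞ B)
        split = ≤-trans (+-monoˡ-≤ _ (cardF-inj {X = A} {λ y → A (y -F b₀)} (_+F b₀) (λ x ex → trans (cong A (+F-F-cancel x b₀)) ex) (λ x y → +F-cancelʳ b₀ x y)))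
          (cardF-disjoint {X = λ y → A (y -F b₀)} {Xs ⊞ B*} {A ⊞ B} (λ x ex → ⊞⁺ ex eb (-F+F-cancel x b₀)) sub dis)
          where
          dis : ∀ x → A (x -F b₀) ≡ true → (Xs ⊞ B*) x ≡ true → ⊥
          dis x ax q = let u , v , xu , bv , eq = ⊞⁻ {A = Xs} {B*} q in
            avoid u v xu bv (trans (cong A (trans (sym (+F-assoc u v (-F b₀))) (cong (_-F b₀) eq))) ax)
        eqn : ∀ a b b* x xb s → x + (xb + 1 + s + (a + b) + suc b*) + 0 ≡ 1 + (x + b* + (a + xb) + (s + 1) + b)
        eqn = solve-∀

  vosper : ∀ {A B : Set′} → 2 ≤ cardF A → 2 ≤ cardF B → cardF (A ⊞ B) + 2 ≤ p →
    cardF (A ⊞ B) + 1 ≤ cardF A + cardF B → ∃ λ d → d ≢ ι 0 × Progression pr d A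
  vosper {A} {B} = V (cardF B) A B ≤-refl

-- Progressions

least : (Q : ℕ → Bool) (n : ℕ) → Q n ≡ true → ∃ λ i → i ≤ n × Q i ≡ true × (∀ j → Q j ≡ true → i ≤ j)
least Q zero e = 0 , z≤n , e , λ _ _ → z≤n
least Q (suc n) e with bool-case (Q 0)
... | inj₁ t = 0 , z≤n , t , λ _ _ → z≤n
... | inj₂ f with least (Q ∘ suc) n e
...   | i , i≤n , ei , mn = suc i , s≤s i≤n , ei , mn′
  where
  mn′ : ∀ j → Q j ≡ true → suc i ≤ j
  mn′ zero ej = ⊥-elim (true≢false ej f)
  mn′ (suc j) ej = s≤s (mn j ej)

span : (Q : ℕ → Bool) (N : ℕ) {n : ℕ} → n ≤ N → Q n ≡ true →
  ∃ λ lo → ∃ λ hi → lo ≤ hi × hi ≤ N × Q lo ≡ true × Q hi ≡ true × (∀ j → j ≤ N → Q j ≡ true → lo ≤ j × j ≤ hi)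
span Q N {n} n≤N e =
  let lo , _ , elo , mlo = least Q n e
      r , r≤ , er , mr = least (λ i → Q (N ∸ i)) (N ∸ n) (trans (cong Q (m∸[m∸n]≡n n≤N)) e)
      hi-max : ∀ j → j ≤ N → Q j ≡ true → j ≤ N ∸ r
      hi-max j j≤N ej = m+n≤o⇒m≤o∸n j (≤-trans (+-monoʳ-≤ j (mr (N ∸ j) (trans (cong Q (m∸[m∸n]≡n j≤N)) ej))) (≤-reflexive (m+[n∸m]≡n j≤N)))
  in lo , N ∸ r , mlo (N ∸ r) er , m∸n≤m N r , elo , er , λ j j≤N ej → mlo j ej , hi-max j j≤N ej

module _ {p : ℕ} .{{nz : NonZero p}} where

  opaque
    -- The point ha + nd, which is the sum of any h points of the progression whose offsets add up
    -- to n. Offsets stay natural numbers; reduction modulo p enters through `lc-p`.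
    lc : Fin p → Fin p → ℕ → ℕ → Fin p
    lc a d h n = ι h *F a +F ι n *F d

    lc-def : ∀ a d h n → lc a d h n ≡ ι h *F a +F ι n *F d
    lc-def a d h n = refl

    lc-1 : ∀ a d n → lc a d 1 n ≡ a +F ι n *F d
    lc-1 a d n = cong (_+F ι n *F d) (*F-identityˡ a)

    lc-00 : ∀ a d → lc a d 0 0 ≡ ι 0
    lc-00 a d = trans (cong₂ _+F_ (*F-zeroˡ a) (*F-zeroˡ d)) (+F-identityˡ (ι 0))

    lc-+ : ∀ a d h n h′ n′ → lc a d h n +F lc a d h′ n′ ≡ lc a d (h + h′) (n + n′)
    lc-+ a d h n h′ n′ = trans (FpC.interchange (ι h *F a) (ι n *F d) (ι h′ *F a) (ι n′ *F d))
      (cong₂ _+F_ (trans (sym (*F-distribʳ a (ι h) (ι h′))) (cong (_*F a) (ι-+ h h′)))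
                  (trans (sym (*F-distribʳ d (ι n) (ι n′))) (cong (_*F d) (ι-+ n n′))))

    lc-p : ∀ a d h n → lc a d h (n + p) ≡ lc a d h n
    lc-p a d h n = cong (λ w → ι h *F a +F w *F d) (ι-p+ n)

    lc-shift : ∀ a d h n u → lc a d h n +F ι u *F d ≡ lc a d h (n + u)
    lc-shift a d h n u = trans (+F-assoc (ι h *F a) (ι n *F d) (ι u *F d))
      (cong (ι h *F a +F_) (trans (sym (*F-distribʳ d (ι n) (ι u))) (cong (_*F d) (ι-+ n u))))

    lc-rebase : ∀ a d s j → lc (lc a d 1 s) d 1 j ≡ lc a d 1 (s + j)
    lc-rebase a d s j = trans (cong (_+F ι j *F d) (*F-identityˡ _)) (lc-shift a d 1 s j)

    lc-inj : Prime p → ∀ {d : Fin p} → d ≢ ι 0 → ∀ a h {i j} → i < p → j < p → lc a d h i ≡ lc a d h j → i ≡ j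
    lc-inj pr {d} d≢0 a h {i} {j} i<p j<p eq = ι-injective i<p j<p
      (*F-cancelˡ pr d (ι i) (ι j) d≢0 (trans (*F-comm d (ι i)) (trans (+F-cancelˡ (ι h *F a) (ι i *F d) (ι j *F d) eq) (*F-comm (ι j) d))))

    lc-surj : Prime p → ∀ {d : Fin p} → d ≢ ι 0 → ∀ a h x → ∃ λ i → i < p × x ≡ lc a d h i
    lc-surj pr {d} d≢0 a h x =
      let b , db = inverse-exists pr d d≢0
          y = x -F ι h *F a
      in toℕ (y *F b) , toℕ<n (y *F b) ,
         sym (trans (cong (λ w → ι h *F a +F w *F d) (ι-toℕ (y *F b)))
           (trans (cong (ι h *F a +F_) (trans (*F-assoc y b d) (trans (cong (y *F_) (trans (*F-comm b d) db)) (*F-identityʳ y))))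
             (trans (+F-comm (ι h *F a) y) (-F+F-cancel x (ι h *F a)))))

  cardF-≥ : ∀ (X : Fin p → Bool) n (f : ℕ → Fin p) → (∀ i → i < n → X (f i) ≡ true) →
    (∀ i j → i < n → j < n → f i ≡ f j → i ≡ j) → n ≤ cardF X
  cardF-≥ X n f mem inj = ≤-trans (≤-reflexive (sym (length-upTo n)))
    (injection⇒length≤ f {upTo n} {filterᵇ X (allFin p)} (Uq.upTo⁺ n) (λ i → filterᵇ⁺ X (∈-allFin (f _)) (mem _ (∈-upTo⁻ i)))
      (λ i j → inj _ _ (∈-upTo⁻ i) (∈-upTo⁻ j)))

  infix 4 _⊑[_,_]_
  _⊑[_,_]_ : (Fin p → Bool) → Fin p → Fin p → ℕ → Set
  X ⊑[ a , d ] M = ∀ x → X x ≡ true → ∃ λ i → i ≤ M × x ≡ lc a d 1 i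

  module _ (pr : Prime p) where

    private
      Set′ : Set
      Set′ = Fin p → Bool

    -- A proper nonempty A has exactly one end c. A walk from x in steps of d can leave A only after
    -- c, so the points from x to c are distinct elements of A and number at most |A|. Counting back
    -- from c explains the difference -d.
    progression-cover : ∀ d {A : Set′} {z} → d ≢ ι 0 → Progression pr d A → A z ≡ false → 1 ≤ cardF A →
      ∃ λ c → ∃ λ e → e ≢ ι 0 × (A ⊑[ c , e ] (cardF A ∸ 1))
    progression-cover d {A} {z} d≢0 prog ez ne with bool-case (any (λ x → A x ∧ not (A (x +F d))) (allFin p))
    ... | inj₂ f = ⊥-elim (true≢false (translate-closed⇒all pr A (proj₁ a₀) d d≢0 (proj₂ a₀) cl z) ez)
      where
      a₀ = cnt-∃ A (allFin p) ne
      cl : ∀ x → A x ≡ true → A (x +F d) ≡ true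
      cl x ex with bool-case (A (x +F d))
      ... | inj₁ t = t
      ... | inj₂ u = ⊥-elim (true≢false (any⁺ _ (∈-allFin x) (∧-true ex (false⇒not-true u))) f)
    ... | inj₁ t = c , (-F d) , neg≢0 d≢0 , cover
      where
      ends : Set′
      ends x = A x ∧ not (A (x +F d))
      c = proj₁ (any⁻ ends (allFin p) t)
      ec = proj₂ (any⁻ ends (allFin p) t)
      end-unique : ∀ x → ends x ≡ true → x ≡ c
      end-unique x ex with x ≟F c
      ... | yes q = q
      ... | no n = ⊥-elim (<-irrefl refl (≤-trans (≤-trans (s≤s (cardF-pos {X = ends ∖ c} (∖⁺ {X = ends} ex n)))
                     (≤-reflexive (sym (cardF-∖-∈ ends c ec)))) prog))
      cover : A ⊑[ c , (-F d) ] (cardF A ∸ 1)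
      cover x ex with lc-surj pr d≢0 x 1 c
      ... | i , i<p , eq = i , m+n≤o⇒m≤o∸n i (≤-trans (≤-reflexive (+-comm i 1)) big) , back
        where
        walk : ∀ j → j ≤ i → A (lc x d 1 j) ≡ true
        walk zero _ = trans (cong A (trans (lc-1 x d 0) (trans (cong (x +F_) (*F-zeroˡ d)) (+F-identityʳ x)))) ex
        walk (suc j) j<i with bool-case (A (lc x d 1 (suc j)))
        ... | inj₁ t′ = t′
        ... | inj₂ f = ⊥-elim (<⇒≢ j<i (lc-inj pr d≢0 x 1 (<-trans j<i i<p) i<p (trans (end-unique _ isEnd) eq)))
          where
          isEnd : ends (lc x d 1 j) ≡ true
          isEnd = ∧-true (walk j (<⇒≤ j<i)) (false⇒not-true (trans (cong A (trans (cong (lc x d 1 j +F_) (sym (*F-identityˡ d)))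
                    (trans (lc-shift x d 1 j 1) (cong (lc x d 1) (+-comm j 1))))) f))
        big : suc i ≤ cardF A
        big = cardF-≥ A (suc i) (lc x d 1) (λ j j<i → walk j (≤-pred j<i))
          (λ j j′ lt lt′ → lc-inj pr d≢0 x 1 (≤-trans lt i<p) (≤-trans lt′ i<p))
        back : x ≡ lc c (-F d) 1 i
        back = sym (trans (lc-1 c (-F d) i) (trans (cong₂ _+F_ (trans eq (lc-1 x d i)) (sym (FpR.-‿distribʳ-* (ι i) d))) (+F-F-cancel x (ι i *F d))))

    -- Offsets in 2X add up without wrapping around, so twice the width of X is at most 2m+1.
    half-cover : ∀ {X : Set′} {x₀} m c {d} → d ≢ ι 0 → X x₀ ≡ true → 4 * m + 2 < p → (X ⊞ X) ⊑[ c , d ] (2 * m + 1) →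
      ∃ λ a → X ⊑[ a , d ] m
    half-cover {X} {x₀} m c {d} d≢0 ex₀ room cov =
      lc a d 1 lo , λ x ex → let i , i≤ , eq = cov′ x ex
                                 l , h = bounds i i≤ (trans (cong X (sym eq)) ex)
                             in i ∸ lo , ≤-trans (∸-monoˡ-≤ lo h) u≤m , trans eq (sym (trans (lc-rebase a d lo (i ∸ lo)) (cong (lc a d 1) (m+[n∸m]≡n l))))
      where
      N = 2 * m + 1
      a = c -F x₀
      cov′ : X ⊑[ a , d ] N
      cov′ x ex = let i , i≤ , eq = cov (x +F x₀) (⊞⁺ ex ex₀ refl) in
        i , i≤ , trans (+F≡⇒≡-F eq) (trans (cong (_-F x₀) (lc-1 c d i)) (trans (trans (+F-assoc c _ _) (trans (cong (c +F_) (+F-comm (ι i *F d) (-F x₀))) (sym (+F-assoc c (-F x₀) (ι i *F d))))) (sym (lc-1 a d i))))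
      first = cov′ x₀ ex₀
      sp = span (λ i → X (lc a d 1 i)) N (proj₁ (proj₂ first)) (trans (cong X (sym (proj₂ (proj₂ first)))) ex₀)
      lo = proj₁ sp
      hi = proj₁ (proj₂ sp)
      lo≤hi = proj₁ (proj₂ (proj₂ sp))
      hi≤N = proj₁ (proj₂ (proj₂ (proj₂ sp)))
      elo = proj₁ (proj₂ (proj₂ (proj₂ (proj₂ sp))))
      ehi = proj₁ (proj₂ (proj₂ (proj₂ (proj₂ (proj₂ sp)))))
      bounds = proj₂ (proj₂ (proj₂ (proj₂ (proj₂ (proj₂ sp)))))
      u = hi ∸ lo
      u≤N : u ≤ N
      u≤N = ≤-trans (m∸n≤m hi lo) hi≤N
      -- Both i and u are at most 2m + 1, so i + u ≤ 4m + 2 < p and equal points have equal offsets.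
      step : ∀ {x y} → (X ⊞ X) x ≡ true → (X ⊞ X) y ≡ true → x +F ι u *F d ≡ y →
        ∀ {i} → i ≤ N → x ≡ lc c d 1 i → ∃ λ j → j ≤ N × y ≡ lc c d 1 j × i + u ≡ j
      step {x} {y} xx yy e {i} i≤ eq = let j , j≤ , eq′ = cov y yy in
        j , j≤ , eq′ , lc-inj pr d≢0 c 1 (≤-trans (s≤s (≤-trans (+-mono-≤ i≤ u≤N) (≤-reflexive (dbl m)))) room)
          (≤-trans (s≤s (≤-trans j≤ (≤-trans (m≤m+n N N) (≤-reflexive (dbl m))))) room)
          (trans (sym (lc-shift c d 1 i u)) (trans (cong (_+F ι u *F d) (sym eq)) (trans e eq′)))
        where
        dbl : ∀ m → 2 * m + 1 + (2 * m + 1) ≡ 4 * m + 2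
        dbl = solve-∀
      x₁ = lc a d 1 lo
      x₂ = lc a d 1 hi
      x₂≡ : x₁ +F ι u *F d ≡ x₂
      x₂≡ = trans (lc-shift a d 1 lo u) (cong (lc a d 1) (m+[n∸m]≡n lo≤hi))
      -- The sums x₁ + x₁, x₁ + x₂, x₂ + x₂ have offsets i, i + u, i + 2u, the last at most 2m + 1;
      -- hence u ≤ m.
      s0 = cov (x₁ +F x₁) (⊞⁺ elo elo refl)
      s1 = step (⊞⁺ elo elo refl) (⊞⁺ elo ehi refl) (trans (+F-assoc x₁ x₁ _) (cong (x₁ +F_) x₂≡)) (proj₁ (proj₂ s0)) (proj₂ (proj₂ s0))
      s2 = step (⊞⁺ elo ehi refl) (⊞⁺ ehi ehi refl) (trans (FpC.xy∙z≈xz∙y x₁ x₂ (ι u *F d)) (cong (_+F x₂) x₂≡)) (proj₁ (proj₂ s1)) (proj₁ (proj₂ (proj₂ s1)))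
      u≤m : u ≤ m
      u≤m = halve-≤ u m 2u≤
        where
        three : proj₁ s0 + u + u ≤ 2 * m + 1
        three = ≤-trans (≤-reflexive (trans (cong (_+ u) (proj₂ (proj₂ (proj₂ s1)))) (proj₂ (proj₂ (proj₂ s2))))) (proj₁ (proj₂ s2))
        2u≤ : 2 * u ≤ suc (2 * m)
        2u≤ = lin (proj₁ s0) three (eqn u m (proj₁ s0))
          where
          eqn : ∀ u m i → 2 * u + (2 * m + 1) + i ≡ suc (2 * m) + (i + u + u)
          eqn = solve-∀

-- Repeated sums of X and the covering progression.

module _ {p : ℕ} .{{nz : NonZero p}} where

  data Rep (X : Fin p → Bool) : ℕ → Fin p → Set where
    [] : Rep X 0 (ι 0)
    cons : ∀ {h x z w} → X x ≡ true → Rep X h z → x +F z ≡ w → Rep X (suc h) w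

  private
    single : ∀ {X : Fin p → Bool} {x} → X x ≡ true → Rep X 1 x
    single {x = x} e = cons e [] (+F-identityʳ x)

  private
    Set′ : Set
    Set′ = Fin p → Bool

  -- A subset of (i+1)X: only as many copies of X as parity requires are summed outside a pair.
  fold : ℕ → Set′ → Set′
  fold 0 X = X
  fold 1 X = X ⊞ X
  fold (suc (suc i)) X = (X ⊞ X) ⊞ fold i X

  fold-Rep : ∀ i X z → fold i X z ≡ true → Rep X (suc i) z
  fold-Rep 0 X z e = single e
  fold-Rep 1 X z e = let x , y , ex , ey , q = ⊞⁻ e in cons ex (single ey) q
  fold-Rep (suc (suc i)) X z e = let x , y , ex , ey , q = ⊞⁻ {A = X ⊞ X} e
                                     x₁ , x₂ , e₁ , e₂ , q′ = ⊞⁻ ex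
                                 in cons e₁ (cons e₂ (fold-Rep i X y ey) refl) (trans (sym (+F-assoc x₁ x₂ y)) (trans (cong (_+F y) q′) q))

  fold-grows : ∀ X {x₀} → X x₀ ≡ true → ∀ i → cardF (fold i X) ≤ cardF (fold (suc (suc i)) X)
  fold-grows X {x₀} e i = cardF-inj {X = fold i X} {fold (suc (suc i)) X} ((x₀ +F x₀) +F_) (λ x ex → ⊞⁺ (⊞⁺ e e refl) ex refl) (λ x y → +F-cancelˡ (x₀ +F x₀) x y)

  -- Two further copies of X amount to one summand X ⊞ X, which by `step` contributes 2m + 2. By
  -- `fold-grows` the room for the larger sum is also room for the smaller ones.
  fold-card : ∀ X {x₀} m → X x₀ ≡ true → 2 ≤ m → m ≤ cardF X → 2 * m + 2 ≤ cardF (X ⊞ X) →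
    (∀ B → 2 ≤ cardF B → cardF ((X ⊞ X) ⊞ B) + 2 ≤ p → 2 * m + 2 + cardF B ≤ cardF ((X ⊞ X) ⊞ B)) →
    ∀ i → cardF (fold i X) + 2 ≤ p → suc i * m + i ≤ cardF (fold i X)
  fold-card X m e 2≤m mX mD step 0 _ = ≤-trans (≤-reflexive (trans (+-identityʳ _) (+-identityʳ m))) mX
  fold-card X m e 2≤m mX mD step 1 _ = ≤-trans (lin 1 (≤-refl {0}) (eqn m)) mD
    where
    eqn : ∀ m → 2 * m + 1 + 0 + 1 ≡ 2 * m + 2 + 0
    eqn = solve-∀
  fold-card X m e 2≤m mX mD step (suc (suc i)) room =
    lin 0 (ih ⊹ step (fold i X) 2≤f room) (eqn m i (cardF (fold i X)) (cardF (fold (suc (suc i)) X)))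
    where
    ih : suc i * m + i ≤ cardF (fold i X)
    ih = fold-card X m e 2≤m mX mD step i (≤-trans (+-monoˡ-≤ 2 (fold-grows X e i)) room)
    2≤f : 2 ≤ cardF (fold i X)
    2≤f = ≤-trans 2≤m (≤-trans (≤-trans (m≤m+n m (i * m)) (m≤m+n _ i)) ih)
    eqn : ∀ m i f g → (m + (m + (m + i * m)) + (2 + i)) + (f + g) + 0 ≡ g + ((m + i * m) + i + (2 * m + 2 + f))
    eqn = solve-∀

  sumsetF-card : ∀ X → cardF (sumsetF X) ≡ cardF (X ⊞ X)
  sumsetF-card X = cnt-cong (allFin p) (λ z → iff⇒≡ (to z) (from z))
    where
    to : ∀ z → sumsetF X z ≡ true → (X ⊞ X) z ≡ true
    to z e = let x , e₁ = any⁻ _ (allFin p) e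
                 y , e₂ = any⁻ _ (allFin p) e₁
             in ⊞⁺ (∧-trueˡ e₂) (∧-trueˡ (∧-trueʳ {X x} e₂)) (==F⇒≡ (∧-trueʳ {X y} (∧-trueʳ {X x} e₂)))
    from : ∀ z → (X ⊞ X) z ≡ true → sumsetF X z ≡ true
    from z e = let x , y , ex , ey , q = ⊞⁻ e in
      any⁺ _ (∈-allFin x) (any⁺ _ (∈-allFin y) (∧-true ex (∧-true ey (trans (cong (_==F z) q) (==F-refl z)))))

-- Small doubling is covered by feasibility; large doubling (by Cauchy–Davenport
-- or Vosper, applied to sums of copies of 2X) makes kX and ℓX too large to be disjoint.
sumfree-cover : ∀ k ℓ λ' m {p} .{{_ : NonZero p}} → 1 ≤ k → 1 ≤ ℓ → λ' + 5 ≤ k + ℓ → 7 ≤ m →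
  FiveTBound (k + ℓ) m → p ≡ (k + ℓ) * m + 2 + λ' → Prime p → (X : Fin p → Bool) → cardF X ≡ m →
  (∀ z → Rep X k z → Rep X ℓ z → ⊥) → ∃ λ a → ∃ λ d → d ≢ ι 0 × (X ⊑[ a , d ] suc m)
sumfree-cover (suc k) (suc ℓ) λ' m {p} _ _ hλ 7≤m five p≡ pr X |X| dis = main
  where
  D = X ⊞ X
  x₀ = proj₁ (cnt-∃ X (allFin p) (≤-trans (≤-trans (s≤s z≤n) 7≤m) (≤-reflexive (sym |X|))))
  ex₀ = proj₂ (cnt-∃ X (allFin p) (≤-trans (≤-trans (s≤s z≤n) 7≤m) (≤-reflexive (sym |X|))))
  2≤m : 2 ≤ m
  2≤m = ≤-trans (s≤s (s≤s z≤n)) 7≤m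
  2≤X : 2 ≤ cardF X
  2≤X = ≤-trans 2≤m (≤-reflexive (sym |X|))
  m≤X : m ≤ cardF X
  m≤X = ≤-reflexive (sym |X|)

  disjoint : cardF (fold k X) + cardF (fold ℓ X) ≤ p
  disjoint = cardF-disjoint-≤p {X = fold k X} {fold ℓ X} (λ z a b → dis z (fold-Rep k X z a) (fold-Rep ℓ X z b))

  fold-2≤ : ∀ i → 2 ≤ cardF (fold i X)
  fold-2≤ 0 = 2≤X
  fold-2≤ 1 = ≤-trans 2≤X (cardF-inj {X = X} {X ⊞ X} (x₀ +F_) (λ x ex → ⊞⁺ ex₀ ex refl) (λ x y → +F-cancelˡ x₀ x y))
  fold-2≤ (suc (suc i)) = ≤-trans (fold-2≤ i) (fold-grows X ex₀ i)

  impossible : 2 * m + 2 ≤ cardF D →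
    (∀ B → 2 ≤ cardF B → cardF (D ⊞ B) + 2 ≤ p → 2 * m + 2 + cardF B ≤ cardF (D ⊞ B)) → ⊥
  -- For the original k and ℓ the two bounds add up to (k + ℓ)m + k + ℓ - 2, so disjointness would
  -- give k + ℓ ≤ λ + 4. The room for each sum is guaranteed by two elements of the other.
  impossible mD step = 1+n≰n {λ' + p} (lin 0 (ck ⊹ cℓ ⊹ disjoint ⊹ ≤-reflexive p≡ ⊹ hλ) (eqn (cardF (fold k X)) (cardF (fold ℓ X)) k ℓ m p λ'))
    where
    ck : suc k * m + k ≤ cardF (fold k X)
    ck = fold-card X m ex₀ 2≤m m≤X mD step k (≤-trans (+-monoʳ-≤ _ (fold-2≤ ℓ)) disjoint)
    cℓ : suc ℓ * m + ℓ ≤ cardF (fold ℓ X)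
    cℓ = fold-card X m ex₀ 2≤m m≤X mD step ℓ (≤-trans (+-monoʳ-≤ _ (fold-2≤ k)) (≤-trans (≤-reflexive (+-comm (cardF (fold ℓ X)) _)) disjoint))
    eqn : ∀ f g k ℓ m p l → 1 + (l + p) + (f + g + p + ((1 + k + (1 + ℓ)) * m + 2 + l) + (1 + k + (1 + ℓ))) + 0
      ≡ l + p + ((1 + k) * m + k + ((1 + ℓ) * m + ℓ) + (f + g) + p + (l + 5))
    eqn = solve-∀

  small : cardF D ≤ 2 * m + 1 → ∃ λ a → ∃ λ d → d ≢ ι 0 × (X ⊑[ a , d ] suc m)
  -- The constant 4 comes from 2m + 1 = (2 + 4/m)m - 3; as 4/m is strictly below 5/m, some feasible
  -- τ is at least 4/m.
  small h with five 4 m (≤-trans (s≤s z≤n) 7≤m) (+-monoˡ-≤ (4 * m) (≤-trans (s≤s z≤n) 7≤m))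
  ... | a′ , b′ , _ , (_ , _ , feas) , ratio with feas p pr X
          (lin (2 + λ') (≤-reflexive (sym p≡) ⊹ (suc k + suc ℓ) ⊗ ≤-reflexive |X|) (e1 (suc k + suc ℓ) (cardF X) m λ' p))
          (lin 0 (b′ ⊗ (≤-trans (≤-reflexive (sumsetF-card X)) h) ⊹ ratio ⊹ (2 * b′ + a′) ⊗ m≤X) (e2 b′ a′ m (cardF (sumsetF X)) (cardF X)))
    where
    e1 : ∀ s x m l p → s * x + (p + s * m) + (2 + l) ≡ p + (s * m + 2 + l + s * x)
    e1 = solve-∀
    e2 : ∀ b a m y x → (b * y + 3 * b) + (b * (2 * m + 1) + a * m + (2 * b + a) * x) + 0 ≡ (2 * b + a) * x + (b * y + 4 * b + (2 * b + a) * m)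
    e2 = solve-∀
  ...   | a , d , cov = a , d , d≢0 , λ x ex → let i , i< , eq = cov x ex in i , bound i i< , trans eq (sym (lc-1 a d i))
    where
    bound : ∀ i → i < cardF (sumsetF X) ∸ cardF X + 1 → i ≤ suc m
    -- The covering length |2X| - |X| + 1 is at most m + 2, so offsets reach at most m + 1.
    bound i i< = ≤-pred (≤-trans i< (≤-trans (≤-reflexive (+-comm _ 1)) (s≤s
      (m≤n+o⇒m∸n≤o (cardF (sumsetF X)) (cardF X) (lin 0 (≤-trans (≤-reflexive (sumsetF-card X)) h ⊹ m≤X) (e3 (cardF (sumsetF X)) m (cardF X)))))))
      where
      e3 : ∀ y m x → y + (2 * m + 1 + x) + 0 ≡ x + (1 + m) + (y + m)
      e3 = solve-∀
    d≢0 : d ≢ ι 0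
    d≢0 refl = let x₁ , e₁ , ne = another X x₀ 2≤X in ne (trans (const x₁ e₁) (sym (const x₀ ex₀)))
      where
      const : ∀ x → X x ≡ true → x ≡ a
      const x ex = let i , _ , eq = cov x ex in trans eq (trans (cong (a +F_) (*F-zeroʳ (ι i))) (+F-identityʳ a))

  missing : ∀ B → cardF (D ⊞ B) + 2 ≤ p → ∃ λ z → (D ⊞ B) z ≡ false
  missing B room = cardF-missing {X = D ⊞ B} (≤-trans (≤-trans (n≤1+n _) (≤-reflexive (+-comm 2 _))) room)

  main : ∃ λ a → ∃ λ d → d ≢ ι 0 × (X ⊑[ a , d ] suc m)
  main with cardF D ≤? 2 * m + 1
  ... | yes h = small h
  ... | no ¬h with cardF D ≤? 2 * m + 2
  -- Here |D| ≥ 2m + 3, and the loss of one in Cauchy-Davenport is affordable.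
  ...   | no ¬h′ = ⊥-elim (impossible mD step)
    where
    mD : 2 * m + 2 ≤ cardF D
    mD = <⇒≤ (≰⇒> ¬h′)
    step : ∀ B → 2 ≤ cardF B → cardF (D ⊞ B) + 2 ≤ p → 2 * m + 2 + cardF B ≤ cardF (D ⊞ B)
    step B 2≤B room = lin 0 (≰⇒> ¬h′ ⊹ cauchy-davenport pr {D} {B} (⊞⁺ ex₀ ex₀ refl) (proj₂ (cnt-∃ B (allFin p) (≤-trans (s≤s z≤n) 2≤B))) (proj₂ (missing B room)))
      (eqn m (cardF B) (cardF D) (cardF (D ⊞ B)))
      where
      eqn : ∀ m b d s → 2 * m + 2 + b + (d + (s + 1)) + 0 ≡ s + (1 + (2 * m + 2) + (d + b))
      eqn = solve-∀
  ...   | yes h′ = go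
    where
    mD : 2 * m + 2 ≤ cardF D
    mD = ≤-trans (≤-reflexive (+-suc (2 * m) 1)) (≰⇒> ¬h)
    4m+2<p : 4 * m + 2 < p
    4m+2<p = lin (m * λ' + 6 + λ') (m ⊗ hλ ⊹ ≤-reflexive (sym p≡) ⊹ 7≤m) (eqn m (suc k + suc ℓ) λ' p)
      where
      eqn : ∀ m s l p → 1 + (4 * m + 2) + (m * s + p + m) + (m * l + 6 + l) ≡ p + (m * (l + 5) + (s * m + 2 + l) + 7)
      eqn = solve-∀
    room : cardF D + 2 ≤ p
    room = ≤-trans (+-monoˡ-≤ 2 h′) (lin (m + 6) (4m+2<p ⊹ 7≤m) (eqn m p))
      where
      eqn : ∀ m p → 2 * m + 2 + 2 + (p + m) + (m + 6) ≡ p + (1 + (4 * m + 2) + 7)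
      eqn = solve-∀
    go : ∃ λ a → ∃ λ d → d ≢ ι 0 × (X ⊑[ a , d ] suc m)
    -- Here |D| = 2m + 2 exactly. If D is no progression, Vosper recovers the one that
    -- Cauchy-Davenport loses. If it is one, X fits into a progression of half its width.
    go with any? (λ d → ¬? (d ≟F ι 0) ×-dec (cardF (λ x → D x ∧ not (D (x +F d))) ≤? 1))
    ... | no none = ⊥-elim (impossible mD step)
      where
      step : ∀ B → 2 ≤ cardF B → cardF (D ⊞ B) + 2 ≤ p → 2 * m + 2 + cardF B ≤ cardF (D ⊞ B)
      step B 2≤B room with cardF (D ⊞ B) + 1 ≤? cardF D + cardF B
      ... | yes crit = ⊥-elim (none (vosper pr {D} {B} (fold-2≤ 1) 2≤B room crit))
      ... | no ¬crit = ≤-trans (+-monoˡ-≤ _ mD) (≤-pred (≤-trans (≰⇒> ¬crit) (≤-reflexive (+-comm _ 1))))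
    ... | yes (d , d≢0 , prog) =
      let z , ez = cardF-missing {X = D} (≤-trans (≤-trans (n≤1+n _) (≤-reflexive (+-comm 2 _))) room)
          c , e , e≢0 , cov = progression-cover pr d d≢0 prog ez (≤-trans (s≤s z≤n) (fold-2≤ 1))
          a , cov′ = half-cover pr m c e≢0 ex₀ 4m+2<p
            (λ x ex → let i , i≤ , eq = cov x ex in i , ≤-trans i≤ (≤-trans (∸-monoˡ-≤ 1 h′) (≤-reflexive (m+n∸n≡m′ m))) , eq)
      in a , e , e≢0 , λ x ex → let i , i≤ , eq = cov′ x ex in i , m≤n⇒m≤1+n i≤ , eq
      where
      m+n∸n≡m′ : ∀ m → 2 * m + 2 ∸ 1 ≡ 2 * m + 1
      m+n∸n≡m′ m = cong (_∸ 1) (+-suc (2 * m) 1)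

-- Offsets along a progression

data ORep (Q : ℕ → Bool) : ℕ → ℕ → Set where
  [] : ORep Q 0 0
  cons : ∀ {h i n} → Q i ≡ true → ORep Q h n → ORep Q (suc h) (i + n)

ORep-≡ : ∀ {Q h h′ n n′} → h ≡ h′ → n ≡ n′ → ORep Q h n → ORep Q h′ n′
ORep-≡ refl refl r = r

repeat : ∀ {Q i} → Q i ≡ true → ∀ t → ORep Q t (t * i)
repeat e zero = []
repeat e (suc t) = cons e (repeat e t)

append : ∀ {Q h n h′ n′} → ORep Q h n → ORep Q h′ n′ → ORep Q (h + h′) (n + n′)
append [] s = s
append (cons {i = i} {n} e r) s = ORep-≡ refl (sym (+-assoc i n _)) (cons e (append r s))

-- The end offsets 0 and M alone produce the multiples wM with w ≤ h; the remainder q ≤ M is left to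
-- a difference of two elements of X.
blocks-split : ∀ h M n → n ≤ suc h * M → ∃ λ w → ∃ λ q → w ≤ h × q ≤ M × n ≡ w * M + q
blocks-split zero M n le = 0 , n , z≤n , ≤-trans le (≤-reflexive (+-identityʳ M)) , refl
blocks-split (suc h) M n le with n ≤? suc h * M
... | yes le′ = let w , q , w≤ , q≤ , eq = blocks-split h M n le′ in w , q , m≤n⇒m≤1+n w≤ , q≤ , eq
... | no gt = suc h , n ∸ suc h * M , ≤-refl , m≤n+o⇒m∸n≤o n (suc h * M) (≤-trans le (≤-reflexive (+-comm M (suc h * M)))) , sym (m+[n∸m]≡n (<⇒≤ (≰⇒> gt)))

-- Steps of size r ≤ W + 1 cannot jump over the forbidden window.
stays-below : ∀ (r g W T : ℕ) → r ≤ suc W → (∀ t c → t ≤ T → c ≤ W → t * r ≡ suc g + c → ⊥) → T * r ≤ g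
stays-below r g W zero r≤ avoid = z≤n
stays-below r g W (suc T) r≤ avoid with suc T * r ≤? g
... | yes le = le
... | no gt = ⊥-elim (avoid (suc T) (suc T * r ∸ suc g) ≤-refl
        (m≤n+o⇒m∸n≤o (suc T * r) (suc g) (≤-trans (+-mono-≤ r≤ ih) (≤-reflexive (cong suc (+-comm W g)))))
        (sym (m+[n∸m]≡n (≰⇒> gt))))
  where ih = stays-below r g W T r≤ (λ t c t≤ → avoid t c (m≤n⇒m≤1+n t≤))

-- X and Ω are sets of offsets i of points a + i d, and E is defined by ℓa = ka + E d,
-- where the paper's k and ℓ are 2 + κ and suc ℓ.
module Offsets (κ ℓ m M E p : ℕ) (X Ω : ℕ → Bool)
  (X⊆Ω : ∀ {i} → X i ≡ true → Ω i ≡ true)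
  (0∈ : X 0 ≡ true) (M∈ : X M ≡ true)
  (few : ∀ ms → Unique ms → All (λ i → i ≤ M × X i ≡ false) ms → m + length ms ≤ suc M)
  -- The two alternatives are equality of k-fold and ℓ-fold sums without and with one turn around
  -- 𝔽_p.
  (conf : ∀ {i₁ i₂ n₁ n₂} → X i₁ ≡ true → X i₂ ≡ true → ORep Ω κ n₁ → ORep Ω (suc ℓ) n₂ →
          (i₁ + i₂ + n₁ ≡ E + n₂ ⊎ i₁ + i₂ + n₁ + p ≡ E + n₂) → ⊥) where

  -- q lies in X - X. In `conf-K` the larger element q + j joins the k-fold sum and j the ℓ-fold
  -- sum; `conf-L` exchanges them. So q may be added on whichever side needs it.
  Dif : ℕ → Set
  Dif q = ∃ λ j → X j ≡ true × X (q + j) ≡ true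

  zeros : ∀ h → ORep Ω h 0
  zeros h = ORep-≡ refl (*-zeroʳ h) (repeat (X⊆Ω 0∈) h)

  blocks : ∀ h w → w ≤ h → ORep Ω h (w * M)
  blocks h w w≤h = ORep-≡ (m+[n∸m]≡n w≤h) (+-identityʳ _) (append (repeat (X⊆Ω M∈) w) (zeros (h ∸ w)))

  -- One of the terms is singled out as an element of X: together with the one spent on a difference
  -- it makes up the two that `conf` demands.
  blocks₁ : ∀ h w → w ≤ suc h → ∃ λ i → ∃ λ n → X i ≡ true × ORep Ω h n × i + n ≡ w * M
  blocks₁ h zero _ = 0 , 0 , 0∈ , zeros h , refl
  blocks₁ h (suc w) (s≤s w≤h) = M , w * M , M∈ , blocks h w w≤h , refl

  module _ {i b c q : ℕ} (ei : X i ≡ true) (rb : ORep Ω κ b) (rc : ORep Ω ℓ c) (dq : Dif q) where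

    private
      j = proj₁ dq
      ej = proj₁ (proj₂ dq)
      eq+j = proj₂ (proj₂ dq)

    conf-K : i + b + q ≡ E + c → ⊥
    conf-K eq = conf ei eq+j rb (cons (X⊆Ω ej) rc) (inj₁ (trans (l i b q j) (trans (cong (_+ j) eq) (r E c j))))
      where
      l : ∀ i b q j → i + (q + j) + b ≡ i + b + q + j
      l = solve-∀
      r : ∀ E c j → E + c + j ≡ E + (j + c)
      r = solve-∀

    conf-L : i + b ≡ E + c + q → ⊥
    conf-L eq = conf ei ej rb (cons (X⊆Ω eq+j) rc) (inj₁ (trans (l i b j) (trans (cong (_+ j) eq) (r E c q j))))
      where
      l : ∀ i b j → i + j + b ≡ i + b + j
      l = solve-∀
      r : ∀ E c q j → E + c + q + j ≡ E + (q + j + c)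
      r = solve-∀

    conf-Kp : i + b + q + p ≡ E + c → ⊥
    conf-Kp eq = conf ei eq+j rb (cons (X⊆Ω ej) rc) (inj₂ (trans (l i b q j p) (trans (cong (_+ j) eq) (r E c j))))
      where
      l : ∀ i b q j p → i + (q + j) + b + p ≡ i + b + q + p + j
      l = solve-∀
      r : ∀ E c j → E + c + j ≡ E + (j + c)
      r = solve-∀

    conf-Lp : i + b + p ≡ E + c + q → ⊥
    conf-Lp eq = conf ei ej rb (cons (X⊆Ω eq+j) rc) (inj₂ (trans (l i b j p) (trans (cong (_+ j) eq) (r E c q j))))
      where
      l : ∀ i b j p → i + j + b + p ≡ i + b + p + j
      l = solve-∀
      r : ∀ E c q j → E + c + q + j ≡ E + (q + j + c)
      r = solve-∀

  private
    pair : ∀ q j → j ≤ M → j + q ≤ M → (X j ≡ true × X (q + j) ≡ true) ⊎ (∃ λ i → (i ≡ j ⊎ i ≡ j + q) × i ≤ M × X i ≡ false)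
    pair q j j≤ j+q≤ with bool-case (X j) | bool-case (X (q + j))
    ... | inj₁ t | inj₁ t′ = inj₁ (t , t′)
    ... | inj₂ u | _ = inj₂ (j , inj₁ refl , j≤ , u)
    ... | inj₁ _ | inj₂ u = inj₂ (j + q , inj₂ refl , j+q≤ , trans (cong X (+-comm j q)) u)

    1≤ : ∀ {q} → q ≢ 0 → 1 ≤ q
    1≤ = n≢0⇒n>0

  -- At most one offset of [0, M] is missing: try the pairs (0, q), (M ∸ q, M), (1, q + 1).
  dif-all : M ≤ m → 3 ≤ M → ∀ q → q ≤ M → Dif q
  dif-all M≤m 3≤M q q≤M with bool-case (X q)
  ... | inj₁ t = 0 , 0∈ , trans (cong X (+-identityʳ q)) t
  ... | inj₂ f with bool-case (X (M ∸ q))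
  ...   | inj₁ t = M ∸ q , t , trans (cong X (m+[n∸m]≡n q≤M)) M∈
  ...   | inj₂ f′ = 1 , has 1 (≤-trans (s≤s z≤n) 3≤M) (λ e → q≢1 (sym e)) , has (q + 1) q+1≤M (λ e → 1+n≢n (trans (+-comm 1 q) e))
    where
    two : ∀ i j → i ≤ M → j ≤ M → X i ≡ false → X j ≡ false → i ≡ j
    two i j i≤ j≤ ei ej with i ≟ j
    ... | yes e = e
    ... | no ne = ⊥-elim (1+n≰n (≤-trans (≤-trans (≤-reflexive (+-comm 2 m)) (few (i ∷ j ∷ []) ((ne ∷ []) ∷ [] ∷ []) ((i≤ , ei) ∷ (j≤ , ej) ∷ []))) (s≤s M≤m)))
    has : ∀ i → i ≤ M → i ≢ q → X i ≡ true
    has i i≤ ne with bool-case (X i)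
    ... | inj₁ t = t
    ... | inj₂ f″ = ⊥-elim (ne (two i q i≤ q≤M f″ f))
    2q : q + q ≡ M
    2q = trans (cong (q +_) (two q (M ∸ q) q≤M (m∸n≤m M q) f f′)) (m+[n∸m]≡n q≤M)
    q≢1 : q ≢ 1
    q≢1 refl = 1+n≰n (≤-trans 3≤M (≤-reflexive (sym 2q)))
    q+1≤M : q + 1 ≤ M
    q+1≤M with q ≟ 0
    ... | yes refl = ≤-trans (s≤s z≤n) 3≤M
    ... | no ne = ≤-trans (+-monoʳ-≤ q (1≤ ne)) (≤-reflexive 2q)

  -- At most two offsets of [0, M] are missing: try also the pair (2, q + 2).
  dif-most : M ≤ suc m → 7 ≤ M → ∀ q → 2 + q ≤ M → Dif q
  dif-most M≤ 7≤M q q+2≤M with bool-case (X q)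
  ... | inj₁ t = 0 , 0∈ , trans (cong X (+-identityʳ q)) t
  ... | inj₂ f with bool-case (X (M ∸ q))
  ...   | inj₁ t = M ∸ q , t , trans (cong X (m+[n∸m]≡n (≤-trans (m≤n+m q 2) q+2≤M))) M∈
  ...   | inj₂ f′ with pair q 1 (≤-trans (s≤s z≤n) 7≤M) (≤-trans (n≤1+n _) q+2≤M)
  ...     | inj₁ (t , t′) = 1 , t , t′
  ...     | inj₂ (i₁ , c₁ , i₁≤ , u₁) with pair q 2 (≤-trans (s≤s (s≤s z≤n)) 7≤M) q+2≤M
  ...       | inj₁ (t , t′) = 2 , t , t′
  ...       | inj₂ (i₂ , c₂ , i₂≤ , u₂) = ⊥-elim (clash c₁ c₂)
    where
    q≤M : q ≤ M
    q≤M = ≤-trans (m≤n+m q 2) q+2≤M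
    three : ∀ i j l → i ≤ M → j ≤ M → l ≤ M → X i ≡ false → X j ≡ false → X l ≡ false → i ≢ j → i ≢ l → j ≢ l → ⊥
    three i j l i≤ j≤ l≤ ei ej el ij il jl = 1+n≰n (≤-trans (≤-trans (≤-reflexive (+-comm 3 m))
      (few (i ∷ j ∷ l ∷ []) ((ij ∷ il ∷ []) ∷ (jl ∷ []) ∷ [] ∷ []) ((i≤ , ei) ∷ (j≤ , ej) ∷ (l≤ , el) ∷ []))) (s≤s M≤))
    q′ = M ∸ q
    q+q′ : q + q′ ≡ M
    q+q′ = m+[n∸m]≡n q≤M
    third : ∀ i → i ≤ M → X i ≡ false → q ≢ q′ → i ≡ q ⊎ i ≡ q′
    third i i≤ u ne with i ≟ q | i ≟ q′
    ... | yes e | _ = inj₁ e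
    ... | no _ | yes e = inj₂ e
    ... | no n₁ | no n₂ = ⊥-elim (three i q q′ i≤ q≤M (m∸n≤m M q) u f f′ n₁ n₂ ne)
    small : ∀ {a b c : ℕ} → a + b ≡ c → 7 ≤ c → a + b ≤ 6 → ⊥
    small refl h h′ = 1+n≰n (≤-trans h h′)
    clash : (i₁ ≡ 1 ⊎ i₁ ≡ 1 + q) → (i₂ ≡ 2 ⊎ i₂ ≡ 2 + q) → ⊥
    -- Among the missing places q, M - q, i₁, i₂ at least three are distinct: every coincidence
    -- preventing this is absurd, or forces M - q ≤ 1 or M ≤ 6.
    clash c₁ c₂ with q ≟ q′
    ... | yes e = three q i₁ i₂ q≤M i₁≤ i₂≤ f u₁ u₂ (d₁ c₁) (d₂ c₂) (d₃ c₁ c₂)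
      where
      big : ∀ n → q ≡ n → n ≤ 3 → ⊥
      big n refl n≤3 = small {q} {q} (trans (cong (q +_) e) q+q′) 7≤M (+-mono-≤ n≤3 n≤3)
      d₁ : (i₁ ≡ 1 ⊎ i₁ ≡ 1 + q) → q ≢ i₁
      d₁ (inj₁ refl) x = big 1 x (s≤s z≤n)
      d₁ (inj₂ refl) x = 1+n≢n (sym x)
      d₂ : (i₂ ≡ 2 ⊎ i₂ ≡ 2 + q) → q ≢ i₂
      d₂ (inj₁ refl) x = big 2 x (s≤s (s≤s z≤n))
      d₂ (inj₂ refl) x = m≢1+n+m q x
      d₃ : (i₁ ≡ 1 ⊎ i₁ ≡ 1 + q) → (i₂ ≡ 2 ⊎ i₂ ≡ 2 + q) → i₁ ≢ i₂
      d₃ (inj₁ refl) (inj₁ refl) ()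
      d₃ (inj₁ refl) (inj₂ refl) ()
      d₃ (inj₂ refl) (inj₁ refl) x = big 1 (suc-injective x) (s≤s z≤n)
      d₃ (inj₂ refl) (inj₂ refl) x = 1+n≢n (sym (suc-injective x))
    ... | no ne = bad c₁ (third i₁ i₁≤ u₁ ne) c₂ (third i₂ i₂≤ u₂ ne)
      where
      q′≥2 : 2 ≤ q′
      q′≥2 = m+n≤o⇒m≤o∸n 2 q+2≤M
      sums : ∀ {a b} → q ≡ a → q′ ≡ b → a + b ≤ 6 → ⊥
      sums refl refl h = small {q} {q′} q+q′ 7≤M h
      caseA : q ≡ 1 → i₂ ≡ 2 ⊎ i₂ ≡ 2 + q → i₂ ≡ q ⊎ i₂ ≡ q′ → ⊥
      caseA refl (inj₁ refl) (inj₁ ())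
      caseA refl (inj₁ refl) (inj₂ y) = sums refl (sym y) (s≤s (s≤s (s≤s z≤n)))
      caseA refl (inj₂ refl) (inj₁ ())
      caseA refl (inj₂ refl) (inj₂ y) = sums refl (sym y) (s≤s (s≤s (s≤s (s≤s z≤n))))
      caseB : 1 + q ≡ q′ → i₂ ≡ 2 ⊎ i₂ ≡ 2 + q → i₂ ≡ q ⊎ i₂ ≡ q′ → ⊥
      caseB x (inj₁ refl) (inj₁ y) = sums (sym y) (trans (sym x) (cong suc (sym y))) (s≤s (s≤s (s≤s (s≤s (s≤s z≤n)))))
      caseB x (inj₁ refl) (inj₂ y) = sums (suc-injective (trans x (sym y))) (sym y) (s≤s (s≤s (s≤s z≤n)))
      caseB x (inj₂ refl) (inj₁ y) = m≢1+n+m q (sym y)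
      caseB x (inj₂ refl) (inj₂ y) = 1+n≢n (suc-injective (trans y (sym x)))
      bad : i₁ ≡ 1 ⊎ i₁ ≡ 1 + q → i₁ ≡ q ⊎ i₁ ≡ q′ → i₂ ≡ 2 ⊎ i₂ ≡ 2 + q → i₂ ≡ q ⊎ i₂ ≡ q′ → ⊥
      bad (inj₁ refl) (inj₁ x) = caseA (sym x)
      bad (inj₁ refl) (inj₂ x) = λ _ _ → 1+n≰n (≤-trans q′≥2 (≤-reflexive (sym x)))
      bad (inj₂ refl) (inj₁ x) = λ _ _ → 1+n≢n x
      bad (inj₂ refl) (inj₂ x) = caseB x

  DifAll : Set
  DifAll = ∀ q → q ≤ M → Dif q

  -- Relative to ka, the hull of kX is [0, kM] and that of ℓX starts at E. A start inside [0, kM]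
  -- would be an honest k-fold sum, by `blocks-split` and one difference, although ℓa is itself an
  -- ℓ-fold sum. `hull-L` is the same argument for the point ka and the hull of ℓX.
  hull-K : DifAll → E ≤ (2 + κ) * M → ⊥
  hull-K dif E≤ = let w , q , w≤ , q≤ , eq = blocks-split (suc κ) M E E≤
                      i , n , ei , rn , i+n = blocks₁ κ w w≤
                  in conf-K ei rn (zeros ℓ) (dif q q≤) (trans (cong (_+ q) i+n) (trans (sym eq) (sym (+-identityʳ E))))

  hull-L : DifAll → ∀ e → p ≡ E + e → e ≤ suc ℓ * M → ⊥
  hull-L dif e p≡ e≤ = let w , q , w≤ , q≤ , eq = blocks-split ℓ M e e≤
                       in conf-Lp 0∈ (zeros κ) (blocks ℓ w w≤) (dif q q≤) (trans p≡ (trans (cong (E +_) eq) (sym (+-assoc E _ q))))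

  -- The hulls of kX and ℓX are disjoint, with gaps g₁ and g₂ between them.
  Gaps : ℕ → ℕ → Set
  Gaps g₁ g₂ = E ≡ (2 + κ) * M + suc g₁ × p ≡ E + (suc ℓ * M + suc g₂)

  gaps : DifAll → E < p → ∃ λ g₁ → ∃ λ g₂ → Gaps g₁ g₂
  gaps dif E<p = E ∸ suc ((2 + κ) * M) , p ∸ E ∸ suc (suc ℓ * M) , ge (≰⇒> (hull-K dif)) ,
      trans (sym (m+[n∸m]≡n (<⇒≤ E<p))) (cong (E +_) (ge (≰⇒> (hull-L dif (p ∸ E) (sym (m+[n∸m]≡n (<⇒≤ E<p)))))))
    where
    ge : ∀ {a b} → suc a ≤ b → b ≡ a + suc (b ∸ suc a)
    ge {a} {b} h = trans (sym (m+[n∸m]≡n h)) (sym (+-suc a _))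

  -- With two missing places the differences M - 1 and M are not guaranteed, so the hulls are
  -- separated only up to an overlap of one on each side: kM ≤ E + 1 and ℓM + E ≤ p + 1. This still
  -- contradicts the length.
  too-long : .{{_ : NonZero M}} → (∀ q → 2 + q ≤ M → Dif q) → 3 ≤ M → E < p → p + 3 ≤ (3 + κ + ℓ) * M → ⊥
  too-long dif 3≤M E<p long = 1+n≰n {p + 2} (lin 0 (long ⊹ bK ⊹ bL) (eqn p κ ℓ M E))
    where
    eqn : ∀ p κ ℓ M E → 1 + (p + 2) + ((3 + κ + ℓ) * M + (E + 1) + (p + 1)) + 0 ≡ p + 2 + (p + 3 + (2 + κ) * M + (suc ℓ * M + E))
    eqn = solve-∀
    e = p ∸ E
    p≡ : p ≡ E + e
    p≡ = sym (m+[n∸m]≡n (<⇒≤ E<p))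
    quot : ∀ n h → suc n < suc h * M → suc n / M ≤ h
    quot n h lt = ≤-pred (m<n*o⇒m/o<n lt)
    euclid : ∀ n → suc n ≡ (suc n / M) * M + suc n % M
    euclid n = trans (m≡m%n+[m/n]*n (suc n) M) (+-comm (suc n % M) _)
    bK : (2 + κ) * M ≤ E + 1
    -- E + 1 is divided by M instead of E: a positive remainder q + 1 < M leaves a difference q ≤ M
    -- - 2, and remainder 0 is met by the difference 1 on the other side.
    bK with suc (suc E) ≤? (2 + κ) * M
    ... | no ¬h = ≤-trans (≤-pred (≰⇒> ¬h)) (≤-reflexive (+-comm 1 E))
    ... | yes h with suc E % M in eq | m%n<n (suc E) M | blocks₁ κ (suc E / M) (quot E (suc κ) h)
    ...   | zero | _ | i , n , ei , rn , i+n = ⊥-elim (conf-L ei rn (zeros ℓ) (dif 1 3≤M)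
              (trans i+n (trans (sym (trans (euclid E) (trans (cong (suc E / M * M +_) eq) (+-identityʳ _)))) (trans (+-comm 1 E) (cong (_+ 1) (sym (+-identityʳ E)))))))
    ...   | suc q | lt | i , n , ei , rn , i+n = ⊥-elim (conf-K ei rn (zeros ℓ) (dif q lt)
              (trans (cong (_+ q) i+n) (trans (suc-injective (trans (sym (+-suc _ q)) (trans (cong (suc E / M * M +_) (sym eq)) (sym (euclid E))))) (sym (+-identityʳ E)))))
    bL : suc ℓ * M + E ≤ p + 1
    bL with suc (suc e) ≤? suc ℓ * M
    ... | no ¬h = ≤-trans (+-monoˡ-≤ E (≤-pred (≰⇒> ¬h))) (≤-reflexive (trans (cong suc (trans (+-comm e E) (sym p≡))) (+-comm 1 p)))
    ... | yes h with suc e % M in eq | m%n<n (suc e) M | blocks ℓ (suc e / M) (quot e ℓ h)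
    ...   | zero | _ | rn = ⊥-elim (conf-Kp 0∈ (zeros κ) rn (dif 1 3≤M)
              (trans (cong suc p≡) (trans (sym (+-suc E e)) (cong (E +_) (trans (euclid e) (trans (cong (suc e / M * M +_) eq) (+-identityʳ _)))))))
    ...   | suc q | lt | rn = ⊥-elim (conf-Lp 0∈ (zeros κ) rn (dif q lt)
              (trans p≡ (trans (cong (E +_) (suc-injective (trans (euclid e) (trans (cong (suc e / M * M +_) eq) (+-suc _ q))))) (sym (+-assoc E _ q)))))

  module _ {κ′ g₁ g₂ : ℕ} (κ≡ : κ ≡ suc κ′) (dif : DifAll) (gp : Gaps g₁ g₂) where

    private
      E≡ = proj₁ gp
      p≡ = proj₂ gp

    -- Because y + (k−1)X is disjoint from ℓX.
    outside : ∀ u → Ω u ≡ true → u ≤ M + g₁ ⊎ p ≤ u + g₂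
    outside u eu with u ≤? E
    ... | yes u≤E with E ∸ u ≤? suc κ * M
    ...   | no gt = inj₁ (lin 0 (≰⇒> gt ⊹ ≤-reflexive (m+[n∸m]≡n u≤E) ⊹ ≤-reflexive E≡) (eqn u κ M (E ∸ u) E g₁))
      where
      eqn : ∀ u κ M f E g → u + (f + E + ((2 + κ) * M + suc g)) + 0 ≡ M + g + (1 + suc κ * M + (u + f) + E)
      eqn = solve-∀
    ...   | yes le = let w , q , w≤ , q≤ , eq = blocks-split κ M (E ∸ u) le
                         i , n , ei , rn , i+n = blocks₁ κ′ w (≤-trans w≤ (≤-reflexive κ≡))
                     in ⊥-elim (conf-K ei (ORep-≡ (sym κ≡) refl (cons eu rn)) (zeros ℓ) (dif q q≤)
                          (trans (r i u n q) (trans (cong (λ z → u + (z + q)) i+n) (trans (cong (u +_) (sym eq)) (trans (m+[n∸m]≡n u≤E) (sym (+-identityʳ E)))))))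
      where
      r : ∀ i u n q → i + (u + n) + q ≡ u + (i + n + q)
      r = solve-∀
    outside u eu | no gt with u ∸ E ≤? suc ℓ * M
    ... | no gt′ = inj₂ (lin 0 (≰⇒> gt′ ⊹ ≤-reflexive (m+[n∸m]≡n (<⇒≤ (≰⇒> gt))) ⊹ ≤-reflexive p≡) (eqn p u ℓ M E (u ∸ E) g₂))
      where
      eqn : ∀ p u ℓ M E f g → p + (f + u + (E + (suc ℓ * M + suc g))) + 0 ≡ u + g + (1 + suc ℓ * M + (E + f) + p)
      eqn = solve-∀
    ... | yes le = let w , q , w≤ , q≤ , eq = blocks-split ℓ M (u ∸ E) le
                   in ⊥-elim (conf-L 0∈ (ORep-≡ (sym κ≡) refl (cons eu (zeros κ′))) (blocks ℓ w w≤) (dif q q≤)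
                        (trans (+-identityʳ u) (trans (sym (m+[n∸m]≡n (<⇒≤ (≰⇒> gt)))) (trans (cong (E +_) eq) (sym (+-assoc E _ q))))))

    module _ (r : ℕ) (eu : Ω (M + r) ≡ true) where

      private
        mixed : ∀ h t → t ≤ h → ORep Ω h (h * M + t * r)
        mixed h t t≤ = ORep-≡ (m+[n∸m]≡n t≤)
            (trans (eqn t M r (h ∸ t)) (cong (λ z → z * M + t * r) (m+[n∸m]≡n t≤)))
            (append (repeat eu t) (repeat (X⊆Ω M∈) (h ∸ t)))
          where
          eqn : ∀ t M r s → t * (M + r) + s * M ≡ (t + s) * M + t * r
          eqn = solve-∀

      -- With y = a + (M + r)d, taking t copies of y and κ - t of the end point, one more end point,
      -- and any difference in [0, M] keeps tr out of [g₁ + 1, g₁ + 1 + M]. Raising t from 0 cannot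
      -- jump this window.
      steps-K : r ≤ suc M → κ * r ≤ g₁
      steps-K r≤ = stays-below r g₁ M κ r≤ λ t c t≤ c≤ eq →
        conf-K M∈ (mixed κ t t≤) (zeros ℓ) (dif (M ∸ c) (m∸n≤m M c))
          (trans (cong (λ z → M + (κ * M + z) + (M ∸ c)) eq) (trans (eqn κ M g₁ c (M ∸ c))
            (trans (cong (λ z → M + (κ * M + suc g₁) + z) (m+[n∸m]≡n c≤)) (trans (eqn′ κ M g₁) (trans (sym E≡) (sym (+-identityʳ E)))))))
        where
        eqn : ∀ κ M g c f → M + (κ * M + (suc g + c)) + f ≡ M + (κ * M + suc g) + (c + f)
        eqn = solve-∀
        eqn′ : ∀ κ M g → M + (κ * M + suc g) + M ≡ (2 + κ) * M + suc g
        eqn′ = solve-∀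

      steps-L : r ≤ suc M → ℓ * r ≤ g₂
      steps-L r≤ = stays-below r g₂ M ℓ r≤ λ t c t≤ c≤ eq →
        conf-Lp 0∈ (zeros κ) (mixed ℓ t t≤) (dif (M ∸ c) (m∸n≤m M c))
          (trans p≡ (sym (trans (cong (λ z → E + (ℓ * M + z) + (M ∸ c)) eq) (trans (eqn E ℓ M g₂ c (M ∸ c))
            (trans (cong (λ z → E + (ℓ * M + suc g₂ + z)) (m+[n∸m]≡n c≤)) (eqn′ E ℓ M g₂))))))
        where
        eqn : ∀ E ℓ M g c f → E + (ℓ * M + (suc g + c)) + f ≡ E + (ℓ * M + suc g + (c + f))
        eqn = solve-∀
        eqn′ : ∀ E ℓ M g → E + (ℓ * M + suc g + M) ≡ E + (suc ℓ * M + suc g)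
        eqn′ = solve-∀

      -- For a gapless X the two terms on the side of k reach every offset up to 2M by themselves.
      -- No term of the ℓ-fold sum is spent on a difference, so all ℓ of them may be y and the
      -- window is almost twice as wide.
      steps-L′ : (∀ i → i ≤ M → X i ≡ true) → r ≤ suc (M + M) → suc ℓ * r ≤ g₂
      steps-L′ full r≤ = stays-below r g₂ (M + M) (suc ℓ) r≤ λ t c t≤ c≤ eq →
        let i₁ , i₂ , h₁ , h₂ , i₁+i₂ = two c c≤ in
        conf (full i₁ h₁) (full i₂ h₂) (zeros κ) (mixed (suc ℓ) t t≤)
          (inj₂ (trans (cong₂ (λ y z → y + 0 + z) i₁+i₂ p≡) (trans (eqn c E ℓ M g₂) (cong (λ z → E + (suc ℓ * M + z)) (sym eq)))))
        where
        two : ∀ c → c ≤ M + M → ∃ λ i₁ → ∃ λ i₂ → i₁ ≤ M × i₂ ≤ M × i₁ + i₂ ≡ c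
        two c c≤ with c ≤? M
        ... | yes le = c , 0 , le , z≤n , +-identityʳ c
        ... | no gt = M , c ∸ M , ≤-refl , m≤n+o⇒m∸n≤o c M c≤ , m+[n∸m]≡n (<⇒≤ (≰⇒> gt))
        eqn : ∀ c E ℓ M g → c + 0 + (E + (suc ℓ * M + suc g)) ≡ E + (suc ℓ * M + (suc g + c))
        eqn = solve-∀

      -- The steps give (k - 2)r + (ℓ - 1)r ≤ g₁ + g₂ = λ, whereas k + ℓ - 3 ≥ λ + 2: no point of Ω
      -- fits beyond X.
      thin : ∀ {λ'} → M ≡ m → g₁ + g₂ ≡ λ' → λ' + 5 ≤ 3 + κ + ℓ → 3 + κ + ℓ ≤ m + 1 → 1 ≤ r → r ≤ g₁ → ⊥
      thin {λ'} refl g≡ hλ s≤ 1≤r r≤ = 1+n≰n {λ'} (lin 1 (steps-K r≤M ⊹ steps-L r≤M ⊹ (κ + ℓ) ⊗ 1≤r ⊹ ≤-reflexive g≡ ⊹ hλ) (eqn κ ℓ r g₁ g₂ λ'))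
        where
        r≤M : r ≤ suc M
        r≤M = lin (5 + g₂) (r≤ ⊹ ≤-reflexive g≡ ⊹ hλ ⊹ s≤) (eq′ r M g₁ g₂ λ' (3 + κ + ℓ))
          where
          eq′ : ∀ r M g₁ g₂ l s → r + (g₁ + l + s + (M + 1)) + (5 + g₂) ≡ suc M + (r + (g₁ + g₂) + (l + 5) + s)
          eq′ = solve-∀
        eqn : ∀ κ ℓ r g₁ g₂ l → 1 + l + (g₁ + g₂ + (κ + ℓ) * r + l + (3 + κ + ℓ)) + 1 ≡ l + (κ * r + ℓ * r + (κ + ℓ) * 1 + (g₁ + g₂) + (l + 5))
        eqn = solve-∀

      -- Here (k - 2)r + ℓr ≤ k + ℓ + λ ≤ 2(k + ℓ) - 5 < 2(k + ℓ - 2), so r < 2 and y is the place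
      -- next to X. The two step bounds at r = 1 are what later leaves only a few values of g₁.
      thick : ∀ {λ'} → suc M ≡ m → (∀ i → i ≤ M → X i ≡ true) → g₁ + g₂ ≡ 3 + κ + ℓ + λ' → λ' + 5 ≤ 3 + κ + ℓ → 3 + κ + ℓ ≤ m + 1 →
        1 ≤ r → r ≤ g₁ → r ≡ 1 × κ ≤ g₁ × suc ℓ ≤ g₂
      thick {λ'} refl full g≡ hλ s≤ 1≤r r≤ = r≡1 , subst (λ z → z ≤ g₁) (trans (cong (κ *_) r≡1) (*-identityʳ κ)) κr ,
          subst (λ z → z ≤ g₂) (trans (cong (suc ℓ *_) r≡1) (*-identityʳ (suc ℓ))) ℓr
        where
        s = 3 + κ + ℓ
        r≤2M : r ≤ suc (M + M)
        r≤2M = lin (2 + g₂) (r≤ ⊹ ≤-reflexive g≡ ⊹ hλ ⊹ 2 ⊗ s≤) (eq′ r M g₁ g₂ λ' s)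
          where
          eq′ : ∀ r M g₁ g₂ l s → r + (g₁ + (s + l) + s + 2 * (suc M + 1)) + (2 + g₂) ≡ suc (M + M) + (r + (g₁ + g₂) + (l + 5) + 2 * s)
          eq′ = solve-∀
        ℓr : suc ℓ * r ≤ g₂
        ℓr = steps-L′ full r≤2M
        r≤M : r ≤ suc M
        -- `steps-K` needs r ≤ M + 1, which is not known at first. The wider window of `steps-L′`
        -- applies already, and then 2r ≤ r + ℓr ≤ g₁ + g₂ suffices.
        r≤M = *-cancelˡ-≤ 2 (lin (3 + ℓ * r) (r≤ ⊹ ℓr ⊹ ≤-reflexive g≡ ⊹ hλ ⊹ 2 ⊗ s≤) (eq′ r M g₁ g₂ λ' s ℓ))
          where
          eq′ : ∀ r M g₁ g₂ l s ℓ → 2 * r + (g₁ + g₂ + (s + l) + s + 2 * (suc M + 1)) + (3 + ℓ * r) ≡ 2 * suc M + (r + suc ℓ * r + (g₁ + g₂) + (l + 5) + 2 * s)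
          eq′ = solve-∀
        κr : κ * r ≤ g₁
        κr = steps-K r≤M
        r≡1 : r ≡ 1
        r≡1 with r ≤? 1
        ... | yes h = ≤-antisym h 1≤r
        ... | no gt = ⊥-elim (1+n≰n {s + λ'} (lin 0 (κr ⊹ ℓr ⊹ ≤-reflexive g≡ ⊹ hλ ⊹ (κ + suc ℓ) ⊗ ≰⇒> gt) (eq′ r g₁ g₂ λ' κ ℓ)))
          where
          eq′ : ∀ r g₁ g₂ l κ ℓ → 1 + (3 + κ + ℓ + l) + (g₁ + g₂ + (3 + κ + ℓ + l) + (3 + κ + ℓ) + (κ + suc ℓ) * r) + 0
            ≡ 3 + κ + ℓ + l + (κ * r + suc ℓ * r + (g₁ + g₂) + (l + 5) + (κ + suc ℓ) * 2)
          eq′ = solve-∀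

-- Passing between offsets and points, and reversing a progression.

module _ {p : ℕ} .{{nz : NonZero p}} (pr : Prime p) where

  private
    Set′ : Set
    Set′ = Fin p → Bool

  offsets-few : ∀ {X : Set′} {a d M} → d ≢ ι 0 → M < p → X ⊑[ a , d ] M →
    ∀ ms → Unique ms → All (λ i → i ≤ M × X (lc a d 1 i) ≡ false) ms → cardF X + length ms ≤ suc M
  offsets-few {X} {a} {d} {M} d≢0 M<p cov ms uniq all =
    ≤-trans (+-mono-≤ inside outside′) (≤-reflexive (trans (cnt-not (λ i → X (lc a d 1 i)) (upTo (suc M))) (length-upTo (suc M))))
    where
    off : Fin p → ℕ
    off x = proj₁ (lc-surj pr d≢0 a 1 x)
    off-eq : ∀ x → x ≡ lc a d 1 (off x)
    off-eq x = proj₂ (proj₂ (lc-surj pr d≢0 a 1 x))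
    off≤ : ∀ x → X x ≡ true → off x ≤ M
    off≤ x ex = let i , i≤ , eq = cov x ex in
      ≤-trans (≤-reflexive (lc-inj pr d≢0 a 1 (proj₁ (proj₂ (lc-surj pr d≢0 a 1 x))) (≤-trans (s≤s i≤) M<p) (trans (sym (off-eq x)) eq))) i≤
    inside : cardF X ≤ cnt (λ i → X (lc a d 1 i)) (upTo (suc M))
    inside = injection⇒length≤ off {filterᵇ X (allFin p)} {filterᵇ (λ i → X (lc a d 1 i)) (upTo (suc M))} (Uq.filter⁺ (T? ∘ X) (Uq.allFin⁺ p))
      (λ {x} i → let ex = proj₂ (filterᵇ⁻ X {allFin p} i) in filterᵇ⁺ (λ i → X (lc a d 1 i)) (∈-upTo⁺ (s≤s (off≤ x ex))) (trans (cong X (sym (off-eq x))) ex))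
      (λ {x} {y} _ _ e → trans (off-eq x) (trans (cong (lc a d 1) e) (sym (off-eq y))))
    outside′ : length ms ≤ cnt (λ i → not (X (lc a d 1 i))) (upTo (suc M))
    outside′ = injection⇒length≤ (λ i → i) {ms} {filterᵇ (λ i → not (X (lc a d 1 i))) (upTo (suc M))} uniq
      (λ i → filterᵇ⁺ (λ i → not (X (lc a d 1 i))) (∈-upTo⁺ (s≤s (proj₁ (All.lookup all i)))) (false⇒not-true (proj₂ (All.lookup all i)))) (λ _ _ e → e)

  ORep⇒Rep : ∀ {Ω : Set′} a d {h n} → ORep (λ i → Ω (lc a d 1 i)) h n → Rep Ω h (lc a d h n)
  ORep⇒Rep {Ω} a d [] = subst (Rep Ω 0) (sym (lc-00 a d)) []
  ORep⇒Rep a d (cons {h} {i} {n} e r) = cons e (ORep⇒Rep a d r) (lc-+ a d 1 i h n)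

  lc-reverse : ∀ a d M h n v c → v + n ≡ h * M + c * p → lc (lc a d 1 M) (-F d) h n ≡ lc a d h v
  lc-reverse a d M h n v c eq = +F-cancelʳ (ι n *F d) _ _ (trans lhs (sym (trans (lc-shift a d h v n) (trans (cong (lc a d h) eq) (wrap c)))))
    where
    wrap : ∀ c → lc a d h (h * M + c * p) ≡ lc a d h (h * M)
    wrap zero = cong (lc a d h) (+-identityʳ _)
    wrap (suc c) = trans (cong (lc a d h) (trans (cong (h * M +_) (+-comm p (c * p))) (sym (+-assoc (h * M) (c * p) p)))) (trans (lc-p a d h _) (wrap c))
    lhs : lc (lc a d 1 M) (-F d) h n +F ι n *F d ≡ lc a d h (h * M)
    lhs = trans (cong (_+F ι n *F d) (lc-def _ (-F d) h n)) (trans (+F-assoc (ι h *F lc a d 1 M) (ι n *F (-F d)) (ι n *F d))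
      (trans (cong (ι h *F lc a d 1 M +F_) (trans (sym (*F-distribˡ (ι n) (-F d) d)) (trans (cong (ι n *F_) (+F-inverseˡ d)) (*F-zeroʳ (ι n)))))
        (trans (+F-identityʳ _) (trans (cong (ι h *F_) (lc-1 a d M)) (trans (*F-distribˡ (ι h) a (ι M *F d))
          (trans (cong (ι h *F a +F_) (trans (sym (*F-assoc (ι h) (ι M) d)) (cong (_*F d) (ι-* h M)))) (sym (lc-def a d h (h * M)))))))))

  ⊑-reverse : ∀ {X : Set′} {a d M} → X ⊑[ a , d ] M → X ⊑[ lc a d 1 M , (-F d) ] M
  ⊑-reverse {a = a} {d} {M} cov x ex = let i , i≤ , eq = cov x ex in M ∸ i , m∸n≤m M i ,
    trans eq (sym (lc-reverse a d M 1 (M ∸ i) i 0 (trans (m+[n∸m]≡n i≤) (sym (trans (+-identityʳ _) (+-identityʳ M))))))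

  lc-reverse-at : ∀ a d M {i} → i ≤ M → lc (lc a d 1 M) (-F d) 1 i ≡ lc a d 1 (M ∸ i)
  lc-reverse-at a d M {i} i≤ = lc-reverse a d M 1 i (M ∸ i) 0 (trans (m∸n+n≡m i≤) (sym (trans (+-identityʳ _) (+-identityʳ M))))

  -- Read from its far end with difference -d, the progression has its two gaps exchanged. Points of
  -- Ω before X thereby become points after it.
  lc-reverse-gap : ∀ a d k ℓ M E g₂ → lc a d ℓ 0 ≡ lc a d k E → p ≡ E + (ℓ * M + suc g₂) →
    lc (lc a d 1 M) (-F d) ℓ 0 ≡ lc (lc a d 1 M) (-F d) k (k * M + suc g₂)
  lc-reverse-gap a d k ℓ M E g₂ eqE pE = trans (lc-reverse a d M ℓ 0 (ℓ * M) 0 refl)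
    (trans shift (sym (lc-reverse a d M k (k * M + suc g₂) (E + ℓ * M) 1 (trans (eqn E ℓ M k g₂) (cong (k * M +_) (trans (sym pE) (sym (*-identityˡ p))))))))
    where
    shift : lc a d ℓ (ℓ * M) ≡ lc a d k (E + ℓ * M)
    shift = trans (sym (trans (lc-+ a d ℓ 0 0 (ℓ * M)) (cong (λ h → lc a d h (ℓ * M)) (+-identityʳ ℓ))))
      (trans (cong (_+F lc a d 0 (ℓ * M)) eqE) (trans (lc-+ a d k E 0 (ℓ * M)) (cong (λ h → lc a d h (E + ℓ * M)) (+-identityʳ k))))
    eqn : ∀ E ℓ M k g → E + ℓ * M + (k * M + suc g) ≡ k * M + (E + (ℓ * M + suc g))
    eqn = solve-∀

-- The paper's k and ℓ are 3 + κ′ and suc ℓ₀.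
module Structure (κ′ ℓ₀ λ' m : ℕ) {p : ℕ} .{{nz : NonZero p}} (pr : Prime p)
  (hλ : λ' + 5 ≤ 3 + suc κ′ + ℓ₀) (7≤m : 7 ≤ m) (s≤ : 3 + suc κ′ + ℓ₀ ≤ m + 1)
  (p≡ : p ≡ (3 + suc κ′ + ℓ₀) * m + 2 + λ')
  (X Ω : Fin p → Bool) (X⊆Ω : ∀ x → X x ≡ true → Ω x ≡ true) (|X| : cardF X ≡ m)
  (H : ∀ {x₁ x₂ z₁ z₂} → X x₁ ≡ true → X x₂ ≡ true → Rep Ω (suc κ′) z₁ → Rep Ω (suc ℓ₀) z₂ → (x₁ +F x₂) +F z₁ ≡ z₂ → ⊥) where

  k = 3 + κ′
  ℓ = suc ℓ₀

  -- The k-fold and ℓ-fold sums of the m + 1 places have disjoint hulls with gaps g₁ and g₂; this is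
  -- the defining position of an extremal cuboid, up to scaling and reversal.
  Extremal : Set
  Extremal = ∃ λ a → ∃ λ d → ∃ λ g₁ → ∃ λ g₂ → d ≢ ι 0 × (Ω ⊑[ a , d ] m) ×
    lc a d ℓ 0 ≡ lc a d k (k * m + suc g₁) × g₁ + g₂ ≡ λ'

  record Interval (a d : Fin p) (g₁ g₂ : ℕ) : Set where
    field
      M : ℕ
      M≡ : suc M ≡ m
      d≢0 : d ≢ ι 0
      X⊑ : X ⊑[ a , d ] M
      ⊑X : ∀ i → i ≤ M → X (lc a d 1 i) ≡ true
      gap : lc a d ℓ 0 ≡ lc a d k (k * M + suc g₁)
      total : g₁ + g₂ ≡ 3 + suc κ′ + ℓ₀ + λ'

  Extended : Set
  Extended = ∃ λ a → ∃ λ d → ∃ λ g₁ → ∃ λ g₂ → Interval a d g₁ g₂ × Ω (lc a d 1 m) ≡ true ×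
    (Ω ⊑[ a , d ] m) × suc κ′ ≤ g₁ × ℓ ≤ g₂

  private
    m+2<p : suc (suc m) < p
    m+2<p = lin (λ' * m + 3 * m + 6 + λ') (m ⊗ hλ ⊹ ≤-reflexive (sym p≡) ⊹ 7≤m) (eqn m (3 + suc κ′ + ℓ₀) λ' p)
      where
      eqn : ∀ m s l p → 3 + m + (m * s + p + m) + (l * m + 3 * m + 6 + l) ≡ p + (m * (l + 5) + (s * m + 2 + l) + 7)
      eqn = solve-∀

    module Line (M : ℕ) (M<p : M < p) (a d : Fin p) (d≢0 : d ≢ ι 0) (cov : X ⊑[ a , d ] M)
                (e0 : X (lc a d 1 0) ≡ true) (eM : X (lc a d 1 M) ≡ true)
                (E : ℕ) (E<p : E < p) (eqE : lc a d ℓ 0 ≡ lc a d k E) where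

      conf : ∀ {i₁ i₂ n₁ n₂} → X (lc a d 1 i₁) ≡ true → X (lc a d 1 i₂) ≡ true →
        ORep (λ i → Ω (lc a d 1 i)) (suc κ′) n₁ → ORep (λ i → Ω (lc a d 1 i)) ℓ n₂ →
        (i₁ + i₂ + n₁ ≡ E + n₂ ⊎ i₁ + i₂ + n₁ + p ≡ E + n₂) → ⊥
      conf {i₁} {i₂} {n₁} {n₂} e₁ e₂ r₁ r₂ eq = H e₁ e₂ (ORep⇒Rep pr a d r₁) (ORep⇒Rep pr a d r₂)
        (trans (cong (_+F lc a d (suc κ′) n₁) (lc-+ a d 1 i₁ 1 i₂)) (trans (lc-+ a d 2 (i₁ + i₂) (suc κ′) n₁) (trans (wrap eq)
          (trans (sym (trans (lc-+ a d k E 0 n₂) (cong (λ h → lc a d h (E + n₂)) (+-identityʳ k))))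
            (trans (cong (_+F lc a d 0 n₂) (sym eqE)) (trans (lc-+ a d ℓ 0 0 n₂) (cong (λ h → lc a d h n₂) (+-identityʳ ℓ))))))))
        where
        wrap : (i₁ + i₂ + n₁ ≡ E + n₂ ⊎ i₁ + i₂ + n₁ + p ≡ E + n₂) → lc a d k (i₁ + i₂ + n₁) ≡ lc a d k (E + n₂)
        wrap (inj₁ q) = cong (lc a d k) q
        wrap (inj₂ q) = trans (sym (lc-p a d k _)) (cong (lc a d k) q)

      few : ∀ ms → Unique ms → All (λ i → i ≤ M × X (lc a d 1 i) ≡ false) ms → m + length ms ≤ suc M
      few ms u all = subst (λ z → z + length ms ≤ suc M) |X| (offsets-few pr {X} {a} {d} d≢0 M<p cov ms u all)

      open Offsets (suc κ′) ℓ₀ m M E p (λ i → X (lc a d 1 i)) (λ i → Ω (lc a d 1 i)) (X⊆Ω _) e0 eM few conf public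

      gaps-total : ∀ {g₁ g₂} → Gaps g₁ g₂ → p ≡ (3 + suc κ′ + ℓ₀) * M + 2 + (g₁ + g₂)
      gaps-total {g₁} {g₂} (E≡ , pE) = trans pE (trans (cong (_+ (ℓ * M + suc g₂)) E≡) (eqn κ′ ℓ₀ M g₁ g₂))
        where
        eqn : ∀ κ ℓ M g₁ g₂ → (2 + suc κ) * M + suc g₁ + (suc ℓ * M + suc g₂) ≡ (3 + suc κ + ℓ) * M + 2 + (g₁ + g₂)
        eqn = solve-∀

    Short Long : ℕ → ℕ → ℕ → Set
    Short M g₁ g₂ = M ≡ m × g₁ + g₂ ≡ λ'
    Long M g₁ g₂ = suc M ≡ m × g₁ + g₂ ≡ 3 + suc κ′ + ℓ₀ + λ'

    right : ∀ M (M<p : M < p) a d (d≢0 : d ≢ ι 0) (cov : X ⊑[ a , d ] M) (e0 : X (lc a d 1 0) ≡ true) (eM : X (lc a d 1 M) ≡ true)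
      g₁ g₂ (E<p : k * M + suc g₁ < p) (eqE : lc a d ℓ 0 ≡ lc a d k (k * M + suc g₁)) → p ≡ k * M + suc g₁ + (ℓ * M + suc g₂) →
      (∀ q → q ≤ M → Line.Dif M M<p a d d≢0 cov e0 eM (k * M + suc g₁) E<p eqE q) →
      ∀ u → Ω (lc a d 1 u) ≡ true → (∀ x → Ω x ≡ true → X x ≡ true ⊎ x ≡ lc a d 1 u) → M < u → u ≤ M + g₁ →
      (Short M g₁ g₂ → ⊥) × (Long M g₁ g₂ → Extended)
    right M M<p a d d≢0 cov e0 eM g₁ g₂ E<p eqE pE dif u eu Ω⊆ M<u u≤ = short , long
      where
      open Line M M<p a d d≢0 cov e0 eM (k * M + suc g₁) E<p eqE
      r = u ∸ M
      u≡ : M + r ≡ u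
      u≡ = m+[n∸m]≡n (<⇒≤ M<u)
      eu′ : Ω (lc a d 1 (M + r)) ≡ true
      eu′ = trans (cong (λ z → Ω (lc a d 1 z)) u≡) eu
      1≤r : 1 ≤ r
      1≤r = m+n≤o⇒m≤o∸n 1 M<u
      r≤ : r ≤ g₁
      r≤ = m≤n+o⇒m∸n≤o u M u≤
      short : Short M g₁ g₂ → ⊥
      short (M≡ , g≡) = thin refl dif (refl , pE) r eu′ M≡ g≡ hλ s≤ 1≤r r≤
      long : Long M g₁ g₂ → Extended
      long (M≡ , g≡) = a , d , g₁ , g₂ ,
          record { M = M ; M≡ = M≡ ; d≢0 = d≢0 ; X⊑ = cov ; ⊑X = full ; gap = eqE ; total = g≡ } ,
          trans (cong (λ z → Ω (lc a d 1 z)) (sym u≡m)) eu , Ω⊑ , proj₁ (proj₂ th) , proj₂ (proj₂ th)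
        where
        full : ∀ i → i ≤ M → X (lc a d 1 i) ≡ true
        full i i≤ with bool-case (X (lc a d 1 i))
        ... | inj₁ t = t
        ... | inj₂ f = ⊥-elim (1+n≰n (≤-trans (≤-reflexive (+-comm 1 m)) (≤-trans (few (i ∷ []) ([] ∷ []) ((i≤ , f) ∷ [])) (≤-reflexive M≡))))
        th = thick refl dif (refl , pE) r eu′ M≡ full g≡ hλ s≤ 1≤r r≤
        u≡m : u ≡ m
        u≡m = trans (sym u≡) (trans (cong (M +_) (proj₁ th)) (trans (+-comm M 1) M≡))
        Ω⊑ : Ω ⊑[ a , d ] m
        Ω⊑ x ex with Ω⊆ x ex
        ... | inj₁ t = let i , i≤ , eq = cov x t in i , ≤-trans i≤ (≤-trans (n≤1+n M) (≤-reflexive M≡)) , eq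
        ... | inj₂ e = m , ≤-refl , trans e (cong (lc a d 1) u≡m)

  Result : Set
  Result = Extremal ⊎ (∃ λ a → ∃ λ d → ∃ λ g₁ → ∃ λ g₂ → Interval a d g₁ g₂ × (∀ x → Ω x ≡ true → X x ≡ true)) ⊎ Extended

  private
    3≤ : ∀ {M} → m ≤ suc M → 3 ≤ M
    3≤ m≤ = ≤-pred (≤-trans (≤-trans (s≤s (s≤s (s≤s (s≤s z≤n)))) 7≤m) m≤)

    solve-line : cardF Ω ≤ suc m → ∀ M (M<p : M < p) a d (d≢0 : d ≢ ι 0) (cov : X ⊑[ a , d ] M)
      (e0 : X (lc a d 1 0) ≡ true) (eM : X (lc a d 1 M) ≡ true) E (E<p : E < p) (eqE : lc a d ℓ 0 ≡ lc a d k E) →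
      M ≤ m → m ≤ suc M → (∃ λ g₁ → ∃ λ g₂ → E ≡ k * M + suc g₁ × p ≡ E + (ℓ * M + suc g₂)) → Result
    solve-line |Ω| M M<p a d d≢0 cov e0 eM E E<p eqE M≤m m≤ (g₁ , g₂ , refl , pE) = split (m≤n⇒m<n∨m≡n M≤m)
      where
      open Line M M<p a d d≢0 cov e0 eM (k * M + suc g₁) E<p eqE
      3≤M : 3 ≤ M
      3≤M = 3≤ m≤
      dif = dif-all M≤m 3≤M
      total = gaps-total (refl , pE)

      Z : Fin p → Bool
      Z x = Ω x ∧ not (X x)

      extra : (∀ x → Ω x ≡ true → X x ≡ true) ⊎
        (∃ λ u → u < p × Ω (lc a d 1 u) ≡ true × X (lc a d 1 u) ≡ false × (∀ x → Ω x ≡ true → X x ≡ true ⊎ x ≡ lc a d 1 u))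
      extra with bool-case (any Z (allFin p))
      ... | inj₂ f = inj₁ λ x ex → inX x ex (bool-case (X x))
        where
        inX : ∀ x → Ω x ≡ true → X x ≡ true ⊎ X x ≡ false → X x ≡ true
        inX x ex (inj₁ t) = t
        inX x ex (inj₂ n) = ⊥-elim (true≢false (any⁺ Z (∈-allFin x) (∧-true ex (false⇒not-true n))) f)
      ... | inj₁ t = inj₂ (u , u<p , trans (cong Ω (sym y≡)) (∧-trueˡ ey) , trans (cong X (sym y≡)) (not-true⇒false (∧-trueʳ {Ω y} ey)) ,
              λ x ex → only x ex (bool-case (X x)))
        where
        y = proj₁ (any⁻ Z (allFin p) t)
        ey = proj₂ (any⁻ Z (allFin p) t)
        sur = lc-surj pr d≢0 a 1 y
        u = proj₁ sur
        u<p = proj₁ (proj₂ sur)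
        y≡ : y ≡ lc a d 1 u
        y≡ = proj₂ (proj₂ sur)
        |Z| : cardF Z ≤ 1
        |Z| = +-cancelˡ-≤ m _ 1 (≤-trans (+-monoˡ-≤ (cardF Z) (≤-trans (≤-reflexive (sym |X|)) (cardF-mono {X = X} {λ x → Ω x ∧ X x} (λ x ex → ∧-true (X⊆Ω x ex) ex))))
                (≤-trans (≤-reflexive (sym (cnt-split Ω X (allFin p)))) (≤-trans |Ω| (≤-reflexive (+-comm 1 m)))))
        only : ∀ x → Ω x ≡ true → X x ≡ true ⊎ X x ≡ false → X x ≡ true ⊎ x ≡ lc a d 1 u
        only x ex (inj₁ q) = inj₁ q
        only x ex (inj₂ n) with x ≟F y
        ... | yes e = inj₂ (trans e y≡)
        ... | no ne = ⊥-elim (1+n≰n (≤-trans (s≤s (cardF-pos {X = Z ∖ y} (∖⁺ {X = Z} (∧-true ex (false⇒not-true n)) ne)))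
                        (≤-trans (≤-reflexive (sym (cardF-∖-∈ Z y ey))) |Z|)))

      beyond : ∀ u → u < p → M < u → Ω (lc a d 1 u) ≡ true → (∀ x → Ω x ≡ true → X x ≡ true ⊎ x ≡ lc a d 1 u) →
        (Short M g₁ g₂ → ⊥) × (Long M g₁ g₂ → Extended)
      beyond u u<p M<u eu Ω⊆ with outside refl dif (refl , pE) u eu
      ... | inj₁ u≤ = right M M<p a d d≢0 cov e0 eM g₁ g₂ E<p eqE pE dif u eu Ω⊆ M<u u≤
      ... | inj₂ p≤ = let sh , lo = reversed in
              (λ (M≡ , g≡) → sh (M≡ , trans (+-comm g₂ g₁) g≡)) , (λ (M≡ , g≡) → lo (M≡ , trans (+-comm g₂ g₁) g≡))
        where
        a′ = lc a d 1 M
        d′ = -F d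
        -- Seen backwards from the far end, u has offset M - u; adding p makes it a natural number.
        -- It exceeds M because u < p, and p ≤ u + g₂ bounds it by M + g₂.
        u′ = p + M ∸ u
        u≤pM : u ≤ p + M
        u≤pM = ≤-trans (<⇒≤ u<p) (m≤m+n p M)
        e0′ : X (lc a′ d′ 1 0) ≡ true
        e0′ = trans (cong X (lc-reverse-at pr a d M z≤n)) eM
        eM′ : X (lc a′ d′ 1 M) ≡ true
        eM′ = trans (cong X (trans (lc-reverse-at pr a d M ≤-refl) (cong (lc a d 1) (n∸n≡0 M)))) e0
        E<p′ : k * M + suc g₂ < p
        E<p′ = lin (g₁ + ℓ * M) (≤-reflexive (sym pE)) (eqn k M g₁ g₂ ℓ p)
          where
          eqn : ∀ k M g₁ g₂ ℓ p → 1 + (k * M + suc g₂) + p + (g₁ + ℓ * M) ≡ p + (k * M + suc g₁ + (ℓ * M + suc g₂))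
          eqn = solve-∀
        pE′ : p ≡ k * M + suc g₂ + (ℓ * M + suc g₁)
        pE′ = trans pE (eqn (k * M) g₁ g₂ (ℓ * M))
          where
          eqn : ∀ A g₁ g₂ B → A + suc g₁ + (B + suc g₂) ≡ A + suc g₂ + (B + suc g₁)
          eqn = solve-∀
        at-u : lc a′ d′ 1 u′ ≡ lc a d 1 u
        at-u = lc-reverse pr a d M 1 u′ u 1 (trans (m+[n∸m]≡n u≤pM) (trans (+-comm p M) (cong₂ _+_ (sym (+-identityʳ M)) (sym (+-identityʳ p)))))
        eqE′ = lc-reverse-gap pr a d k ℓ M (k * M + suc g₁) g₂ eqE pE
        reversed = right M M<p a′ d′ (neg≢0 d≢0) (⊑-reverse pr cov) e0′ eM′ g₂ g₁ E<p′ eqE′ pE′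
          (Line.dif-all M M<p a′ d′ (neg≢0 d≢0) (⊑-reverse pr cov) e0′ eM′ (k * M + suc g₂) E<p′ eqE′ M≤m 3≤M)
          u′ (trans (cong Ω at-u) eu) (λ x ex → Data.Sum.map₂ (λ e → trans e (sym at-u)) (Ω⊆ x ex))
          (m+n≤o⇒m≤o∸n (suc M) (≤-trans (≤-reflexive (cong suc (+-comm M u))) (+-monoˡ-≤ M u<p)))
          (m≤n+o⇒m∸n≤o (p + M) u (≤-trans (+-monoˡ-≤ M p≤) (≤-reflexive (eqn u g₂ M))))
          where
          eqn : ∀ u g M → u + g + M ≡ u + (M + g)
          eqn = solve-∀

      split : M < m ⊎ M ≡ m → Result
      split (inj₂ M≡) = inj₁ (short extra)
        where
        g≡ : g₁ + g₂ ≡ λ'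
        g≡ = +-cancelˡ-≡ ((3 + suc κ′ + ℓ₀) * m + 2) _ _ (trans (cong (λ z → (3 + suc κ′ + ℓ₀) * z + 2 + (g₁ + g₂)) (sym M≡)) (trans (sym total) p≡))
        conclude : Ω ⊑[ a , d ] m → Extremal
        conclude cov′ = a , d , g₁ , g₂ , d≢0 , cov′ , trans eqE (cong (λ z → lc a d k (k * z + suc g₁)) M≡) , g≡
        cov-m : X ⊑[ a , d ] m
        cov-m = subst (X ⊑[ a , d ]_) M≡ cov
        short : _ → Extremal
        short (inj₁ Ω⊆X) = conclude (λ x ex → cov-m x (Ω⊆X x ex))
        short (inj₂ (u , u<p , eu , nu , Ω⊆)) with u ≤? M
        ... | yes u≤ = conclude λ x ex → Data.Sum.[ cov-m x , (λ e → u , ≤-trans u≤ M≤m , e) ]′ (Ω⊆ x ex)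
        ... | no gt = ⊥-elim (proj₁ (beyond u u<p (≰⇒> gt) eu Ω⊆) (M≡ , g≡))
      split (inj₁ M<m) = long extra
        where
        M≡ : suc M ≡ m
        M≡ = ≤-antisym M<m m≤
        g≡ : g₁ + g₂ ≡ 3 + suc κ′ + ℓ₀ + λ'
        g≡ = +-cancelˡ-≡ ((3 + suc κ′ + ℓ₀) * M + 2) _ _ (trans (sym total) (trans p≡ (trans (cong (λ z → (3 + suc κ′ + ℓ₀) * z + 2 + λ') (sym M≡)) (eqn (3 + suc κ′ + ℓ₀) M λ'))))
          where
          eqn : ∀ s M l → s * suc M + 2 + l ≡ s * M + 2 + (s + l)
          eqn = solve-∀
        full : ∀ i → i ≤ M → X (lc a d 1 i) ≡ true
        full i i≤ with bool-case (X (lc a d 1 i))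
        ... | inj₁ t = t
        ... | inj₂ f = ⊥-elim (1+n≰n (≤-trans (≤-reflexive (+-comm 1 m)) (≤-trans (few (i ∷ []) ([] ∷ []) ((i≤ , f) ∷ [])) (≤-reflexive M≡))))
        long : _ → Result
        long (inj₁ Ω⊆X) = inj₂ (inj₁ (a , d , g₁ , g₂ , record { M = M ; M≡ = M≡ ; d≢0 = d≢0 ; X⊑ = cov ; ⊑X = full ; gap = eqE ; total = g≡ } , Ω⊆X))
        long (inj₂ (u , u<p , eu , nu , Ω⊆)) with u ≤? M
        ... | yes u≤ = ⊥-elim (true≢false (full u u≤) nu)
        ... | no gt = inj₂ (inj₂ (proj₂ (beyond u u<p (≰⇒> gt) eu Ω⊆) (M≡ , g≡)))

  structure : cardF Ω ≤ suc m → ∀ a d → d ≢ ι 0 → X ⊑[ a , d ] suc m → Result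
  -- The progression is trimmed to the first and last offsets that X attains, since the offset
  -- arguments use both end points as summands.
  structure |Ω| a₀ d d≢0 cov₀ = decide (M ≤? m)
    where
    x₀ = cnt-∃ X (allFin p) (≤-trans (≤-trans (s≤s z≤n) 7≤m) (≤-reflexive (sym |X|)))
    c₀ = cov₀ (proj₁ x₀) (proj₂ x₀)
    sp = span (λ i → X (lc a₀ d 1 i)) (suc m) (proj₁ (proj₂ c₀)) (trans (cong X (sym (proj₂ (proj₂ c₀)))) (proj₂ x₀))
    lo = proj₁ sp
    hi = proj₁ (proj₂ sp)
    lo≤hi = proj₁ (proj₂ (proj₂ sp))
    hi≤ = proj₁ (proj₂ (proj₂ (proj₂ sp)))
    elo = proj₁ (proj₂ (proj₂ (proj₂ (proj₂ sp))))
    ehi = proj₁ (proj₂ (proj₂ (proj₂ (proj₂ (proj₂ sp)))))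
    bounds = proj₂ (proj₂ (proj₂ (proj₂ (proj₂ (proj₂ sp)))))
    a = lc a₀ d 1 lo
    M = hi ∸ lo
    M≤ : M ≤ suc m
    M≤ = ≤-trans (m∸n≤m hi lo) hi≤
    M<p : M < p
    M<p = ≤-trans (s≤s M≤) (<⇒≤ m+2<p)
    cov : X ⊑[ a , d ] M
    cov x ex = let i , i≤ , eq = cov₀ x ex
                   l , h = bounds i i≤ (trans (cong X (sym eq)) ex)
               in i ∸ lo , ∸-monoˡ-≤ lo h , trans eq (sym (trans (lc-rebase a₀ d lo (i ∸ lo)) (cong (lc a₀ d 1) (m+[n∸m]≡n l))))
    e0 : X (lc a d 1 0) ≡ true
    e0 = trans (cong X (trans (lc-rebase a₀ d lo 0) (cong (lc a₀ d 1) (+-identityʳ lo)))) elo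
    eM : X (lc a d 1 M) ≡ true
    eM = trans (cong X (trans (lc-rebase a₀ d lo M) (cong (lc a₀ d 1) (m+[n∸m]≡n lo≤hi)))) ehi
    sur = lc-surj pr d≢0 a k (lc a d ℓ 0)
    E = proj₁ sur
    E<p = proj₁ (proj₂ sur)
    eqE = proj₂ (proj₂ sur)
    open Line M M<p a d d≢0 cov e0 eM E E<p eqE
    decide : _ → Result
    decide (yes M≤m) = solve-line |Ω| M M<p a d d≢0 cov e0 eM E E<p eqE M≤m m≤ (gaps (dif-all M≤m (3≤ m≤)) E<p)
      where
      m≤ : m ≤ suc M
      m≤ = ≤-trans (≤-reflexive (sym (+-identityʳ m))) (few [] [] [])
    decide (no M≰m) = ⊥-elim (too-long {{>-nonZero (≤-trans (s≤s z≤n) 7≤M)}} (dif-most M≤ 7≤M) (≤-trans (s≤s (s≤s (s≤s z≤n))) 7≤M) E<p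
        (lin 0 (≤-reflexive p≡ ⊹ hλ ⊹ (3 + suc κ′ + ℓ₀) ⊗ ≰⇒> M≰m) (eqn (3 + suc κ′ + ℓ₀) m M λ' p)))
      where
      7≤M : 7 ≤ M
      7≤M = ≤-trans 7≤m (<⇒≤ (≰⇒> M≰m))
      eqn : ∀ s m M l p → p + 3 + (s * m + 2 + l + s + s * M) + 0 ≡ s * M + (p + (l + 5) + s * suc m)
      eqn = solve-∀

-- The vector space 𝔽_p^n

module _ {p : ℕ} .{{nz : NonZero p}} where

  PtGroup : ℕ → AbelianGroup 0ℓ 0ℓ
  PtGroup n = record
    { Carrier = Pt p n ; _≈_ = _≡_ ; _∙_ = _⊕_ ; ε = 𝟘 ; _⁻¹ = λ x → ⊖ x
    ; isAbelianGroup = record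
      { isGroup = record
        { isMonoid = record
          { isSemigroup = record
            { isMagma = record { isEquivalence = isEquivalence ; ∙-cong = cong₂ _⊕_ }
            ; assoc = zipWith-assoc +F-assoc }
          ; identity = zipWith-identityˡ +F-identityˡ , zipWith-identityʳ +F-identityʳ }
        ; inverse = zipWith-inverseˡ +F-inverseˡ , zipWith-inverseʳ +F-inverseʳ
        ; ⁻¹-cong = cong (λ x → ⊖ x) }
      ; comm = zipWith-comm +F-comm } }

  module Pts {n : ℕ} where
    open AbelianGroup (PtGroup n) public using () renaming (assoc to ⊕-assoc; comm to ⊕-comm; identityˡ to ⊕-identityˡ; identityʳ to ⊕-identityʳ; inverseˡ to ⊕-inverseˡ; inverseʳ to ⊕-inverseʳ; commutativeSemigroup to ⊕-commutativeSemigroup)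
    open AG (PtGroup n) public using () renaming (inverseˡ-unique to ⊕-inverseˡ-unique)
    open CS ⊕-commutativeSemigroup public using () renaming (interchange to ⊕-interchange)

    ⊖⊕-cancel : ∀ (x y : Pt p n) → (x ⊖ y) ⊕ y ≡ x
    ⊖⊕-cancel x y = trans (⊕-assoc x (⊖ y) y) (trans (cong (x ⊕_) (⊕-inverseˡ y)) (⊕-identityʳ x))

    ⊕⊖-cancel : ∀ (x y : Pt p n) → (x ⊕ y) ⊖ y ≡ x
    ⊕⊖-cancel x y = trans (⊕-assoc x y (⊖ y)) (trans (cong (x ⊕_) (⊕-inverseʳ y)) (⊕-identityʳ x))

    ⊕-cancelʳ : ∀ (z x y : Pt p n) → x ⊕ z ≡ y ⊕ z → x ≡ y
    ⊕-cancelʳ z x y e = trans (sym (⊕⊖-cancel x z)) (trans (cong (_⊖ z) e) (⊕⊖-cancel y z))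

    ⊕-cancelˡ : ∀ (z x y : Pt p n) → z ⊕ x ≡ z ⊕ y → x ≡ y
    ⊕-cancelˡ z x y e = ⊕-cancelʳ z x y (trans (⊕-comm x z) (trans e (⊕-comm z y)))
  open Pts public

  ·-distribˡ : ∀ {n} c (x y : Pt p n) → c · (x ⊕ y) ≡ c · x ⊕ c · y
  ·-distribˡ c [] [] = refl
  ·-distribˡ c (x ∷ xs) (y ∷ ys) = cong₂ _∷_ (*F-distribˡ c x y) (·-distribˡ c xs ys)

  ·-distribʳ : ∀ {n} b c (x : Pt p n) → (b +F c) · x ≡ b · x ⊕ c · x
  ·-distribʳ b c [] = refl
  ·-distribʳ b c (x ∷ xs) = cong₂ _∷_ (*F-distribʳ x b c) (·-distribʳ b c xs)

  ·-assoc : ∀ {n} b c (x : Pt p n) → (b *F c) · x ≡ b · (c · x)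
  ·-assoc b c [] = refl
  ·-assoc b c (x ∷ xs) = cong₂ _∷_ (*F-assoc b c x) (·-assoc b c xs)

  ·-identity : ∀ {n} (x : Pt p n) → ι 1 · x ≡ x
  ·-identity [] = refl
  ·-identity (x ∷ xs) = cong₂ _∷_ (*F-identityˡ x) (·-identity xs)

  ·-zero : ∀ {n} (x : Pt p n) → ι 0 · x ≡ 𝟘
  ·-zero [] = refl
  ·-zero (x ∷ xs) = cong₂ _∷_ (*F-zeroˡ x) (·-zero xs)

  linComb-⊕ : ∀ {n d} (cs cs′ : Vec (Fin p) d) (bs : Vec (Pt p n) d) →
    linComb (cs ⊕ cs′) bs ≡ linComb cs bs ⊕ linComb cs′ bs
  linComb-⊕ [] [] [] = sym (⊕-identityˡ 𝟘)
  linComb-⊕ (c ∷ cs) (c′ ∷ cs′) (b ∷ bs) =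
    trans (cong₂ _⊕_ (·-distribʳ c c′ b) (linComb-⊕ cs cs′ bs)) (⊕-interchange (c · b) (c′ · b) _ _)

  linComb-𝟘 : ∀ {n d} (bs : Vec (Pt p n) d) → linComb 𝟘 bs ≡ 𝟘
  linComb-𝟘 [] = refl
  linComb-𝟘 (b ∷ bs) = trans (cong₂ _⊕_ (·-zero b) (linComb-𝟘 bs)) (⊕-identityˡ 𝟘)

  additive-𝟘 : ∀ {n n′} {f : Pt p n → Pt p n′} → (∀ x y → f (x ⊕ y) ≡ f x ⊕ f y) → f 𝟘 ≡ 𝟘
  additive-𝟘 {f = f} add = ⊕-cancelˡ (f 𝟘) (f 𝟘) 𝟘 (trans (sym (add 𝟘 𝟘)) (trans (cong f (⊕-identityˡ 𝟘)) (sym (⊕-identityʳ (f 𝟘)))))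

  injective⇒surjective : ∀ {n} (f : Pt p n → Pt p n) → (∀ x y → f x ≡ f y → x ≡ y) → ∀ y → ∃ λ x → f x ≡ y
  injective⇒surjective {n} f inj y =
    let x , e = any⁻ (λ x → ⌊ ≡-dec _≟F_ (f x) y ⌋) (allFinVec p n)
                  (cnt-full Q (allFinVec p n) (allFinVec-complete p n)
                    (≤-trans (≤-reflexive (sym (cnt-all (λ _ → true) (allFinVec p n) (λ _ → refl))))
                      (cnt-≤ f {λ _ → true} {Q} (allFinVec-unique p n) (allFinVec-complete p n)
                        (λ x _ → any⁺ (λ u → ⌊ ≡-dec _≟F_ (f u) (f x) ⌋) (allFinVec-complete p n x) (yes-refl (f x)))
                        (λ x y _ _ → inj x y))) y)
    in x , from-yes e
    where
    Q : Pt p n → Bool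
    Q z = any (λ u → ⌊ ≡-dec _≟F_ (f u) z ⌋) (allFinVec p n)
    yes-refl : ∀ x → ⌊ ≡-dec _≟F_ x x ⌋ ≡ true
    yes-refl x with ≡-dec _≟F_ x x
    ... | yes _ = refl
    ... | no ne = ⊥-elim (ne refl)
    from-yes : ∀ {x y : Pt p n} → ⌊ ≡-dec _≟F_ x y ⌋ ≡ true → x ≡ y
    from-yes {x} {y} e with ≡-dec _≟F_ x y
    ... | yes q = q

  injective⇒automorphism : ∀ {n} (f : Pt p n → Pt p n) → (∀ x y → f (x ⊕ y) ≡ f x ⊕ f y) →
    (∀ x y → f x ≡ f y → x ≡ y) → IsAutomorphism f
  injective⇒automorphism f add inj = add , g , (λ x → inj _ _ (fg (f x))) , fg
    where
    g = λ y → proj₁ (injective⇒surjective f inj y)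
    fg = λ y → proj₂ (injective⇒surjective f inj y)

  automorphism-inverse : ∀ {n} {f : Pt p n → Pt p n} (aut : IsAutomorphism f) → IsAutomorphism (proj₁ (proj₂ aut))
  automorphism-inverse {f = f} (add , g , gf , fg) =
    (λ x y → trans (cong g (trans (cong₂ _⊕_ (sym (fg x)) (sym (fg y))) (sym (add (g x) (g y))))) (gf (g x ⊕ g y))) , f , fg , gf

  automorphism-∘ : ∀ {n} {f g : Pt p n → Pt p n} → IsAutomorphism f → IsAutomorphism g → IsAutomorphism (f ∘ g)
  automorphism-∘ {f = f} {g} (addf , f′ , f′f , ff′) (addg , g′ , g′g , gg′) =
    (λ x y → trans (cong f (addg x y)) (addf (g x) (g y))) , (g′ ∘ f′) ,
    (λ x → trans (cong g′ (f′f (g x))) (g′g x)) , (λ x → trans (cong f (gg′ (f′ x))) (ff′ x))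

  kernel⇒injective : ∀ {n n′} {f : Pt p n → Pt p n′} → (∀ x y → f (x ⊕ y) ≡ f x ⊕ f y) → (∀ x → f x ≡ 𝟘 → x ≡ 𝟘) → ∀ x y → f x ≡ f y → x ≡ y
  kernel⇒injective {f = f} add ker x y e = trans (sym (⊖⊕-cancel x y)) (trans (cong (_⊕ y) (ker (x ⊖ y) eq)) (⊕-identityˡ y))
    where
    eq : f (x ⊖ y) ≡ 𝟘
    eq = ⊕-cancelʳ (f y) _ 𝟘 (trans (sym (add (x ⊖ y) y)) (trans (cong f (⊖⊕-cancel x y)) (trans e (sym (⊕-identityˡ (f y))))))

  InSumset-cons : ∀ {n h} {S : SubsetF p n} {a z} → S a ≡ true → InSumset h S z → InSumset (suc h) S (a ⊕ z)
  InSumset-cons {a = a} ea (as , all , refl) = a ∷ as , ea VAll.∷ all , refl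

  InSumset-map : ∀ {n h} {S T : SubsetF p n} {f : Pt p n → Pt p n} → (∀ x y → f (x ⊕ y) ≡ f x ⊕ f y) →
    (∀ x → S x ≡ true → T (f x) ≡ true) → ∀ {z} → InSumset h S z → InSumset h T (f z)
  InSumset-map {h = zero} add ST ([] , VAll.[] , refl) = [] , VAll.[] , sym (additive-𝟘 add)
  InSumset-map {h = suc h} {T = T} {f} add ST (a ∷ as , ea VAll.∷ all , refl) =
    subst (InSumset (suc h) T) (sym (add a (sumPts as))) (InSumset-cons (ST a ea) (InSumset-map add ST (as , all , refl)))

  module _ (pr : Prime p) where

    -- (i , g) ↦ i v + Σ gⱼ bⱼ identifies 𝔽_p × 𝔽_p^{n} with 𝔽_p^{n+1}, K being the image of {0} × 𝔽_p^{n}.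
    decomposition-automorphism : ∀ {n} {v : Pt p (suc n)} {K : SubsetF p (suc n)} → (dec : Decomposition v K) →
      IsAutomorphism (λ cs → linComb cs (v ∷ proj₁ (proj₂ (proj₁ dec))))
    decomposition-automorphism {n} {v} {K} (((_ , _ , K·) , bs , indep , mem) , v∉K) =
      injective⇒automorphism f (λ x y → linComb-⊕ x y (v ∷ bs)) (kernel⇒injective (λ x y → linComb-⊕ x y (v ∷ bs)) ker)
      where
      f : Pt p (suc n) → Pt p (suc n)
      f cs = linComb cs (v ∷ bs)
      ker : ∀ x → f x ≡ 𝟘 → x ≡ 𝟘
      ker (i ∷ cs) e with i ≟F ι 0
      ... | yes refl = cong (ι 0 ∷_) (indep cs (trans (sym (⊕-identityˡ _)) (trans (cong (_⊕ linComb cs bs) (sym (·-zero v))) e)))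
      ... | no i≢0 = ⊥-elim (true≢false v∈K v∉K)
        where
        l = linComb cs bs
        l∈K : K l ≡ true
        l∈K = Equivalence.from (mem l) (cs , refl)
        iv∈K : K (i · v) ≡ true
        iv∈K = trans (cong K (trans (⊕-inverseˡ-unique (i · v) l e) (⊖-· l))) (K· (-F (ι 1)) l l∈K)
          where
          ⊖-· : ∀ {n} (x : Pt p n) → ⊖ x ≡ (-F (ι 1)) · x
          ⊖-· [] = refl
          ⊖-· (x ∷ xs) = cong₂ _∷_ (sym (FpR.-1*x≈-x x)) (⊖-· xs)
        j = proj₁ (inverse-exists pr i i≢0)
        v∈K : K v ≡ true
        v∈K = trans (cong K (trans (sym (·-identity v)) (trans (cong (_· v) (trans (sym (proj₂ (inverse-exists pr i i≢0))) (*F-comm i j))) (·-assoc j i v))))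
                (K· j (i · v) iv∈K)

-- Slices

Odd : ℕ → Set
Odd n = ∃ λ h → n ≡ suc (2 * h)

odd-* : ∀ {a b} → Odd a → Odd b → Odd (a * b)
odd-* {a} {b} (h , refl) (j , refl) = h * suc (2 * j) + j , eqn h j
  where
  eqn : ∀ h j → (1 + 2 * h) * (1 + 2 * j) ≡ 1 + 2 * (h * (1 + 2 * j) + j)
  eqn = solve-∀

odd-^ : ∀ {a} n → Odd a → Odd (a ^ n)
odd-^ zero o = 0 , refl
odd-^ (suc n) o = odd-* o (odd-^ n o)

odd-prime : ∀ {p} → Prime p → 2 < p → Odd p
odd-prime {p} pr 2<p with p % 2 in eq | m%n<n p 2
... | 1 | _ = p / 2 , trans (m≡m%n+[m/n]*n p 2) (cong₂ _+_ eq (*-comm (p / 2) 2))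
... | suc (suc _) | s≤s (s≤s ())
... | 0 | _ with prime⇒irreducible pr (divides (p / 2) (trans (m≡m%n+[m/n]*n p 2) (cong (_+ p / 2 * 2) eq)))
...   | inj₂ refl = ⊥-elim (<-irrefl refl 2<p)

module _ {p : ℕ} .{{nz : NonZero p}} where

  -- U and g - W have more than p^n points together, so they meet.
  card-pigeonhole : ∀ {n} (U W : SubsetF p n) → p ^ n < card U + card W → ∀ g →
    ∃ λ u → U u ≡ true × W (g ⊖ u) ≡ true
  card-pigeonhole {n} U W big g =
    let u , e = cnt-∃ (λ u → U u ∧ W (g ⊖ u)) xs (+-cancelˡ-≤ (p ^ n) 1 _ (≤-trans (≤-reflexive (+-comm _ 1)) (≤-trans big
                  (≤-trans (+-monoʳ-≤ (card U) (cnt-≤ (λ u → g ⊖ u) {W} {λ u → W (g ⊖ u)} (allFinVec-unique p n) (allFinVec-complete p n)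
                     (λ u eu → trans (cong W (invol u)) eu) (λ x y _ _ e → trans (sym (invol x)) (trans (cong (λ u → g ⊖ u) e) (invol y)))))
                    (≤-trans (≤-reflexive (cnt-∨∧ U (λ u → W (g ⊖ u)) xs))
                      (+-monoˡ-≤ _ (≤-trans (cnt-≤-length _ xs) (≤-reflexive (length-allFinVec p n)))))))))
    in u , ∧-trueˡ e , ∧-trueʳ {U u} e
    where
    xs = allFinVec p n
    invol : ∀ u → g ⊖ (g ⊖ u) ≡ u
    invol u = sym (⊕-cancelʳ (g ⊖ u) u (g ⊖ (g ⊖ u)) (trans (trans (⊕-comm u (g ⊖ u)) (⊖⊕-cancel g u)) (sym (⊖⊕-cancel g (g ⊖ u)))))

  subset-of-size : ∀ m j (P : Fin p → Bool) → cardF P ≡ j + m → ∃ λ X → (∀ x → X x ≡ true → P x ≡ true) × cardF X ≡ m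
  subset-of-size m zero P e = P , (λ _ q → q) , e
  subset-of-size m (suc j) P e =
    let x , ex = cnt-∃ P (allFin p) (≤-trans (s≤s z≤n) (≤-reflexive (sym e)))
        X , sub , |X| = subset-of-size m j (P ∖ x) (suc-injective (trans (sym (cardF-∖-∈ P x ex)) e))
    in X , (λ y q → ∖⁻ˡ {X = P} (sub y q)) , |X|

  -- Raising one slice to its cap N keeps the total within |Ω|N. Done once or three times, this
  -- bounds how far one slice, or three together, can fall short of being full.
  fill : (Fin p → ℕ) → ℕ → Fin p → Fin p → ℕ
  fill f N e x with x ≟F e
  ... | yes _ = N
  ... | no _ = f x

  fill-≢ : ∀ f N {e x} → x ≢ e → fill f N e x ≡ f x
  fill-≢ f N {e} {x} ne with x ≟F e
  ... | yes q = ⊥-elim (ne q)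
  ... | no _ = refl

  Bounded : (Fin p → Bool) → ℕ → (Fin p → ℕ) → Set
  Bounded Ω N f = ∀ x → f x ≤ ind (Ω x) N

  fill-bounded : ∀ {Ω N f e} → Ω e ≡ true → Bounded Ω N f → Bounded Ω N (fill f N e)
  fill-bounded {Ω} {N} {f} {e} ee b x with x ≟F e
  ... | yes refl = ≤-reflexive (cong (λ z → ind z N) (sym ee))
  ... | no _ = b x

  fill-sum : ∀ f N e → Σl (fill f N e) (allFin p) + f e ≡ Σl f (allFin p) + N
  fill-sum f N e = trans (cong (Σl (fill f N e) (allFin p) +_) (sym (point (f e)))) (trans (sym (Σl-+ (fill f N e) _ (allFin p)))
      (trans (≤-antisym (Σl-mono (allFin p) (λ x → ≤-reflexive (pw x))) (Σl-mono (allFin p) (λ x → ≤-reflexive (sym (pw x)))))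
        (trans (Σl-+ f _ (allFin p)) (cong (Σl f (allFin p) +_) (point N)))))
    where
    one : cardF (_==F e) ≡ 1
    one = ≤-antisym (≤-trans (cardF-∖ (_==F e) e) (s≤s (≤-reflexive (cnt-none _ (allFin p) none)))) (cardF-pos {X = _==F e} (==F-refl e))
      where
      none : ∀ x → ((_==F e) ∖ e) x ≡ false
      none x with x ==F e
      ... | true = refl
      ... | false = refl
    point : ∀ c → Σl (λ x → ind (x ==F e) c) (allFin p) ≡ c
    point c = trans (Σl-ind (_==F e) c (allFin p)) (trans (cong (_* c) one) (+-identityʳ c))
    pw : ∀ x → fill f N e x + ind (x ==F e) (f e) ≡ f x + ind (x ==F e) N
    pw x with x ≟F e
    ... | yes refl = +-comm N (f x)
    ... | no _ = refl

  bounded-sum : ∀ {Ω N f} → Bounded Ω N f → Σl f (allFin p) ≤ cardF Ω * N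
  bounded-sum {Ω} {N} b = ≤-trans (Σl-mono (allFin p) b) (≤-reflexive (Σl-ind Ω N (allFin p)))

  deficit₁ : ∀ {Ω N f e} → Bounded Ω N f → Ω e ≡ true → Σl f (allFin p) + N ≤ cardF Ω * N + f e
  deficit₁ {Ω} {N} {f} {e} b ee = ≤-trans (≤-reflexive (sym (fill-sum f N e))) (+-monoˡ-≤ (f e) (bounded-sum (fill-bounded {f = f} ee b)))

  deficit₃ : ∀ {Ω N f e₁ e₂ e₃} → Bounded Ω N f → Ω e₁ ≡ true → Ω e₂ ≡ true → Ω e₃ ≡ true → e₁ ≢ e₂ → e₁ ≢ e₃ → e₂ ≢ e₃ →
    Σl f (allFin p) + 3 * N ≤ cardF Ω * N + (f e₁ + f e₂ + f e₃)
  deficit₃ {Ω} {N} {f} {e₁} {e₂} {e₃} b h₁ h₂ h₃ n₁₂ n₁₃ n₂₃ =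
    lin 0 (deficit₁ {Ω} {N} {f₂} {e₃} (fill-bounded {f = f₁} h₂ (fill-bounded {f = f} h₁ b)) h₃ ⊹ ≤-reflexive (sym (fill-sum f N e₁)) ⊹ ≤-reflexive (sym (fill-sum f₁ N e₂))
           ⊹ ≤-reflexive (trans (fill-≢ f₁ N (n₂₃ ∘ sym)) (fill-≢ f N (n₁₃ ∘ sym))) ⊹ ≤-reflexive (fill-≢ f N (n₁₂ ∘ sym)))
      (eqn (Σl f (allFin p)) (Σl f₁ (allFin p)) (Σl f₂ (allFin p)) N (cardF Ω * N) (f e₁) (f e₂) (f e₃) (f₂ e₃) (f₁ e₂))
    where
    f₁ = fill f N e₁
    f₂ = fill f₁ N e₂
    eqn : ∀ S S₁ S₂ N C a b c c′ b′ → S + 3 * N + (C + c′ + (S₁ + a) + (S₂ + b′) + c + b) + 0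
      ≡ C + (a + b + c) + (S₂ + N + (S + N) + (S₁ + N) + c′ + b′)
    eqn = solve-∀

  module Slices {n : ℕ} (B : SubsetF p (suc n)) where

    N : ℕ
    N = p ^ n

    opaque
      size : Fin p → ℕ
      size x = card (λ g → B (x ∷ g))

      size-def : ∀ x → size x ≡ card (λ g → B (x ∷ g))
      size-def x = refl

      support : Fin p → Bool
      support x = any (λ g → B (x ∷ g)) (allFinVec p n)

      support⁺ : ∀ {x g} → B (x ∷ g) ≡ true → support x ≡ true
      support⁺ {x} {g} e = any⁺ (λ g → B (x ∷ g)) (allFinVec-complete p n g) e

      support⁻ : ∀ {x} → support x ≡ true → ∃ λ g → B (x ∷ g) ≡ true
      support⁻ {x} e = any⁻ _ (allFinVec p n) e

      size-bounded : Bounded support N size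
      size-bounded x with bool-case (support x)
      ... | inj₁ t = ≤-trans (≤-trans (cnt-≤-length _ (allFinVec p n)) (≤-reflexive (length-allFinVec p n))) (≤-reflexive (cong (λ z → ind z N) (sym t)))
      ... | inj₂ f = ≤-trans (≤-reflexive (cnt-none _ (allFinVec p n) (λ g → ¬true⇒false λ t → true≢false (any⁺ (λ g → B (x ∷ g)) (allFinVec-complete p n g) t) f))) z≤n

      size-pos : ∀ {x} → 1 ≤ size x → ∃ λ g → B (x ∷ g) ≡ true
      size-pos {x} h = cnt-∃ _ (allFinVec p n) h

      size-full : ∀ {x} → N ≤ size x → ∀ g → B (x ∷ g) ≡ true
      size-full {x} h g = cnt-full (λ g → B (x ∷ g)) (allFinVec p n) (allFinVec-complete p n) (≤-trans (≤-reflexive (length-allFinVec p n)) h) g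

      size-sum : card B ≡ Σl size (allFin p)
      size-sum = card-slices B

    size-≤N : ∀ x → size x ≤ N
    size-≤N x = ≤-trans (size-bounded x) (ind≤ (support x))
      where
      ind≤ : ∀ b → ind b N ≤ N
      ind≤ true = ≤-refl
      ind≤ false = z≤n

    -- Sum-freeness forbids a residue that is full for one of k, ℓ and merely hit for the other.
    -- Fullness survives adding any nonempty slice, so only two terms ever need to be large.
    Hit Full : ℕ → Fin p → Set
    Hit h z = ∃ λ g → InSumset h B (z ∷ g)
    Full h z = ∀ g → InSumset h B (z ∷ g)

    hit : ∀ {h z} → Rep support h z → Hit h z
    hit [] = 𝟘 , [] , VAll.[] , refl
    hit (cons ex r refl) = let g , eg = support⁻ ex
                               g′ , s = hit r
                           in g ⊕ g′ , InSumset-cons eg s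

    full-cons : ∀ {h x z w} → support x ≡ true → Full h z → x +F z ≡ w → Full (suc h) w
    full-cons {h} {x} {z} ex f refl g = let g₀ , eg = support⁻ ex in
      subst (λ y → InSumset (suc h) B ((x +F z) ∷ y)) (trans (⊕-comm g₀ (g ⊖ g₀)) (⊖⊕-cancel g g₀)) (InSumset-cons eg (f (g ⊖ g₀)))

    full-rep : ∀ {h j z w y} → Rep support h z → Full j w → z +F w ≡ y → Full (h + j) y
    full-rep {w = w} [] f refl = subst (Full _) (sym (+F-identityˡ w)) f
    full-rep {w = w} (cons {x = x} {z} ex r refl) f refl = full-cons ex (full-rep r f refl) (sym (+F-assoc x z w))

    full-two : ∀ {x₁ x₂} → N < size x₁ + size x₂ → Full 2 (x₁ +F x₂)
    full-two {x₁} {x₂} big g = let u , e₁ , e₂ = card-pigeonhole (λ v → B (x₁ ∷ v)) (λ v → B (x₂ ∷ v)) (subst₂ (λ a b → N < a + b) (size-def x₁) (size-def x₂) big) g in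
      (x₁ ∷ u) ∷ (x₂ ∷ (g ⊖ u)) ∷ [] , e₁ VAll.∷ e₂ VAll.∷ VAll.[] ,
      cong₂ _∷_ (cong (x₁ +F_) (+F-identityʳ x₂)) (trans (cong (u ⊕_) (⊕-identityʳ (g ⊖ u))) (trans (⊕-comm u (g ⊖ u)) (⊖⊕-cancel g u)))

    full-one : ∀ {x} → N ≤ size x → Full 1 x
    full-one {x} h g = (x ∷ g) ∷ [] , size-full h g VAll.∷ VAll.[] , cong₂ _∷_ (+F-identityʳ x) (⊕-identityʳ g)

    large : Fin p → Bool
    large x = ⌊ suc N ≤? 2 * size x ⌋

    large⁻ : ∀ {x} → large x ≡ true → N < 2 * size x
    large⁻ {x} e with suc N ≤? 2 * size x
    ... | yes h = h

    large⇒support : ∀ {x} → large x ≡ true → support x ≡ true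
    large⇒support {x} e = support⁺ (proj₂ (size-pos (pos (size x) (large⁻ e))))
      where
      pos : ∀ s → N < 2 * s → 1 ≤ s
      pos zero ()
      pos (suc s) _ = s≤s z≤n

    large-two : ∀ {x₁ x₂} → large x₁ ≡ true → large x₂ ≡ true → Full 2 (x₁ +F x₂)
    large-two {x₁} {x₂} e₁ e₂ = full-two (*-cancelˡ-≤ 2 (lin 0 (large⁻ e₁ ⊹ large⁻ e₂) (eqn N (size x₁) (size x₂))))
      where
      eqn : ∀ N a b → 2 * (1 + N) + (2 * a + 2 * b) + 0 ≡ 2 * (a + b) + (1 + N + (1 + N))
      eqn = solve-∀

    -- N is odd, so a slice that is not large has at most (N − 1) / 2 points.
    large-many : ∀ {m} → Odd N → m * N ≤ card B → cardF support ≤ m + 1 → m ≤ cardF large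
    large-many {m} (h , N≡) big |Ω| with m ≤? cardF large
    ... | yes q = q
    ... | no ¬q = ⊥-elim (1+n≰n {2 * Σl size (allFin p)} (lin 1 (2 ⊗ big ⊹ 2 ⊗ ≤-reflexive size-sum ⊹ sum ⊹ (2 * h) ⊗ |Ω| ⊹ (2 * h + 2) ⊗ ≰⇒> ¬q ⊹ (2 * m) ⊗ ≤-reflexive (sym N≡)) (eqn m N h (card B) (Σl size (allFin p)) (cardF support) (cardF large))))
      where
      -- With N = 2h + 1, a slice that is not large has at most h points, so twice its size is at
      -- most 2h, and a large one adds at most 2h + 2 to that. With at most m - 1 large slices the
      -- total would give 2mN ≤ 2mN - 2.
      pw : ∀ x → size x + size x ≤ ind (support x) (2 * h) + ind (large x) (2 * h + 2)
      pw x with bool-case (large x)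
      ... | inj₁ t = ≤-trans (+-mono-≤ (size-≤N x) (size-≤N x)) (≤-trans (≤-reflexive (trans (cong₂ _+_ N≡ N≡) (e2 h)))
                       (≤-reflexive (sym (cong₂ (λ a b → ind a (2 * h) + ind b (2 * h + 2)) (large⇒support t) t))))
        where
        e2 : ∀ h → 1 + 2 * h + (1 + 2 * h) ≡ 2 * h + (2 * h + 2)
        e2 = solve-∀
      ... | inj₂ f with bool-case (support x)
      ...   | inj₂ f′ = ≤-trans (+-mono-≤ zero′ zero′) z≤n
        where
        zero′ : size x ≤ 0
        zero′ = ≤-trans (size-bounded x) (≤-reflexive (cong (λ z → ind z N) f′))
      ...   | inj₁ t = ≤-trans (≤-trans (≤-reflexive (cong (size x +_) (sym (+-identityʳ (size x))))) (*-monoʳ-≤ 2 (halve-≤ (size x) h notLarge)))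
                         (≤-trans (m≤m+n (2 * h) _) (≤-reflexive (sym (cong₂ (λ a b → ind a (2 * h) + b) t refl))))
        where
        notLarge : 2 * size x ≤ suc (2 * h)
        notLarge with suc N ≤? 2 * size x
        ... | no ¬l = ≤-trans (≤-pred (≰⇒> ¬l)) (≤-reflexive N≡)
      sum : Σl size (allFin p) + Σl size (allFin p) ≤ cardF support * (2 * h) + cardF large * (2 * h + 2)
      sum = ≤-trans (≤-reflexive (sym (Σl-+ size size (allFin p)))) (≤-trans (Σl-mono (allFin p) pw)
              (≤-reflexive (trans (Σl-+ _ _ (allFin p)) (cong₂ _+_ (Σl-ind support (2 * h) (allFin p)) (Σl-ind large (2 * h + 2) (allFin p))))))
      eqn : ∀ m N h c S w l → 1 + 2 * S + (2 * c + 2 * S + (w * (2 * h) + l * (2 * h + 2)) + (2 * h) * (m + 1) + (2 * h + 2) * m + (2 * m) * N) + 1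
        ≡ 2 * S + (2 * (m * N) + 2 * c + (S + S) + (2 * h) * w + (2 * h + 2) * (1 + l) + (2 * m) * (1 + 2 * h))
      eqn = solve-∀

    all-full : ∀ {m} → m * N ≤ card B → cardF support ≤ m → ∀ {x} → support x ≡ true → N ≤ size x
    all-full {m} big |Ω| {x} ex = +-cancelˡ-≤ (m * N) _ _ (≤-trans (+-monoˡ-≤ N (≤-trans big (≤-reflexive size-sum)))
      (≤-trans (deficit₁ size-bounded ex) (+-monoˡ-≤ (size x) (*-monoˡ-≤ N |Ω|))))

    -- At most m + 1 slices carry mN points, so all slices together lack at most N.
    three-slices : ∀ {m} → m * N ≤ card B → cardF support ≤ m + 1 → ∀ {x₁ x₂ x₃} → support x₁ ≡ true → support x₂ ≡ true → support x₃ ≡ true →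
      x₁ ≢ x₂ → x₁ ≢ x₃ → x₂ ≢ x₃ → 2 * N ≤ size x₁ + size x₂ + size x₃
    three-slices {m} big |Ω| {x₁} {x₂} {x₃} h₁ h₂ h₃ n₁₂ n₁₃ n₂₃ =
      lin 0 (≤-trans big (≤-reflexive size-sum) ⊹ deficit₃ size-bounded h₁ h₂ h₃ n₁₂ n₁₃ n₂₃ ⊹ *-monoˡ-≤ N |Ω|)
        (eqn m N (Σl size (allFin p)) (cardF support) (size x₁ + size x₂ + size x₃))
      where
      eqn : ∀ m N S w t → 2 * N + (S + (w * N + t) + (m + 1) * N) + 0 ≡ t + (m * N + (S + 3 * N) + w * N)
      eqn = solve-∀

-- Cyclic intervals, scaling and shears.

module _ {p : ℕ} .{{nz : NonZero p}} where

  private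
    offset : ∀ (b : Fin p) i → toℕ ((b +F ι i) -F b) ≡ i % p
    offset b i = trans (cong toℕ (trans (cong (_-F b) (+F-comm b (ι i))) (+F-F-cancel (ι i) b))) (toℕ-ι i)

    ≤ᵇ⁺ : ∀ {a b} → a ≤ b → (a ≤ᵇ b) ≡ true
    ≤ᵇ⁺ h = Equivalence.to T-≡ (≤⇒≤ᵇ h)

  inIntB⁺ : ∀ b {i M} → i ≤ M → M < p → inIntB {p} b (b +F ι M) (b +F ι i) ≡ true
  inIntB⁺ b {i} {M} i≤ M<p = ≤ᵇ⁺ (≤-trans (≤-reflexive (trans (offset b i) (m<n⇒m%n≡m (≤-trans (s≤s i≤) M<p))))
    (≤-trans i≤ (≤-reflexive (sym (trans (offset b M) (m<n⇒m%n≡m M<p))))))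

  inIntB⁻ : ∀ b {M z} → M < p → inIntB {p} b (b +F ι M) z ≡ true → ∃ λ i → i ≤ M × z ≡ b +F ι i
  inIntB⁻ b {M} {z} M<p e = toℕ (z -F b) ,
    ≤-trans (≤ᵇ⇒≤ _ _ (Equivalence.from T-≡ e)) (≤-reflexive (trans (offset b M) (m<n⇒m%n≡m M<p))) ,
    sym (trans (cong (b +F_) (ι-toℕ (z -F b))) (trans (+F-comm b (z -F b)) (-F+F-cancel z b)))

  lc-multiple : ∀ a d h n → ι h *F lc a d 1 n ≡ lc a d h (h * n)
  lc-multiple a d h n = trans (cong (ι h *F_) (lc-1 a d n)) (trans (*F-distribˡ (ι h) a (ι n *F d))
    (trans (cong (ι h *F a +F_) (trans (sym (*F-assoc (ι h) (ι n) d)) (cong (_*F d) (ι-* h n)))) (sym (lc-def a d h (h * n)))))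

  lc-normalise : ∀ a d c → c *F d ≡ ι 1 → ∀ h n → c *F lc a d h n ≡ ι h *F (c *F a) +F ι n
  lc-normalise a d c cd h n = trans (cong (c *F_) (lc-def a d h n)) (trans (*F-distribˡ c (ι h *F a) (ι n *F d)) (cong₂ _+F_ (swap (ι h) a)
      (trans (swap (ι n) d) (trans (cong (ι n *F_) cd) (*F-identityʳ (ι n))))))
    where
    swap : ∀ u v → c *F (u *F v) ≡ u *F (c *F v)
    swap u v = trans (sym (*F-assoc c u v)) (trans (cong (_*F v) (*F-comm c u)) (*F-assoc u c v))

  lc-normalise₁ : ∀ a d c → c *F d ≡ ι 1 → ∀ n → c *F lc a d 1 n ≡ c *F a +F ι n
  lc-normalise₁ a d c cd n = trans (lc-normalise a d c cd 1 n) (cong (_+F ι n) (*F-identityˡ (c *F a)))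

  ι-∸ : ∀ {k ℓ : ℕ} {b : Fin p} {E} → ι ℓ *F b ≡ ι k *F b +F ι E → (ι ℓ -F ι k) *F b ≡ ι E
  ι-∸ {k} {ℓ} {b} {E} e = trans (*F-distribʳ b (ι ℓ) (-F (ι k))) (trans (cong₂ _+F_ e (sym (FpR.-‿distribˡ-* (ι k) b)))
    (trans (cong (_-F (ι k *F b)) (+F-comm (ι k *F b) (ι E))) (+F-F-cancel (ι E) (ι k *F b))))

  module _ (pr : Prime p) where

    invF-*F : ∀ (d : Fin p) → d ≢ ι 0 → invF d *F d ≡ ι 1
    invF-*F d d≢0 = trans (*F-comm (invF d) d) (*F-invF pr d d≢0)

    invF≢0 : ∀ (d : Fin p) → d ≢ ι 0 → invF d ≢ ι 0
    invF≢0 d d≢0 e = 1≢0 pr (trans (sym (*F-invF pr d d≢0)) (trans (cong (d *F_) e) (*F-zeroʳ d)))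

    solve-linear : ∀ {u x y : Fin p} → u ≢ ι 0 → u *F x ≡ y → x ≡ y *F invF u
    solve-linear {u} {x} {y} u≢0 e = *F-cancelˡ pr u x (y *F invF u) u≢0
      (trans e (sym (trans (trans (cong (u *F_) (*F-comm y (invF u))) (sym (*F-assoc u (invF u) y))) (trans (cong (_*F y) (*F-invF pr u u≢0)) (*F-identityˡ y)))))

    ι-F≢0 : ∀ {k ℓ} → k < p → ℓ < p → k ≢ ℓ → ι {p} k -F ι ℓ ≢ ι 0
    ι-F≢0 k<p ℓ<p ne = -F≢0 (λ e → ne (ι-injective k<p ℓ<p e))

    -- Dividing the first coordinate by d turns a progression into an interval. The translation of
    -- the slice over x by x · t straightens cosets for type 2; elsewhere t is zero.
    shear : ∀ {n} → Fin p → Pt p n → Pt p (suc n) → Pt p (suc n)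
    shear d t (x ∷ g) = (invF d *F x) ∷ (g ⊕ x · t)

    shear-automorphism : ∀ {n} d (t : Pt p n) → d ≢ ι 0 → IsAutomorphism (shear d t)
    shear-automorphism {n} d t d≢0 = injective⇒automorphism (shear d t) add inj
      where
      add : ∀ x y → shear d t (x ⊕ y) ≡ shear d t x ⊕ shear d t y
      add (x ∷ g) (y ∷ h) = cong₂ _∷_ (*F-distribˡ (invF d) x y) (trans (cong ((g ⊕ h) ⊕_) (·-distribʳ x y t)) (⊕-interchange g h (x · t) (y · t)))
      inj : ∀ x y → shear d t x ≡ shear d t y → x ≡ y
      inj (x ∷ g) (y ∷ h) e = cong₂ _∷_ x≡y (⊕-cancelʳ (x · t) g h (trans (proj₂ (∷-injective e)) (cong (λ z → h ⊕ z · t) (sym x≡y))))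
        where
        x≡y : x ≡ y
        x≡y = *F-cancelˡ pr (invF d) x y (invF≢0 d d≢0) (proj₁ (∷-injective e))

-- Reading off triviality, type 1 or type 2.

module Final (κ′ ℓ₀ λ' m : ℕ) {p n : ℕ} .{{nz : NonZero p}} (pr : Prime p)
  (ℓ<k : suc ℓ₀ < 3 + κ′) (hλ₀ : λ' + 5 ≤ 3 + κ′ + suc ℓ₀) (7≤m : 7 ≤ m) (s≤₀ : 3 + κ′ + suc ℓ₀ ≤ m + 1)
  (five : FiveTBound (3 + κ′ + suc ℓ₀) m) (p≡₀ : p ≡ (3 + κ′ + suc ℓ₀) * m + 2 + λ')
  (B : SubsetF p (suc n)) (sf : SumFree (3 + κ′) (suc ℓ₀) B) (nontriv : Nontrivial (3 + κ′) (suc ℓ₀) m λ' B)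
  (1≤n : 1 ≤ n) (big : m * p ^ n ≤ card B) (|Ω| : cardF (Slices.support B) ≤ m + 1) where

  open Slices B

  private
    k ℓ s : ℕ
    k = 3 + κ′
    ℓ = suc ℓ₀
    s = 3 + suc κ′ + ℓ₀

    k+ℓ : k + ℓ ≡ s
    k+ℓ = cong (3 +_) (+-suc κ′ ℓ₀)
    hλ : λ' + 5 ≤ s
    hλ = ≤-trans hλ₀ (≤-reflexive k+ℓ)
    s≤ : s ≤ m + 1
    s≤ = ≤-trans (≤-reflexive (sym k+ℓ)) s≤₀
    p≡ : p ≡ s * m + 2 + λ'
    p≡ = trans p≡₀ (cong (λ z → z * m + 2 + λ') k+ℓ)

    2m+2<p : 2 * m + 2 < p
    2m+2<p = lin (λ' * m + 2 * m + 6 + λ') (m ⊗ hλ ⊹ ≤-reflexive (sym p≡) ⊹ 7≤m) (eqn m s λ' p)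
      where
      eqn : ∀ m s l p → 1 + (2 * m + 2) + (m * s + p + m) + (l * m + 2 * m + 6 + l) ≡ p + (m * (l + 5) + (s * m + 2 + l) + 7)
      eqn = solve-∀
    m<p : m < p
    m<p = lin (m + 2) 2m+2<p (eqn m p)
      where
      eqn : ∀ m p → 1 + m + p + (m + 2) ≡ p + (1 + (2 * m + 2))
      eqn = solve-∀
    k<p : k < p
    k<p = lin (m + 1 + ℓ) (2m+2<p ⊹ s≤₀) (eqn k ℓ m p)
      where
      eqn : ∀ k ℓ m p → 1 + k + (p + (m + 1)) + (m + 1 + ℓ) ≡ p + (1 + (2 * m + 2) + (k + ℓ))
      eqn = solve-∀
    ℓ<p : ℓ < p
    ℓ<p = <-trans ℓ<k k<p

    N-odd : Odd N
    N-odd = odd-^ n (odd-prime pr (≤-trans (s≤s (m≤n+m 2 (2 * m))) 2m+2<p))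

    conflict : ∀ {z} → Full k z → Hit ℓ z → ⊥
    conflict f (g , h) = proj₂ sf _ (f g) h

    conflict′ : ∀ {z} → Hit k z → Full ℓ z → ⊥
    conflict′ (g , h) f = proj₂ sf _ h (f g)

    chosen : ∃ λ X → (∀ x → X x ≡ true → large x ≡ true) × cardF X ≡ m
    chosen = subset-of-size m (cardF large ∸ m) large (sym (m∸n+n≡m (large-many N-odd big |Ω|)))
    X = proj₁ chosen
    X⊆large = proj₁ (proj₂ chosen)
    |X| = proj₂ (proj₂ chosen)

    X⊆Ω : ∀ x → X x ≡ true → support x ≡ true
    X⊆Ω x ex = large⇒support (X⊆large x ex)

    full-K : ∀ {x₁ x₂ z₁ z₂} → Full 2 (x₁ +F x₂) → Rep support (suc κ′) z₁ → (x₁ +F x₂) +F z₁ ≡ z₂ → Full k z₂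
    full-K {x₁} {x₂} {z₁} {z₂} f r e = subst (λ h → Full h z₂) (+-comm (suc κ′) 2) (full-rep r f (trans (+F-comm z₁ (x₁ +F x₂)) e))

    H : ∀ {x₁ x₂ z₁ z₂} → X x₁ ≡ true → X x₂ ≡ true → Rep support (suc κ′) z₁ → Rep support (suc ℓ₀) z₂ → (x₁ +F x₂) +F z₁ ≡ z₂ → ⊥
    H {x₁} {x₂} e₁ e₂ r₁ r₂ eq = conflict (full-K {x₁} {x₂} (large-two (X⊆large _ e₁) (X⊆large _ e₂)) r₁ eq) (hit r₂)

  open Structure κ′ ℓ₀ λ' m pr hλ 7≤m s≤ p≡ X support X⊆Ω |X| H hiding (k; ℓ)

  private
    Rep-mono : ∀ {h z} → Rep X h z → Rep support h z
    Rep-mono [] = []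
    Rep-mono (cons e r q) = cons (X⊆Ω _ e) (Rep-mono r) q

    sumfree-X : ∀ z → Rep X k z → Rep X ℓ z → ⊥
    sumfree-X z (cons {x = x₁} e₁ (cons {x = x₂} {z′} e₂ r refl) refl) r′ = H e₁ e₂ (Rep-mono r) (Rep-mono r′) (+F-assoc x₁ x₂ z′)

    result : Result
    result = let a , d , d≢0 , cov = sumfree-cover k ℓ λ' m (s≤s z≤n) (s≤s z≤n) hλ₀ 7≤m five p≡₀ pr X |X| sumfree-X
             in structure (≤-trans |Ω| (≤-reflexive (+-comm m 1))) a d d≢0 cov

    not-in-cuboid : ∀ a d j → d ≢ ι 0 → support ⊑[ a , d ] m → lc a d ℓ 0 ≡ lc a d k (k * m + suc j) → j < ⌈ λ' + 1 /2⌉ → ⊥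
    not-in-cuboid a d j d≢0 cov gap j< = nontriv j j< (shear pr d 𝟘 , shear-automorphism pr d 𝟘 d≢0 , inside)
      where
      c = invF d
      cd = invF-*F pr d d≢0
      base : c *F a ≡ (-F ι (k * m + 1 + j)) *F invF (ι k -F ι ℓ)
      base = solve-linear pr (ι-F≢0 pr k<p ℓ<p (<⇒≢ ℓ<k ∘ sym)) (trans (cong (_*F (c *F a)) flip)
        (trans (sym (FpR.-‿distribˡ-* (ι ℓ -F ι k) (c *F a))) (cong (λ z → -F z) (trans (ι-∸ {k = k} {ℓ} eqb) (cong ι (sym (+-assoc (k * m) 1 j)))))))
        where
        flip : ι {p} k -F ι ℓ ≡ -F (ι ℓ -F ι k)
        flip = sym (trans (sym (FpG.⁻¹-∙-comm (ι ℓ) (-F (ι k)))) (trans (cong ((-F (ι ℓ)) +F_) (FpG.⁻¹-involutive (ι k))) (+F-comm (-F (ι ℓ)) (ι k))))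
        eqb : ι ℓ *F (c *F a) ≡ ι k *F (c *F a) +F ι (k * m + suc j)
        eqb = trans (sym (trans (lc-normalise a d c cd ℓ 0) (+F-identityʳ _))) (trans (cong (c *F_) gap) (lc-normalise a d c cd k _))
      inside : ∀ x → B x ≡ true → extremal k ℓ m j (shear pr d 𝟘 x) ≡ true
      inside (x ∷ g) e = let i , i≤ , eq = cov x (support⁺ e) in
        subst (λ b → inIntB b (b +F ι m) (c *F x) ≡ true) base
          (trans (cong (inIntB (c *F a) (c *F a +F ι m)) (trans (cong (c *F_) eq) (lc-normalise₁ a d c cd i))) (inIntB⁺ (c *F a) i≤ m<p))

    -- As g₁ + g₂ = λ, one of the gaps is below ⌈(λ + 1)/2⌉ and serves as the index j of an extremal
    -- cuboid; if it is g₂, the progression is reversed.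
    not-extremal : Extremal → ⊥
    not-extremal (a , d , g₁ , g₂ , d≢0 , cov , gap , g≡) with suc g₁ ≤? ⌈ λ' + 1 /2⌉
    ... | yes h = not-in-cuboid a d g₁ d≢0 cov gap h
    ... | no ¬h = not-in-cuboid (lc a d 1 m) (-F d) g₂ (neg≢0 d≢0) (⊑-reverse pr cov)
            (lc-reverse-gap pr a d k ℓ m (k * m + suc g₁) g₂ gap (trans p≡ (trans (cong (s * m + 2 +_) (sym g≡)) (eqn κ′ ℓ₀ m g₁ g₂)))) h′
      where
      eqn : ∀ κ ℓ m g₁ g₂ → (3 + suc κ + ℓ) * m + 2 + (g₁ + g₂) ≡ (3 + κ) * m + suc g₁ + (suc ℓ * m + suc g₂)
      eqn = solve-∀
      h′ : suc g₂ ≤ ⌈ λ' + 1 /2⌉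
      h′ with suc g₂ ≤? ⌈ λ' + 1 /2⌉
      ... | yes q = q
      ... | no ¬q = ⊥-elim (1+n≰n {λ'} (≤-trans (≤-reflexive (+-comm 1 λ')) (≤-trans (≤-reflexive (sym (⌊n/2⌋+⌈n/2⌉≡n (λ' + 1))))
              (≤-trans (+-mono-≤ (≤-trans (⌊n/2⌋≤⌈n/2⌉ (λ' + 1)) (≤-pred (≰⇒> ¬h))) (≤-pred (≰⇒> ¬q))) (≤-reflexive g≡)))))

    interval-p : ∀ {a d g₁ g₂} (I : Interval a d g₁ g₂) → p ≡ k * Interval.M I + suc g₁ + (ℓ * Interval.M I + suc g₂)
    interval-p {g₁ = g₁} {g₂} I = trans p≡ (trans (cong (λ z → s * z + 2 + λ') (sym M≡)) (trans (eqn s M λ') (trans (cong (s * M + 2 +_) (sym total)) (eqn′ κ′ ℓ₀ M g₁ g₂))))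
      where
      open Interval I
      eqn : ∀ s M l → s * suc M + 2 + l ≡ s * M + 2 + (s + l)
      eqn = solve-∀
      eqn′ : ∀ κ ℓ m g₁ g₂ → (3 + suc κ + ℓ) * m + 2 + (g₁ + g₂) ≡ (3 + κ) * m + suc g₁ + (suc ℓ * m + suc g₂)
      eqn′ = solve-∀

    interval-reverse : ∀ {a d g₁ g₂} (I : Interval a d g₁ g₂) → Interval (lc a d 1 (Interval.M I)) (-F d) g₂ g₁
    interval-reverse {a} {d} {g₁} {g₂} I = record
      { M = M ; M≡ = M≡ ; d≢0 = neg≢0 d≢0 ; X⊑ = ⊑-reverse pr X⊑
      ; ⊑X = λ i i≤ → trans (cong X (lc-reverse-at pr a d M i≤)) (⊑X (M ∸ i) (m∸n≤m M i))
      ; gap = lc-reverse-gap pr a d k ℓ M (k * M + suc g₁) g₂ gap (interval-p I)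
      ; total = trans (+-comm g₂ g₁) total }
      where open Interval I

    M<p : ∀ {M} → suc M ≡ m → M < p
    M<p refl = <⇒≤ m<p

    type1 : ∀ {a d g₁ g₂} → Interval a d g₁ g₂ → (∀ x → support x ≡ true → X x ≡ true) →
      (suc g₁ ≤ ℓ ⊎ (λ' + ℓ + 2 ≤ suc g₁ × suc g₁ ≤ k)) → Type1 k ℓ m λ' B
    type1 {a} {d} {g₁} {g₂} I Ω⊆X range = b , (shear pr d 𝟘 , shear-automorphism pr d 𝟘 d≢0 , iso) , position range
      where
      open Interval I
      c = invF d
      cd = invF-*F pr d d≢0
      b = c *F a
      m∸1 : m ∸ 1 ≡ M
      m∸1 = cong (_∸ 1) (sym M≡)
      |Ω|≤m : cardF support ≤ m
      |Ω|≤m = ≤-trans (cardF-mono Ω⊆X) (≤-reflexive |X|)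
      iso : ∀ x → B x ≡ cuboid b (b +F ι (m ∸ 1)) (shear pr d 𝟘 x)
      iso (x ∷ g) = subst (λ z → B (x ∷ g) ≡ inIntB b (b +F ι z) (c *F x)) (sym m∸1) (iff⇒≡ to from)
        where
        to : B (x ∷ g) ≡ true → inIntB b (b +F ι M) (c *F x) ≡ true
        to e = let i , i≤ , eq = X⊑ x (Ω⊆X x (support⁺ e)) in
          trans (cong (inIntB b (b +F ι M)) (trans (cong (c *F_) eq) (lc-normalise₁ a d c cd i))) (inIntB⁺ b i≤ (M<p M≡))
        from : inIntB b (b +F ι M) (c *F x) ≡ true → B (x ∷ g) ≡ true
        from e = let i , i≤ , eq = inIntB⁻ b (M<p M≡) e
                     x≡ = *F-cancelˡ pr c x (lc a d 1 i) (invF≢0 pr d d≢0) (trans eq (sym (lc-normalise₁ a d c cd i)))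
                 in size-full (all-full big |Ω|≤m (trans (cong support x≡) (X⊆Ω _ (⊑X i i≤)))) g
      -- The quantity that the definition of type 1 confines to an interval is the distance g₁ + 1
      -- from the end of the hull of kX to the start of that of ℓX.
      e-value : ι ℓ *F b -F ι k *F (b +F ι (m ∸ 1)) ≡ ι (suc g₁)
      e-value = trans (cong₂ _-F_ lhs rhs) (trans (cong (_-F (ι k *F b +F ι (k * M))) (+F-comm (ι k *F b +F ι (k * M)) (ι (suc g₁)))) (+F-F-cancel (ι (suc g₁)) _))
        where
        lhs : ι ℓ *F b ≡ (ι k *F b +F ι (k * M)) +F ι (suc g₁)
        lhs = trans (sym (trans (lc-normalise a d c cd ℓ 0) (+F-identityʳ _))) (trans (cong (c *F_) gap) (trans (lc-normalise a d c cd k _)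
                (trans (cong (ι k *F b +F_) (sym (ι-+ (k * M) (suc g₁)))) (sym (+F-assoc (ι k *F b) (ι (k * M)) (ι (suc g₁)))))))
        rhs : ι k *F (b +F ι (m ∸ 1)) ≡ ι k *F b +F ι (k * M)
        rhs = trans (*F-distribˡ (ι k) b (ι (m ∸ 1))) (cong (ι k *F b +F_) (trans (ι-* k (m ∸ 1)) (cong (λ z → ι (k * z)) m∸1)))
      within : ∀ lo hi {i} → lo ≤ i → i ≤ hi → hi < p → inIntB {p} (ι lo) (ι hi) (ι i) ≡ true
      within lo hi {i} lo≤ i≤ hi<p = subst₂ (λ u v → inIntB (ι lo) u v ≡ true)
        (trans (ι-+ lo (hi ∸ lo)) (cong ι (m+[n∸m]≡n (≤-trans lo≤ i≤)))) (trans (ι-+ lo (i ∸ lo)) (cong ι (m+[n∸m]≡n lo≤)))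
        (inIntB⁺ (ι lo) (∸-monoˡ-≤ lo i≤) (≤-trans (s≤s (m∸n≤m hi lo)) hi<p))
      position : (suc g₁ ≤ ℓ ⊎ (λ' + ℓ + 2 ≤ suc g₁ × suc g₁ ≤ k)) →
        let e = ι ℓ *F b -F ι k *F (b +F ι (m ∸ 1)) in
        (inIntB (ι 1) (ι ℓ) e ≡ true ⊎ (λ' + ℓ + 2 ≤ k × inIntB (ι (λ' + ℓ + 2)) (ι k) e ≡ true))
      position (inj₁ h) = inj₁ (trans (cong (inIntB (ι 1) (ι ℓ)) e-value) (within 1 ℓ (s≤s z≤n) h ℓ<p))
      position (inj₂ (h , h′)) = inj₂ (≤-trans h h′ , trans (cong (inIntB (ι (λ' + ℓ + 2)) (ι k)) e-value) (within (λ' + ℓ + 2) k h h′ k<p))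

    lc-rebase-* : ∀ a d t h j → lc (lc a d 1 t) d h j ≡ lc a d h (h * t + j)
    lc-rebase-* a d t h j = trans (lc-def _ d h j) (trans (cong (_+F ι j *F d) (lc-multiple a d h t)) (lc-shift a d h (h * t) j))

    -- Adding the place after the far end lengthens the two hulls by k and ℓ at their far ends, so
    -- the gaps become g₁ - k and g₂ - ℓ with sum λ. The hypotheses say that both are nonnegative.
    extends-right : ∀ {a d g₁ g₂} (I : Interval a d g₁ g₂) → support ⊑[ a , d ] m → k ≤ g₁ → g₁ ≤ k + λ' → ⊥
    extends-right {a} {d} {g₁} I cov k≤ ≤λ = not-extremal (a , d , g₁ ∸ k , λ' ∸ (g₁ ∸ k) , d≢0 , cov ,
        trans gap (cong (lc a d k) (trans (cong (λ z → k * M + suc z) (sym (m+[n∸m]≡n k≤))) (trans (eqn k M (g₁ ∸ k)) (cong (λ z → k * z + suc (g₁ ∸ k)) M≡)))) ,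
        m+[n∸m]≡n (m≤n+o⇒m∸n≤o g₁ k ≤λ))
      where
      open Interval I
      eqn : ∀ k M j → k * M + suc (k + j) ≡ k * suc M + suc j
      eqn = solve-∀

    -- Adding the place before a instead costs g₁ only ℓ and g₂ the k. It requires Ω to have no
    -- point after X.
    extends-left : ∀ {a d g₁ g₂} (I : Interval a d g₁ g₂) → (∀ x → support x ≡ true → X x ≡ true) → ℓ ≤ g₁ → g₁ ≤ ℓ + λ' → ⊥
    extends-left {a} {d} {g₁} I Ω⊆X ℓ≤ ≤λ = not-extremal (a′ , d , j , λ' ∸ j , d≢0 , cov , gap′ , m+[n∸m]≡n (m≤n+o⇒m∸n≤o g₁ ℓ ≤λ))
      where
      open Interval I
      j = g₁ ∸ ℓ
      a′ = a -F d
      a≡ : lc a′ d 1 1 ≡ a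
      a≡ = trans (lc-1 a′ d 1) (trans (cong (a′ +F_) (*F-identityˡ d)) (-F+F-cancel a d))
      back : ∀ h n → lc a d h n ≡ lc a′ d h (h * 1 + n)
      back h n = trans (cong (λ z → lc z d h n) (sym a≡)) (lc-rebase-* a′ d 1 h n)
      cov : support ⊑[ a′ , d ] m
      cov x ex = let i , i≤ , eq = X⊑ x (Ω⊆X x ex) in suc i , ≤-trans (s≤s i≤) (≤-reflexive M≡) , trans eq (back 1 i)
      gap′ : lc a′ d ℓ 0 ≡ lc a′ d k (k * m + suc j)
      gap′ = +F-cancelʳ (ι ℓ *F d) _ _ (trans (lc-shift a′ d ℓ 0 ℓ) (trans (cong (lc a′ d ℓ) (sym (trans (+-identityʳ _) (*-identityʳ ℓ))))
        (trans (sym (back ℓ 0)) (trans gap (trans (back k _) (trans (cong (lc a′ d k) shift) (sym (lc-shift a′ d k (k * m + suc j) ℓ))))))))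
        where
        shift : k * 1 + (k * M + suc g₁) ≡ k * m + suc j + ℓ
        shift = trans (cong (λ z → k * 1 + (k * M + suc z)) (sym (m+[n∸m]≡n ℓ≤))) (trans (eqn k M ℓ j) (cong (λ z → k * z + suc j + ℓ) M≡))
          where
          eqn : ∀ k M ℓ j → k * 1 + (k * M + suc (ℓ + j)) ≡ k * suc M + suc j + ℓ
          eqn = solve-∀

    -- The range of g₁ splits at ℓ, ℓ + λ, k and k + λ. On [ℓ, ℓ + λ] and [k, k + λ] the interval
    -- extends to an extremal one; below ℓ and strictly between ℓ + λ and k it is of type 1; above k
    -- + λ one has g₂ < ℓ, and the reversed interval is of type 1.
    normal-interval : ∀ {a d g₁ g₂} → Interval a d g₁ g₂ → (∀ x → support x ≡ true → X x ≡ true) → Type1 k ℓ m λ' B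
    normal-interval {a} {d} {g₁} {g₂} I Ω⊆X = case₁ (suc g₁ ≤? ℓ)
      where
      open Interval I
      case₄ : ¬ g₁ < k → Dec (g₁ ≤ k + λ') → Type1 k ℓ m λ' B
      case₄ ¬h₃ (yes h) = ⊥-elim (extends-right I (λ x ex → let i , i≤ , eq = X⊑ x (Ω⊆X x ex) in
        i , ≤-trans i≤ (≤-trans (n≤1+n _) (≤-reflexive M≡)) , eq) (≤-pred (≰⇒> ¬h₃)) h)
      case₄ ¬h₃ (no ¬h) = type1 (interval-reverse I) Ω⊆X (inj₁ (lin 0 (≰⇒> ¬h ⊹ ≤-reflexive total) (eqn g₁ g₂ κ′ ℓ₀ λ')))
        where
        eqn : ∀ g₁ g₂ κ ℓ l → suc g₂ + (g₁ + (3 + suc κ + ℓ + l)) + 0 ≡ suc ℓ + (1 + (3 + κ + l) + (g₁ + g₂))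
        eqn = solve-∀
      case₃ : ¬ g₁ ≤ ℓ + λ' → Dec (g₁ < k) → Type1 k ℓ m λ' B
      case₃ ¬h₂ (yes h) = type1 I Ω⊆X (inj₂ (lin 0 (≰⇒> ¬h₂) (eqn λ' ℓ g₁) , h))
        where
        eqn : ∀ l ℓ g → l + ℓ + 2 + g + 0 ≡ suc g + (1 + (ℓ + l))
        eqn = solve-∀
      case₃ ¬h₂ (no ¬h) = case₄ ¬h (g₁ ≤? k + λ')
      case₂ : ¬ g₁ < ℓ → Dec (g₁ ≤ ℓ + λ') → Type1 k ℓ m λ' B
      case₂ ¬h₁ (yes h) = ⊥-elim (extends-left I Ω⊆X (≤-pred (≰⇒> ¬h₁)) h)
      case₂ ¬h₁ (no ¬h) = case₃ ¬h (suc g₁ ≤? k)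
      case₁ : Dec (g₁ < ℓ) → Type1 k ℓ m λ' B
      case₁ (yes h) = type1 I Ω⊆X (inj₁ h)
      case₁ (no ¬h) = case₂ ¬h (g₁ ≤? ℓ + λ')

    module Type2Case {a d : Fin p} {g₁ g₂ : ℕ} (I : Interval a d g₁ g₂) (y∈ : support (lc a d 1 m) ≡ true) (cov : support ⊑[ a , d ] m) where
      open Interval I

      x : ℕ → Fin p
      x = lc a d 1
      y = x m

      x∈ : ∀ i → i ≤ M → support (x i) ≡ true
      x∈ i i≤ = X⊆Ω _ (⊑X i i≤)

      M<m : M < m
      M<m = ≤-reflexive M≡

      x-≢ : ∀ {i j} → i ≤ m → j ≤ m → i ≢ j → x i ≢ x j
      x-≢ i≤ j≤ ne e = ne (lc-inj pr d≢0 a 1 (≤-trans (s≤s i≤) m<p) (≤-trans (s≤s j≤) m<p) e)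

      2≤M : 2 ≤ M
      2≤M = ≤-pred (≤-trans (≤-trans (s≤s (s≤s (s≤s z≤n))) 7≤m) (≤-reflexive (sym M≡)))

      -- If the slices over y and x_i already lack N points in total, no other slice can lack any.
      others-full : ∀ {i j} → i ≤ M → j ≤ M → i ≢ j → size y + size (x i) ≤ N → N ≤ size (x j)
      others-full {i} {j} i≤ j≤ ne h = lin 0 (three-slices big |Ω| y∈ (x∈ i i≤) (x∈ j j≤)
          (x-≢ ≤-refl (≤-trans i≤ (<⇒≤ M<m)) (λ e → <⇒≢ (≤-trans (s≤s i≤) M<m) (sym e)))
          (x-≢ ≤-refl (≤-trans j≤ (<⇒≤ M<m)) (λ e → <⇒≢ (≤-trans (s≤s j≤) M<m) (sym e)))
          (x-≢ (≤-trans i≤ (<⇒≤ M<m)) (≤-trans j≤ (<⇒≤ M<m)) ne) ⊹ h) (eqn N (size y) (size (x i)) (size (x j)))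
        where
        eqn : ∀ N a b c → N + (a + b + c + N) + 0 ≡ c + (2 * N + (a + b))
        eqn = solve-∀

      reps : ∀ {i} → support (x i) ≡ true → ∀ h → Rep support h (lc a d h (h * i))
      reps e h = ORep⇒Rep pr a d (repeat e h)

      zeros : ∀ h → Rep support h (lc a d h 0)
      zeros h = subst (λ z → Rep support h (lc a d h z)) (*-zeroʳ h) (reps (x∈ 0 z≤n) h)

      -- ℓa = (k−1)y + x_M
      gap≢k-2 : g₁ ≡ suc κ′ → ⊥
      gap≢k-2 refl = decide (suc N ≤? size y + size (x M))
        where
        point : (y +F x M) +F lc a d (suc κ′) (suc κ′ * m) ≡ lc a d ℓ 0
        point = trans (cong (_+F lc a d (suc κ′) (suc κ′ * m)) (lc-+ a d 1 m 1 M)) (trans (lc-+ a d 2 (m + M) (suc κ′) (suc κ′ * m))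
          (trans (cong (lc a d k) (trans (cong (λ z → z + M + suc κ′ * z) (sym M≡)) (eqn M κ′))) (sym gap)))
          where
          eqn : ∀ M κ → suc M + M + suc κ * suc M ≡ (3 + κ) * M + suc (suc κ)
          eqn = solve-∀
        rep : Rep support k (lc a d ℓ 0)
        rep = cons y∈ (cons (x∈ M ≤-refl) (reps y∈ (suc κ′)) refl) (trans (cong (y +F_) (lc-+ a d 1 M (suc κ′) (suc κ′ * m)))
          (trans (lc-+ a d 1 m (2 + κ′) (M + suc κ′ * m)) (trans (cong (lc a d k) (trans (cong (λ z → z + (M + suc κ′ * z)) (sym M≡)) (eqn M κ′))) (sym gap))))
          where
          eqn : ∀ M κ → suc M + (M + suc κ * suc M) ≡ (3 + κ) * M + suc (suc κ)
          eqn = solve-∀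
        full : size y + size (x M) ≤ N → Full ℓ (lc a d ℓ 0)
        full h = subst (λ h → Full h (lc a d ℓ 0)) (+-comm ℓ₀ 1) (full-rep (zeros ℓ₀) (full-one (others-full ≤-refl z≤n (λ e → <⇒≢ (≤-trans (s≤s z≤n) 2≤M) (sym e)) h))
          (trans (lc-+ a d ℓ₀ 0 1 0) (cong (λ h → lc a d h 0) (+-comm ℓ₀ 1))))
        -- Either the slices over y and x_M are large enough together to make (k - 1)y + x_M full,
        -- or the slice over a is full and so is ℓa. In both cases the other side still hits this
        -- residue.
        decide : Dec (N < size y + size (x M)) → ⊥
        decide (yes h) = conflict (full-K {y} {x M} (full-two h) (reps y∈ (suc κ′)) point) (hit (zeros ℓ))
        decide (no ¬h) = conflict′ (hit rep) (full (≤-pred (≰⇒> ¬h)))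

      module _ (g≡ : g₁ ≡ suc (suc κ′)) where

        ky : lc a d k (k * m) ≡ lc a d ℓ 0
        ky = sym (trans gap (cong (lc a d k) (trans (cong (λ z → k * M + suc z) g≡) (trans (eqn M κ′) (cong (k *_) M≡)))))
          where
          eqn : ∀ M κ → (3 + κ) * M + suc (suc (suc κ)) ≡ (3 + κ) * suc M
          eqn = solve-∀

        ℓ₀≡0 : ℓ₀ ≡ 0
        ℓ₀≡0 = go ℓ₀ refl
          where
          go : ∀ h → ℓ₀ ≡ h → ℓ₀ ≡ 0
          go zero eq = eq
          -- For ℓ ≥ 2 two of the ℓ terms a come from a large slice, so ℓa is full although ky hits
          -- it.
          go (suc j) eq = ⊥-elim (conflict′ (hit (subst (Rep support k) ky (reps y∈ k)))
              (subst (λ h → Full h (lc a d ℓ 0)) 2+j (full-rep (zeros j) (large-two (X⊆large _ (⊑X 0 z≤n)) (X⊆large _ (⊑X 0 z≤n)))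
                (trans (cong (lc a d j 0 +F_) (lc-+ a d 1 0 1 0)) (trans (lc-+ a d j 0 2 0) (cong (λ h → lc a d h 0) 2+j))))))
            where
            2+j : j + 2 ≡ ℓ
            2+j = trans (+-comm j 2) (cong suc (sym eq))

        U W V : SubsetF p n
        U g = B (y ∷ g)
        W g = B (x 0 ∷ g)

        w : Pt p n
        w = proj₁ (support⁻ y∈)
        w∈ : U w ≡ true
        w∈ = proj₂ (support⁻ y∈)

        V v = U (w ⊕ v)

        kk : lc a d k (k * m) ≡ x 0
        kk = trans ky (cong (λ h → lc a d (suc h) 0) ℓ₀≡0)

        ·-suc : ∀ j (v : Pt p n) → v ⊕ ι j · v ≡ ι (suc j) · v
        ·-suc j v = trans (cong (_⊕ ι j · v) (sym (·-identity v))) (trans (sym (·-distribʳ (ι 1) (ι j) v)) (cong (_· v) (ι-+ 1 j)))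

        multiples : ∀ j → InSumset j B (lc a d j (j * m) ∷ ι j · w)
        multiples zero = [] , VAll.[] , cong₂ _∷_ (sym (lc-00 a d)) (sym (·-zero w))
        multiples (suc j) = subst₂ (λ z g → InSumset (suc j) B (z ∷ g)) (lc-+ a d 1 m j (j * m)) (·-suc j w) (InSumset-cons w∈ (multiples j))

        not-W : ∀ {g} → InSumset k B (lc a d k (k * m) ∷ g) → W g ≡ false
        not-W {g} i = ¬true⇒false λ e → proj₂ sf (lc a d k (k * m) ∷ g) i (subst (λ h → InSumset (suc h) B (lc a d k (k * m) ∷ g)) (sym ℓ₀≡0)
          (subst (λ z → InSumset 1 B (z ∷ g)) (sym kk) ((x 0 ∷ g) ∷ [] , e VAll.∷ VAll.[] , cong₂ _∷_ (+F-identityʳ (x 0)) (⊕-identityʳ g))))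

        r : Pt p n
        r = ι (2 + κ′) · w

        in-kU : ∀ {u} → U u ≡ true → W (u ⊕ r) ≡ false
        in-kU {u} e = not-W (subst (λ z → InSumset k B (z ∷ (u ⊕ r))) (lc-+ a d 1 m (2 + κ′) ((2 + κ′) * m)) (InSumset-cons e (multiples (2 + κ′))))

        in-kU₂ : ∀ {u u′} → U u ≡ true → U u′ ≡ true → W (u ⊕ (u′ ⊕ ι (1 + κ′) · w)) ≡ false
        in-kU₂ {u} {u′} e e′ = not-W (subst (λ z → InSumset k B (z ∷ (u ⊕ (u′ ⊕ ι (1 + κ′) · w))))
          (trans (cong (y +F_) (lc-+ a d 1 m (1 + κ′) ((1 + κ′) * m))) (lc-+ a d 1 m (2 + κ′) _)) (InSumset-cons e (InSumset-cons e′ (multiples (1 + κ′)))))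

        T : SubsetF p n
        T g = U (g ⊖ r)

        T⇒¬W : ∀ g → T g ≡ true → not (W g) ≡ true
        T⇒¬W g e = false⇒not-true (trans (cong W (sym (⊖⊕-cancel g r))) (in-kU e))

        |U|≤|T| : card U ≤ card T
        |U|≤|T| = cnt-≤ (_⊕ r) (allFinVec-unique p n) (allFinVec-complete p n) (λ u e → trans (cong U (⊕⊖-cancel u r)) e) (λ u v _ _ → ⊕-cancelʳ r u v)

        |W|+|¬W| : card W + card (λ g → not (W g)) ≡ N
        |W|+|¬W| = trans (cnt-not W (allFinVec p n)) (length-allFinVec p n)

        small : size y + size (x 0) ≤ N
        small = subst₂ (λ u v → u + v ≤ N) (sym (size-def y)) (sym (size-def (x 0)))
          (≤-trans (+-monoˡ-≤ (card W) (≤-trans |U|≤|T| (cnt-mono (allFinVec p n) T⇒¬W))) (≤-reflexive (trans (+-comm _ (card W)) |W|+|¬W|)))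

        -- The slices over y, x₀, x₁ hold at least 2N points, of which x₁ accounts for at most N.
        exact : N ≤ card U + card W
        exact = subst₂ (λ u v → N ≤ u + v) (size-def y) (size-def (x 0))
          (lin 0 (three-slices big |Ω| y∈ (x∈ 0 z≤n) (x∈ 1 1≤M)
              (x-≢ ≤-refl z≤n (λ e → <⇒≢ (≤-trans (s≤s z≤n) 7≤m) (sym e))) (x-≢ ≤-refl 1≤m (λ e → <⇒≢ (≤-trans (s≤s 1≤M) M<m) (sym e))) (x-≢ z≤n 1≤m (λ ()))
            ⊹ size-≤N (x 1)) (eqn N (size y) (size (x 0)) (size (x 1))))
          where
          1≤M : 1 ≤ M
          1≤M = ≤-trans (s≤s z≤n) 2≤M
          1≤m : 1 ≤ m
          1≤m = ≤-trans (s≤s z≤n) 7≤m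
          eqn : ∀ N a b c → N + (a + b + c + N) + 0 ≡ a + b + (2 * N + c)
          eqn = solve-∀

        -- |U| + |W| = N turns the inclusion U + (k−1)w ⊆ G ∖ W into an equality.
        ¬W⇒U : ∀ {g} → W g ≡ false → U (g ⊖ r) ≡ true
        ¬W⇒U {g} e = cnt-⊆-≥ {P = T} {λ g → not (W g)} (allFinVec p n) (allFinVec-complete p n) T⇒¬W
          (≤-trans (+-cancelˡ-≤ (card W) _ _ (≤-trans (≤-reflexive |W|+|¬W|) (≤-trans exact (≤-reflexive (+-comm (card U) (card W)))))) |U|≤|T|) g (false⇒not-true e)

        V-𝟘 : V 𝟘 ≡ true
        V-𝟘 = trans (cong U (⊕-identityʳ w)) w∈

        -- The k-fold sums U + U + (k - 2)w avoid W, hence lie in its complement U + (k - 1)w;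
        -- cancelling translations leaves V + V inside V.
        V-⊕ : ∀ v v′ → V v ≡ true → V v′ ≡ true → V (v ⊕ v′) ≡ true
        V-⊕ v v′ e e′ = trans (cong U (⊕-cancelʳ r (w ⊕ (v ⊕ v′)) _ (trans point (sym (⊖⊕-cancel _ r))))) (¬W⇒U (in-kU₂ e e′))
          where
          point : (w ⊕ (v ⊕ v′)) ⊕ r ≡ (w ⊕ v) ⊕ ((w ⊕ v′) ⊕ ι (1 + κ′) · w)
          point = trans (cong₂ _⊕_ (sym (⊕-assoc w v v′)) (sym (·-suc (1 + κ′) w))) (trans (⊕-interchange (w ⊕ v) v′ w (ι (1 + κ′) · w))
            (trans (⊕-assoc (w ⊕ v) w (v′ ⊕ ι (1 + κ′) · w)) (cong ((w ⊕ v) ⊕_) (sym (⊕-assoc w v′ (ι (1 + κ′) · w))))))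

        V-· : ∀ c v → V v ≡ true → V (c · v) ≡ true
        V-· c v e = subst (λ z → V (z · v) ≡ true) (ι-toℕ c) (go (toℕ c))
          where
          go : ∀ j → V (ι j · v) ≡ true
          go zero = trans (cong V (·-zero v)) V-𝟘
          go (suc j) = trans (cong V (sym (·-suc j v))) (V-⊕ v (ι j · v) e (go j))

        x₀≡ky : x 0 ≡ ι k *F y
        x₀≡ky = trans (sym kk) (sym (lc-multiple a d k m))

        y≢0 : y ≢ ι 0
        y≢0 e = x-≢ z≤n ≤-refl (<⇒≢ (≤-trans (s≤s z≤n) 7≤m)) (trans x₀≡ky (trans (cong (ι k *F_) e) (trans (*F-zeroʳ (ι k)) (sym e))))

        -- Chosen with y · t = -w, so that the shear carries U to V. Because x₀ = ky it moves the
        -- slice over x₀ by -kw, and the complement U + (k - 1)w of W goes to V as well: one shear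
        -- normalises both exceptional slices.
        t : Pt p n
        t = invF y · (⊖ w)

        y·t : y · t ≡ ⊖ w
        y·t = trans (sym (·-assoc y (invF y) (⊖ w))) (trans (cong (_· (⊖ w)) (*F-invF pr y y≢0)) (·-identity (⊖ w)))

        ·-⊖ : ∀ {n} c (v : Pt p n) → c · (⊖ v) ≡ ⊖ (c · v)
        ·-⊖ c [] = refl
        ·-⊖ c (z ∷ v) = cong₂ _∷_ (sym (FpR.-‿distribʳ-* c z)) (·-⊖ c v)

        x₀·t : x 0 · t ≡ ⊖ (w ⊕ r)
        x₀·t = trans (cong (_· t) x₀≡ky) (trans (·-assoc (ι k) y t) (trans (cong (ι k ·_) y·t) (trans (·-⊖ (ι k) w) (cong (λ z → ⊖ z) (sym (·-suc (2 + κ′) w))))))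

        V-at-y : ∀ g → V (g ⊕ y · t) ≡ U g
        V-at-y g = cong U (trans (cong (λ z → w ⊕ (g ⊕ z)) y·t) (trans (⊕-comm w (g ⊖ w)) (⊖⊕-cancel g w)))

        V-at-x₀ : ∀ g → V (g ⊕ x 0 · t) ≡ U (g ⊖ r)
        V-at-x₀ g = cong U (trans (cong (λ z → w ⊕ (g ⊕ z)) x₀·t) (⊕-cancelʳ r _ _ (trans (cong (_⊕ r) (⊕-comm w q)) (trans (⊕-assoc q w r)
            (trans (⊖⊕-cancel g (w ⊕ r)) (sym (⊖⊕-cancel g r)))))))
          where q = g ⊖ (w ⊕ r)

        c = invF d
        cd = invF-*F pr d d≢0
        b = c *F a

        base : b ≡ (ι m *F ι k) *F invF (ι ℓ -F ι k)
        base = solve-linear pr (ι-F≢0 pr ℓ<p k<p (<⇒≢ ℓ<k)) (trans (ι-∸ {k = k} {ℓ} eqb) (trans (cong ι (*-comm k m)) (sym (ι-* m k))))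
          where
          eqb : ι ℓ *F b ≡ ι k *F b +F ι (k * m)
          eqb = trans (sym (trans (lc-normalise a d c cd ℓ 0) (+F-identityʳ _))) (trans (cong (c *F_) (sym ky)) (lc-normalise a d c cd k _))

        recover : ∀ {z} i → c *F z ≡ b +F ι i → z ≡ x i
        recover {z} i e = *F-cancelˡ pr c z (x i) (invF≢0 pr d d≢0) (trans e (sym (lc-normalise₁ a d c cd i)))

        M′ = M ∸ 1
        middle : b +F ι (m ∸ 1) ≡ (b +F ι 1) +F ι M′
        middle = trans (cong (λ z → b +F ι z) (trans (cong (_∸ 1) (sym M≡)) (sym (m+[n∸m]≡n (≤-trans (s≤s z≤n) 2≤M)))))
          (sym (trans (+F-assoc b (ι 1) (ι M′)) (cong (b +F_) (ι-+ 1 M′))))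
        M′<p : M′ < p
        M′<p = ≤-trans (s≤s (m∸n≤m M 1)) (M<p M≡)

        iso : ∀ z → B z ≡ type2Set b m V (shear pr d t z)
        iso (z ∷ g) = iff⇒≡ to from
          where
          P₁ P₂ P₃ : Bool
          P₁ = ((c *F z) ==F b) ∧ not (V (g ⊕ z · t))
          P₂ = inIntB (b +F ι 1) (b +F ι (m ∸ 1)) (c *F z)
          P₃ = ((c *F z) ==F (b +F ι m)) ∧ V (g ⊕ z · t)
          at : ∀ i → i ≤ m → z ≡ x i → B (z ∷ g) ≡ true → P₁ ∨ (P₂ ∨ P₃) ≡ true
          at zero _ z≡ e = ∨-trueˡ (P₂ ∨ P₃) (∧-true
            (trans (cong (_==F b) (trans (cong (c *F_) z≡) (trans (lc-normalise₁ a d c cd 0) (+F-identityʳ b)))) (==F-refl b))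
            (false⇒not-true (trans (cong (λ v → V (g ⊕ v · t)) z≡) (trans (V-at-x₀ g) (¬true⇒false noU)))))
            where
            noU : U (g ⊖ r) ≡ true → ⊥
            noU q = true≢false (trans (cong (λ v → B (v ∷ g)) (sym z≡)) e) (trans (cong W (sym (⊖⊕-cancel g r))) (in-kU q))
          at (suc i) i≤ z≡ e = ∨-trueʳ P₁ (upper (m≤n⇒m<n∨m≡n i≤))
            where
            cz : c *F z ≡ b +F ι (suc i)
            cz = trans (cong (c *F_) z≡) (lc-normalise₁ a d c cd (suc i))
            upper : suc i < m ⊎ suc i ≡ m → P₂ ∨ P₃ ≡ true
            upper (inj₁ lt) = ∨-trueˡ P₃ (subst₂ (λ u v → inIntB (b +F ι 1) u v ≡ true) (sym middle)
              (trans (trans (+F-assoc b (ι 1) (ι i)) (cong (b +F_) (ι-+ 1 i))) (sym cz))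
              (inIntB⁺ (b +F ι 1) (m+n≤o⇒m≤o∸n i (≤-trans (≤-reflexive (+-comm i 1)) (≤-pred (≤-trans lt (≤-reflexive (sym M≡)))))) M′<p))
            upper (inj₂ eq) = ∨-trueʳ P₂ (∧-true (trans (cong (_==F (b +F ι m)) (trans cz (cong (λ j → b +F ι j) eq))) (==F-refl (b +F ι m)))
              (trans (cong (λ v → V (g ⊕ v · t)) z≡y) (trans (V-at-y g) (trans (cong (λ v → B (v ∷ g)) (sym z≡y)) e))))
              where
              z≡y : z ≡ y
              z≡y = trans z≡ (cong x eq)
          to : B (z ∷ g) ≡ true → P₁ ∨ (P₂ ∨ P₃) ≡ true
          to e = let i , i≤ , eq = cov z (support⁺ e) in at i i≤ eq e
          from₁ : P₁ ≡ true → B (z ∷ g) ≡ true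
          from₁ e = inW (bool-case (W g))
            where
            z≡ : z ≡ x 0
            z≡ = recover 0 (trans (==F⇒≡ (∧-trueˡ e)) (sym (+F-identityʳ b)))
            inW : W g ≡ true ⊎ W g ≡ false → B (z ∷ g) ≡ true
            inW (inj₁ q) = trans (cong (λ v → B (v ∷ g)) z≡) q
            inW (inj₂ q) = ⊥-elim (true≢false (trans (trans (cong (λ v → V (g ⊕ v · t)) z≡) (V-at-x₀ g)) (¬W⇒U q)) (not-true⇒false (∧-trueʳ {(c *F z) ==F b} e)))
          from₂ : P₂ ≡ true → B (z ∷ g) ≡ true
          from₂ e = let i , i≤ , eq = inIntB⁻ (b +F ι 1) M′<p (subst (λ u → inIntB (b +F ι 1) u (c *F z) ≡ true) middle e)
                        z≡ = recover (suc i) (trans eq (trans (+F-assoc b (ι 1) (ι i)) (cong (b +F_) (ι-+ 1 i))))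
                    in trans (cong (λ v → B (v ∷ g)) z≡) (size-full (others-full z≤n (≤-trans (s≤s i≤) (≤-reflexive (m+[n∸m]≡n (≤-trans (s≤s z≤n) 2≤M)))) (λ ()) small) g)
          from₃ : P₃ ≡ true → B (z ∷ g) ≡ true
          from₃ e = let z≡ = recover m (==F⇒≡ (∧-trueˡ e)) in
            trans (cong (λ v → B (v ∷ g)) z≡) (trans (sym (V-at-y g)) (trans (cong (λ v → V (g ⊕ v · t)) (sym z≡)) (∧-trueʳ {(c *F z) ==F (b +F ι m)} e)))
          from : P₁ ∨ (P₂ ∨ P₃) ≡ true → B (z ∷ g) ≡ true
          from e = Data.Sum.[ from₁ , (λ e′ → Data.Sum.[ from₂ , from₃ ]′ (∨-true⁻ {P₂} e′)) ]′ (∨-true⁻ {P₁} e)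

        V-proper : ∃ λ v → V v ≡ false
        V-proper = let g , e = support⁻ (x∈ 0 z≤n) in g ⊕ x 0 · t ,
          trans (V-at-x₀ g) (¬true⇒false λ q → true≢false e (trans (cong W (sym (⊖⊕-cancel g r))) (in-kU q)))

        type2 : Type2 k ℓ m B
        type2 = cong suc ℓ₀≡0 , s≤s 1≤n , V , (V-𝟘 , V-⊕ , V-·) , V-proper ,
          shear pr d t , shear-automorphism pr d t d≢0 , subst (λ b → ∀ z → B z ≡ type2Set b m V (shear pr d t z)) base iso

  normal : Normal k ℓ m λ' B
  normal = conclude result
    where
    conclude : Result → Normal k ℓ m λ' B
    conclude (inj₁ ext) = ⊥-elim (not-extremal ext)
    conclude (inj₂ (inj₁ (a , d , g₁ , g₂ , I , Ω⊆X))) = inj₁ (normal-interval I Ω⊆X)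
    conclude (inj₂ (inj₂ (a , d , g₁ , g₂ , I , y∈ , cov , κ≤ , ℓ≤))) = decide (k ≤? g₁)
      where
      decide : Dec (k ≤ g₁) → Normal k ℓ m λ' B
      -- With ℓ ≤ g₂ also g₁ ≤ k + λ, so k ≤ g₁ would make the set trivial. Since k - 2 ≤ g₁, only k
      -- - 2 and k - 1 remain, and the latter means ky = ℓa.
      decide (yes k≤) = ⊥-elim (extends-right I cov k≤ (lin 0 (≤-reflexive (Interval.total I) ⊹ ℓ≤) (eqn g₁ g₂ κ′ ℓ₀ λ')))
        where
        eqn : ∀ g₁ g₂ κ ℓ l → g₁ + (3 + suc κ + ℓ + l + g₂) + 0 ≡ 3 + κ + l + (g₁ + g₂ + suc ℓ)
        eqn = solve-∀
      decide (no k≰) = last-two (m≤n⇒m<n∨m≡n κ≤)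
        where
        last-two : suc κ′ < g₁ ⊎ suc κ′ ≡ g₁ → Normal k ℓ m λ' B
        last-two (inj₂ e) = ⊥-elim (Type2Case.gap≢k-2 I y∈ cov (sym e))
        last-two (inj₁ lt) = inj₂ (Type2Case.type2 I y∈ cov (≤-antisym (≤-pred (≰⇒> k≰)) lt))

-- Transport along the automorphism given by the decomposition.

module _ {p n : ℕ} .{{nz : NonZero p}} {A : SubsetF p (suc n)} {L : Pt p (suc n) → Pt p (suc n)} (aut : IsAutomorphism L) where

  private
    L⁻¹ = proj₁ (proj₂ aut)
    L-L⁻¹ = proj₂ (proj₂ (proj₂ aut))
    B : SubsetF p (suc n)
    B z = A (L z)

  SumFree-pull : ∀ {k ℓ} → SumFree k ℓ A → SumFree k ℓ B
  SumFree-pull ((x , ex) , sf) = (L⁻¹ x , trans (cong A (L-L⁻¹ x)) ex) ,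
    λ z i j → sf (L z) (InSumset-map {f = L} (proj₁ aut) (λ _ e → e) i) (InSumset-map {f = L} (proj₁ aut) (λ _ e → e) j)

  Iso-push : ∀ C → Iso B C → Iso A C
  Iso-push C (φ , autφ , eq) = (λ x → φ (L⁻¹ x)) , automorphism-∘ {f = φ} {L⁻¹} autφ (automorphism-inverse {f = L} aut) ,
    λ x → trans (cong A (sym (L-L⁻¹ x))) (eq (L⁻¹ x))

  IsoSub-push : ∀ C → IsoSub B C → IsoSub A C
  IsoSub-push C (φ , autφ , sub) = (λ x → φ (L⁻¹ x)) , automorphism-∘ {f = φ} {L⁻¹} autφ (automorphism-inverse {f = L} aut) ,
    λ x e → sub (L⁻¹ x) (trans (cong A (L-L⁻¹ x)) e)

  card-pull : card A ≤ card B
  card-pull = cnt-≤ L⁻¹ {A} {B} (allFinVec-unique p (suc n)) (allFinVec-complete p (suc n)) (λ x e → trans (cong A (L-L⁻¹ x)) e)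
    (λ x y _ _ e → trans (sym (L-L⁻¹ x)) (trans (cong L e) (L-L⁻¹ y)))

  Normal-push : ∀ {k ℓ m λ'} → Normal k ℓ m λ' B → Normal k ℓ m λ' A
  Normal-push {m = m} (inj₁ (a , iso , range)) = inj₁ (a , Iso-push (cuboid a (a +F ι (m ∸ 1))) iso , range)
  Normal-push {k} {ℓ} {m} (inj₂ (ℓ≡1 , 2≤n , V , sub , proper , iso)) =
    inj₂ (ℓ≡1 , 2≤n , V , sub , proper , Iso-push (type2Set ((ι m *F ι k) *F invF (ι ℓ -F ι k)) m V) iso)

support-≤-omega : ∀ {p n} .{{_ : NonZero p}} {A : SubsetF p (suc n)} {v K} (dec : Decomposition v K) →
  cardF (Slices.support (λ z → A (linComb z (v ∷ proj₁ (proj₂ (proj₁ dec)))))) ≤ omega A v K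
support-≤-omega {p} {n} {A} {v} {K} ((_ , bs , _ , mem) , _) = cnt-mono (allFin p) λ x e →
  let g , eg = Slices.support⁻ B e in
  any⁺ (λ a → A a ∧ K (a ⊖ (x · v))) (allFinVec-complete p (suc n) (linComb (x ∷ g) (v ∷ bs)))
    (∧-true eg (trans (cong K (trans (cong (_⊖ (x · v)) (⊕-comm (x · v) (linComb g bs))) (⊕⊖-cancel (linComb g bs) (x · v)))) (Equivalence.from (mem (linComb g bs)) (g , refl))))
  where
  B : SubsetF p (suc n)
  B z = A (linComb z (v ∷ bs))

theorem4p2 : (k ℓ λ' m p n : ℕ) →
    ℓ < k → 1 ≤ ℓ →
    λ' + 5 ≤ k + ℓ →
    7 ≤ m → k + ℓ ≤ m + 1 → FiveTBound (k + ℓ) m →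
    p ≡ (k + ℓ) * m + 2 + λ' → Prime p → .{{_ : NonZero p}} →
    2 ≤ n →
    (A : SubsetF p n) →
    SumFree k ℓ A → Nontrivial k ℓ m λ' A →
    m * p ^ (n ∸ 1) ≤ card A →
    (v : Pt p n) (K : SubsetF p n) → Decomposition v K →
    omega A v K ≤ m + 1 →
    Normal k ℓ m λ' A
theorem4p2 (suc (suc (suc κ))) (suc ℓ) λ' m p (suc n) ℓ<k _ hλ 7≤m s≤ five p≡ pr (s≤s 1≤n) A sf nontriv big v K dec ω≤ =
  Normal-push {A = A} aut {3 + κ} {suc ℓ} {m} {λ'} (Final.normal κ ℓ λ' m pr ℓ<k hλ 7≤m s≤ five p≡ (λ z → A (linComb z (v ∷ proj₁ (proj₂ (proj₁ dec)))))
    (SumFree-pull {A = A} aut sf) (λ j j< iso → nontriv j j< (IsoSub-push {A = A} aut (extremal (3 + κ) (suc ℓ) m j) iso)) 1≤n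
    (≤-trans big (card-pull {A = A} aut)) (≤-trans (support-≤-omega {A = A} {v} {K} dec) ω≤))
  where aut = decomposition-automorphism pr {n} {v} {K} dec
-- The bound λ + 5 ≤ k + ℓ rules out k = 2, ℓ = 1, so k ≥ 3: next to the two terms in X there is
-- always one left for y.
theorem4p2 (suc (suc zero)) (suc zero) λ' m p n _ _ hλ = ⊥-elim (1+n≰n (≤-trans (≤-trans (s≤s (s≤s (s≤s (s≤s z≤n)))) (m≤n+m 5 λ')) hλ))
theorem4p2 (suc zero) (suc _) λ' m p n (s≤s ())
theorem4p2 (suc (suc zero)) (suc (suc _)) λ' m p n (s≤s (s≤s ()))
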